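{- Let $\Theta$ be a relational language and let $\sqsubset\,\notin\Theta$ be a binary relational symbol. Then the category $\mathbf{Rel}_{srq}(\Theta,\sqsubset)$, whose objects are all finite linearly ordered reflexive $\Theta$-structures and whose morphisms are the strong rigid quotient maps of structures, has the dual Ramsey property.
   Context: A linearly ordered reflexive $\Theta$-structure is $\mathcal A=(A,\Theta^{\mathcal A},\sqsubset^{\mathcal A})$ where $\sqsubset^{\mathcal A}$ is a (strict) linear order on $A$ and each $\theta\in\Theta$ of arity $r$ is interpreted by a relation $\theta^{\mathcal A}\subseteq A^r$ containing all constant tuples $(a,a,\ldots,a)$, $a\in A$. A homomorphism $f:(A,\Theta^{\mathcal A})\to(B,\Theta^{\mathcal B})$ is a map $f:A\to B$ with $(a_1,\ldots,a_r)\in\theta^{\mathcal A}\Rightarrow(f(a_1),\ldots,f(a_r))\in\theta^{\mathcal B}$ for all $\theta\in\Theta$; it induces $\hat f:\theta^{\mathcal A}\to\theta^{\mathcal B}$, $\hat f(a_1,\ldots,a_r)=(f(a_1),\ldots,f(a_r))$. Rigid surjection: a surjection $f:(X,<)\to(Y,<')$ between finite chains such that $\min f^{ -1}(x)<\min f^{ -1}(y)$ whenever $x<'y$. Order on sets: for a finite chain $(A,\sqsubset)$ and distinct $X,Y\subseteq A$ put $X\sqsubset_{alex}Y$ iff $X\subsetneq Y$, or $X,Y$ are incomparable under inclusion and $\max(X\setminus Y)\sqsubset\max(Y\setminus X)$. For the chain $\{1<2<\cdots<r\}$ this order on subsets is written $<_{alex}$. Order on total quasiorders: a total quasiorder on $I=\{1,\ldots,r\}$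 is a reflexive transitive relation $\sigma$ in which any two elements are comparable; $i\equiv_\sigma j$ iff $(i,j),(j,i)\in\sigma$. For distinct total quasiorders $\sigma,\tau$ on $I$ enumerate the classes as $I/{\equiv_\sigma}=\{S_1<_{alex}S_2<_{alex}\cdots<_{alex}S_k\}$ and $I/{\equiv_\tau}=\{T_1<_{alex}T_2<_{alex}\cdots<_{alex}T_\ell\}$. Put $\sigma\triangleleft\tau$ if $k<\ell$, or $k=\ell$ and $(S_1,\ldots,S_k)$ precedes $(T_1,\ldots,T_k)$ anti-lexicographically, i.e. there is an $s$ with $S_s<_{alex}T_s$ and $S_j=T_j$ for all $j>s$. Order on tuples: for a finite chain $(A,\sqsubset)$ and $\bar a=(a_1,\ldots,a_r)\in A^r$ let $\mathrm{tp}(\bar a)=\{(i,j):a_i\sqsubseteq a_j\}$, a total quasiorder on $\{1,\ldots,r\}$. The special anti-lexicographic order $\sqsubset_{sal}$ on $A^r$ is defined as follows: if $\mathrm{tp}(\bar a)\triangleleft\mathrm{tp}(\bar b)$ then $\bar a\sqsubset_{sal}\bar b$; if $\mathrm{tp}(\bar a)=\mathrm{tp}(\bar b)$ and $\{a_1,\ldots,a_r\}\ne\{b_1,\ldots,b_r\}$ then $\bar a\sqsubset_{sal}\bar b$ iff $\{a_1,\ldots,a_r\}\sqsubset_{alex}\{b_1,\ldots,b_r\}$. (For $r=1$ this is $\sqsubset$.) A strong rigid quotient map of structures from $\mathcal A$ to $\mathcal B$ is a homomorphism $f:(A,\Theta^{\mathcal A})\to(B,\Theta^{\mathcal B})$ which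 is a rigid surjection $(A,\sqsubset^{\mathcal A})\to(B,\sqsubset^{\mathcal B})$ and such that for every $\theta\in\Theta$: (i) $\hat f:(\theta^{\mathcal A},\sqsubset^{\mathcal A}_{sal})\to(\theta^{\mathcal B},\sqsubset^{\mathcal B}_{sal})$ is a rigid surjection; (ii) for every $(x_1,\ldots,x_r)\in\theta^{\mathcal A}$, if the restriction of $f$ to $\{x_1,\ldots,x_r\}$ is not constant then $x_i\sqsubset^{\mathcal A}x_j\Rightarrow f(x_i)\sqsubset^{\mathcal B}f(x_j)$ for all $i,j$. A category $\mathbf C$ has the dual Ramsey property if for every integer $k\ge2$ and all objects $\mathcal A,\mathcal B$ with $\hom_{\mathbf C}(\mathcal B,\mathcal A)\neq\varnothing$ there is an object $\mathcal C$ such that for every coloring $\chi:\hom_{\mathbf C}(\mathcal C,\mathcal A)\to\{1,\ldots,k\}$ there is $w\in\hom_{\mathbf C}(\mathcal C,\mathcal B)$ such that $\chi$ is constant on $\{f\cdot w: f\in\hom_{\mathbf C}(\mathcal B,\mathcal A)\}$. -}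

module Defs where

open import Data.Empty using (⊥-elim)
open import Data.Fin.Base as Fin using (Fin)
import Data.Fin.Properties as Fin
open import Data.Fin.Subset as Subset using (Subset)
import Data.Fin.Subset.Properties as Subset
open import Data.List.Base as List using (List; []; _∷_)
import Data.List.Membership.Propositional as List
import Data.List.Membership.Propositional.Properties as List
open import Data.List.Relation.Unary.Any using (here; there)
open import Data.Nat.Base as ℕ using (ℕ)
import Data.Nat.Properties as ℕ
open import Data.Product.Base using (Σ; ∃; ∃₂; _×_; _,_; proj₁; proj₂)
open import Data.Sum.Base using (_⊎_; inj₁; inj₂)
open import Data.Vec.Base as Vec using (Vec; []; _∷_; lookup; map; replicate)
import Data.Vec.Membership.DecPropositional as DecVec
import Data.Vec.Membership.Propositional as Vec
open import Data.Vec.Properties using (map-id; map-∘; lookup-map)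
open import Data.Vec.Relation.Unary.All as All using (All)
open import Data.Vec.Relation.Unary.AllPairs using (AllPairs; []; _∷_)
import Data.Vec.Relation.Unary.Any as VecAny
open import Function.Base using (_∘_; id; flip; _on_)
open import Function.Bundles using (_↔_; Inverse; Func)
open import Function.Definitions using (Congruent; Surjective)
open import Level using (Level; 0ℓ; _⊔_) renaming (suc to lsuc)
open import Relation.Binary.Bundles using (Setoid)
open import Relation.Binary.Core using (Rel; _⇔_)
import Relation.Binary.Construct.On as On
open import Relation.Binary.Definitions
  using (tri<; tri≈; tri>; Transitive)
open import Relation.Binary.PropositionalEquality as ≡
  using (_≡_; refl; sym; trans; cong; subst; _≗_)
open import Relation.Binary.Structures
  using (IsStrictTotalOrder; IsStrictPartialOrder)
open import Relation.Nullary using (¬_; yes; no)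
open import Relation.Unary
  using (Pred; Decidable; _∈_; _∉_; _⊆_; _⊈_; _⊂_; _≐_; _∖_)

record Category (o ℓ e : Level) : Set (lsuc (o ⊔ ℓ ⊔ e)) where
  infixr 9 _·_
  field
    Obj       : Set o
    homSetoid : Obj → Obj → Setoid ℓ e

  Hom : Obj → Obj → Set ℓ
  Hom A B = Setoid.Carrier (homSetoid A B)

  _≈_ : ∀ {A B} → Rel (Hom A B) e
  _≈_ {A} {B} = Setoid._≈_ (homSetoid A B)

  field
    identity  : ∀ {A} → Hom A A
    _·_       : ∀ {A B C} → Hom B C → Hom A B → Hom A C
    identityˡ : ∀ {A B} (f : Hom A B) → (identity · f) ≈ f
    identityʳ : ∀ {A B} (f : Hom A B) → (f · identity) ≈ f
    assoc     : ∀ {A B C D} (h : Hom C D) (g : Hom B C) (f : Hom A B) →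
                ((h · g) · f) ≈ (h · (g · f))
    ·-cong    : ∀ {A B C} {g g′ : Hom B C} {f f′ : Hom A B} →
                g ≈ g′ → f ≈ f′ → (g · f) ≈ (g′ · f′)

-- Colorings are setoid functions, so that they are functions on the set
-- of morphisms modulo equality of morphisms.

DualRamsey : ∀ {o ℓ e} → Category o ℓ e → Set (o ⊔ ℓ ⊔ e)
DualRamsey 𝐂 =
  ∀ (k : ℕ) → 2 ℕ.≤ k → (A B : Obj) → Hom B A →
  ∃ λ (C : Obj) →
  ∀ (χ : Func (homSetoid C A) (≡.setoid (Fin k))) →
  ∃ λ (w : Hom C B) →
  ∀ (f g : Hom B A) → Func.to χ (f · w) ≡ Func.to χ (g · w)
  where open Category 𝐂

IsMin : {A : Set} (_≈_ _<_ : Rel A 0ℓ) → Pred A 0ℓ → Pred A 0ℓ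
IsMin _≈_ _<_ P m = m ∈ P × (∀ {x} → x ∈ P → m < x ⊎ m ≈ x)

-- In finite chains the minima of the fibres exist and are unique; rigid
-- exhibits them.
record IsRigidSurjection {X Y : Set}
  (_≈₁_ _<₁_ : Rel X 0ℓ) (_≈₂_ _<₂_ : Rel Y 0ℓ) (f : X → Y) : Set where

  fibre : Y → Pred X 0ℓ
  fibre y x = f x ≈₂ y

  field
    surjective : Surjective _≈₁_ _≈₂_ f
    rigid      : ∀ {x y} → x <₂ y →
                 ∃₂ λ a b → IsMin _≈₁_ _<₁_ (fibre x) a ×
                            IsMin _≈₁_ _<₁_ (fibre y) b ×
                            a <₁ b

module _ {X : Set} {_≈_ _<_ : Rel X 0ℓ} (P : IsStrictPartialOrder _≈_ _<_) where
  open IsStrictPartialOrder P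

  rigid-identity : {f : X → X} → (∀ x → f x ≈ x) →
                   IsRigidSurjection _≈_ _<_ _≈_ _<_ f
  rigid-identity f≈id = record
    { surjective = λ y → y , λ {z} z≈y → Eq.trans (f≈id z) z≈y
    ; rigid = λ {x} {y} x<y → x , y , min x , min y , x<y
    }
    where
    min : ∀ x → IsMin _≈_ _<_ _ x
    min x = f≈id x , λ {z} fz≈x → inj₂ (Eq.trans (Eq.sym fz≈x) (f≈id z))

module _ {X Y Z : Set}
  {_≈₁_ _<₁_ : Rel X 0ℓ} {_≈₂_ _<₂_ : Rel Y 0ℓ} {_≈₃_ _<₃_ : Rel Z 0ℓ}
  (P₁ : IsStrictPartialOrder _≈₁_ _<₁_)
  (P₂ : IsStrictPartialOrder _≈₂_ _<₂_)
  (P₃ : IsStrictPartialOrder _≈₃_ _<₃_)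
  where
  private
    module P₁ = IsStrictPartialOrder P₁
    module P₂ = IsStrictPartialOrder P₂
    module P₃ = IsStrictPartialOrder P₃

  rigid-compose : {f : X → Y} {g : Y → Z} {h : X → Z} →
                  Congruent _≈₂_ _≈₃_ g →
                  (∀ x → h x ≈₃ g (f x)) →
                  IsRigidSurjection _≈₁_ _<₁_ _≈₂_ _<₂_ f →
                  IsRigidSurjection _≈₂_ _<₂_ _≈₃_ _<₃_ g →
                  IsRigidSurjection _≈₁_ _<₁_ _≈₃_ _<₃_ h
  rigid-compose {f} {g} {h} g-cong h≈gf F G = record
    { surjective = λ z → let y , y↦ = G.surjective z ; x , x↦ = F.surjective y in
        x , λ {x′} x′≈x → P₃.Eq.trans (h≈gf x′) (y↦ (x↦ x′≈x))
    ; rigid = λ z<z′ →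
        let b , b′ , b-min , b′-min , b<b′ = G.rigid z<z′
            a , a′ , a-min , a′-min , a<a′ = F.rigid b<b′
        in a , a′ , min a-min b-min , min a′-min b′-min , a<a′
    }
    where
    module F = IsRigidSurjection F
    module G = IsRigidSurjection G

    join : ∀ {a a₂ a₃ c} → a <₁ a₂ ⊎ a ≈₁ a₂ → a₂ <₁ a₃ →
           a₃ <₁ c ⊎ a₃ ≈₁ c → a <₁ c
    join p q r = right (left p q) r
      where
      left : ∀ {a b c} → a <₁ b ⊎ a ≈₁ b → b <₁ c → a <₁ c
      left (inj₁ a<b) b<c = P₁.trans a<b b<c
      left (inj₂ a≈b) b<c = P₁.<-respˡ-≈ (P₁.Eq.sym a≈b) b<c
      right : ∀ {a b c} → a <₁ b → b <₁ c ⊎ b ≈₁ c → a <₁ c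
      right a<b (inj₁ b<c) = P₁.trans a<b b<c
      right a<b (inj₂ b≈c) = P₁.<-respʳ-≈ b≈c a<b

    min : ∀ {a b z} → IsMin _≈₁_ _<₁_ (F.fibre b) a →
          IsMin _≈₂_ _<₂_ (G.fibre z) b →
          IsMin _≈₁_ _<₁_ (λ x → h x ≈₃ z) a
    min {a} {b} {z} (fa≈b , a≤) (gb≈z , b≤) =
      P₃.Eq.trans (h≈gf a) (P₃.Eq.trans (g-cong fa≈b) gb≈z) , least
      where
      least : ∀ {c} → h c ≈₃ z → a <₁ c ⊎ a ≈₁ c
      least {c} hc≈z with b≤ {f c} (P₃.Eq.trans (P₃.Eq.sym (h≈gf c)) hc≈z)
      ... | inj₂ b≈fc = a≤ (P₂.Eq.sym b≈fc)
      ... | inj₁ b<fc with F.rigid b<fc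
      ... | a₂ , a₃ , (fa₂≈b , _) , (_ , a₃≤) , a₂<a₃ =
        inj₁ (join (a≤ fa₂≈b) a₂<a₃ (a₃≤ P₂.Eq.refl))

IsMax : {A : Set} (_⊏_ : Rel A 0ℓ) → Pred A 0ℓ → Pred A 0ℓ
IsMax _⊏_ = IsMin _≡_ (flip _⊏_)

Alex : {A : Set} (_⊏_ : Rel A 0ℓ) → Rel (Pred A 0ℓ) 0ℓ
Alex _⊏_ X Y =
  X ⊂ Y ⊎
  (X ⊈ Y × Y ⊈ X ×
   ∃₂ λ m n → IsMax _⊏_ (X ∖ Y) m × IsMax _⊏_ (Y ∖ X) n × m ⊏ n)

alex-irrefl : {A : Set} {_⊏_ : Rel A 0ℓ} {X Y : Pred A 0ℓ} →
              X ≐ Y → ¬ Alex _⊏_ X Y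
alex-irrefl (_   , Y⊆X) (inj₁ (_ , Y⊈X)) = Y⊈X Y⊆X
alex-irrefl (X⊆Y , _)   (inj₂ (X⊈Y , _)) = X⊈Y X⊆Y

alex-resp : {A : Set} {_⊏_ : Rel A 0ℓ} {X X′ Y Y′ : Pred A 0ℓ} →
            X ≐ X′ → Y ≐ Y′ → Alex _⊏_ X Y → Alex _⊏_ X′ Y′
alex-resp (x , x′) (y , y′) (inj₁ (p , q)) =
  inj₁ ((λ {_} → y ∘ p ∘ x′) , λ r → q (λ {_} → x′ ∘ r ∘ y))
alex-resp (x , x′) (y , y′)
  (inj₂ (p , q , m , n , ((m∈ , m∉) , m-max) , ((n∈ , n∉) , n-max) , m⊏n)) =
  inj₂ ( (λ r → p (λ {_} → y′ ∘ r ∘ x)) , (λ r → q (λ {_} → x′ ∘ r ∘ y)) , m , n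
       , ((x m∈ , m∉ ∘ y′) , λ (i , j) → m-max (x′ i , j ∘ y))
       , ((y n∈ , n∉ ∘ x′) , λ (i , j) → n-max (y′ i , j ∘ x))
       , m⊏n )

module AlexTransitive {A : Set} {_⊏_ : Rel A 0ℓ}
  (sto : IsStrictTotalOrder _≡_ _⊏_)
  (elements : List A) (complete : ∀ x → x List.∈ elements) where

  open IsStrictTotalOrder sto using (compare; irrefl) renaming (trans to ⊏-trans)

  max? : {P : Pred A 0ℓ} → Decidable P → (∀ x → x ∉ P) ⊎ ∃ (IsMax _⊏_ P)
  max? {P} P? with go elements
    where
    go : ∀ xs → (∀ x → x List.∈ xs → x ∉ P) ⊎
                ∃ λ m → m ∈ P × (∀ x → x List.∈ xs → x ∈ P → x ⊏ m ⊎ m ≡ x)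
    go [] = inj₁ λ _ ()
    go (x ∷ xs) with P? x | go xs
    ... | no x∉P | inj₁ none = inj₁ λ where
      _ (here refl) → x∉P
      y (there y∈)  → none y y∈
    ... | no x∉P | inj₂ (m , m∈ , m≥) = inj₂ (m , m∈ , λ where
      _ (here refl) y∈P → ⊥-elim (x∉P y∈P)
      y (there y∈)      → m≥ y y∈)
    ... | yes x∈P | inj₁ none = inj₂ (x , x∈P , λ where
      _ (here refl) _   → inj₂ refl
      y (there y∈)  y∈P → ⊥-elim (none y y∈ y∈P))
    ... | yes x∈P | inj₂ (m , m∈ , m≥) with compare x m
    ... | tri< x⊏m _ _ = inj₂ (m , m∈ , λ where
      _ (here refl) _ → inj₁ x⊏m
      y (there y∈)    → m≥ y y∈)
    ... | tri≈ _ refl _ = inj₂ (m , m∈ , λ where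
      _ (here refl) _ → inj₂ refl
      y (there y∈)    → m≥ y y∈)
    ... | tri> _ _ m⊏x = inj₂ (x , x∈P , λ where
      _ (here refl) _   → inj₂ refl
      y (there y∈)  y∈P → inj₁ (below (m≥ y y∈ y∈P)))
      where
      below : ∀ {y} → y ⊏ m ⊎ m ≡ y → y ⊏ x
      below (inj₁ y⊏m) = ⊏-trans y⊏m m⊏x
      below (inj₂ refl) = m⊏x
  ... | inj₁ none            = inj₁ λ x → none x (complete x)
  ... | inj₂ (m , m∈ , m≥) = inj₂ (m , m∈ , λ {x} → m≥ x (complete x))

  ∖? : {X Y : Pred A 0ℓ} → Decidable X → Decidable Y → Decidable (X ∖ Y)
  ∖? X? Y? x with X? x | Y? x
  ... | yes p | no q  = yes (p , q)
  ... | no p  | _     = no λ (p′ , _) → p p′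
  ... | _     | yes q = no λ (_ , ¬q) → ¬q q

  stable : {X : Pred A 0ℓ} → Decidable X → ∀ {x} → ¬ (x ∉ X) → x ∈ X
  stable X? {x} ¬¬x with X? x
  ... | yes p = p
  ... | no p  = ⊥-elim (¬¬x p)

  -- The largest element on which X and Y differ belongs to Y.
  Witness : Pred A 0ℓ → Pred A 0ℓ → Pred A 0ℓ
  Witness X Y m = m ∉ X × m ∈ Y × (∀ {x} → m ⊏ x → (x ∈ X → x ∈ Y) × (x ∈ Y → x ∈ X))

  not-below : ∀ {m x} → m ⊏ x → ¬ (x ⊏ m ⊎ m ≡ x)
  not-below m⊏x (inj₁ x⊏m)  = irrefl refl (⊏-trans m⊏x x⊏m)
  not-below m⊏x (inj₂ refl) = irrefl refl m⊏x

  to-witness : {X Y : Pred A 0ℓ} → Decidable X → Decidable Y →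
               Alex _⊏_ X Y → ∃ (Witness X Y)
  to-witness X? Y? (inj₁ (X⊆Y , Y⊈X)) with max? (∖? Y? X?)
  ... | inj₁ none =
    ⊥-elim (Y⊈X λ {x} x∈Y → stable X? λ x∉X → none x (x∈Y , x∉X))
  ... | inj₂ (m , (m∈Y , m∉X) , m≥) =
    m , m∉X , m∈Y , λ m⊏x →
      (λ x∈X → X⊆Y x∈X) ,
      (λ x∈Y → stable X? λ x∉X → not-below m⊏x (m≥ (x∈Y , x∉X)))
  to-witness X? Y? (inj₂ (_ , _ , m , n , (_ , m≥) , ((n∈Y , n∉X) , n≥) , m⊏n)) =
    n , n∉X , n∈Y , λ n⊏x →
      (λ x∈X → stable Y? λ x∉Y → not-below (⊏-trans m⊏n n⊏x) (m≥ (x∈X , x∉Y))) ,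
      (λ x∈Y → stable X? λ x∉X → not-below n⊏x (n≥ (x∈Y , x∉X)))

  from-witness : {X Y : Pred A 0ℓ} → Decidable X → Decidable Y →
                 ∃ (Witness X Y) → Alex _⊏_ X Y
  from-witness X? Y? (m , m∉X , m∈Y , above) with max? (∖? X? Y?)
  ... | inj₁ none =
    inj₁ ( (λ {x} x∈X → stable Y? λ x∉Y → none x (x∈X , x∉Y))
         , λ Y⊆X → m∉X (Y⊆X m∈Y) )
  ... | inj₂ (p , (p∈X , p∉Y) , p≥) with max? (∖? Y? X?)
  ... | inj₁ none = ⊥-elim (none m (m∈Y , m∉X))
  ... | inj₂ (q , q∈ , q≥) =
    inj₂ ( (λ X⊆Y → p∉Y (X⊆Y p∈X)) , (λ Y⊆X → m∉X (Y⊆X m∈Y))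
         , p , q , ((p∈X , p∉Y) , p≥) , (q∈ , q≥) , p⊏q (compare p m) (q≥ (m∈Y , m∉X)) )
    where
    p⊏q : _ → m ⊏ q ⊎ q ≡ m → p ⊏ q
    p⊏q (tri< p⊏m _ _) (inj₁ m⊏q)  = ⊏-trans p⊏m m⊏q
    p⊏q (tri< p⊏m _ _) (inj₂ refl) = p⊏m
    p⊏q (tri≈ _ refl _) _ = ⊥-elim (m∉X p∈X)
    p⊏q (tri> _ _ m⊏p) _ = ⊥-elim (p∉Y (proj₁ (above m⊏p) p∈X))

  alex-trans : {X Y Z : Pred A 0ℓ} → Decidable X → Decidable Y → Decidable Z →
               Alex _⊏_ X Y → Alex _⊏_ Y Z → Alex _⊏_ X Z
  alex-trans {X} {Y} {Z} X? Y? Z? X<Y Y<Z =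
    from-witness X? Z? (go (to-witness X? Y? X<Y) (to-witness Y? Z? Y<Z))
    where
    go : ∃ (Witness X Y) → ∃ (Witness Y Z) → ∃ (Witness X Z)
    go (m , m∉X , m∈Y , XY) (n , n∉Y , n∈Z , YZ) with compare m n
    ... | tri< m⊏n _ _ = n , n∉Y ∘ proj₁ (XY m⊏n) , n∈Z , λ n⊏x →
      let m⊏x = ⊏-trans m⊏n n⊏x in
      proj₁ (YZ n⊏x) ∘ proj₁ (XY m⊏x) , proj₂ (XY m⊏x) ∘ proj₂ (YZ n⊏x)
    ... | tri≈ _ refl _ = ⊥-elim (n∉Y m∈Y)
    ... | tri> _ _ n⊏m = m , m∉X , proj₁ (YZ n⊏m) m∈Y , λ m⊏x →
      let n⊏x = ⊏-trans n⊏m m⊏x in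
      proj₁ (YZ n⊏x) ∘ proj₁ (XY m⊏x) , proj₂ (XY m⊏x) ∘ proj₂ (YZ n⊏x)

infix 4 _<alex_ _◁_

_<alex_ : ∀ {r} → Rel (Subset r) 0ℓ
S <alex T = Alex Fin._<_ (Subset._∈ S) (Subset._∈ T)

IsClass : ∀ {r} → Rel (Fin r) 0ℓ → Pred (Subset r) 0ℓ
IsClass σ S = ∃ λ i → (Subset._∈ S) ≐ (λ j → σ i j × σ j i)

record Enumerates {r k} (σ : Rel (Fin r) 0ℓ) (Ss : Vec (Subset r) k) : Set where
  field
    increasing : AllPairs _<alex_ Ss
    classes    : (Vec._∈ Ss) ≐ IsClass σ

-- Intended for total quasiorders, whose classes have exactly one increasing
-- enumeration; the definition makes sense for arbitrary relations.
data _◁_ {r} (σ τ : Rel (Fin r) 0ℓ) : Set where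
  fewer  : ∀ {k ℓ} {Ss : Vec (Subset r) k} {Ts : Vec (Subset r) ℓ} →
           Enumerates σ Ss → Enumerates τ Ts → k ℕ.< ℓ → σ ◁ τ
  anti-lexicographic :
           ∀ {k} {Ss Ts : Vec (Subset r) k} →
           Enumerates σ Ss → Enumerates τ Ts →
           (s : Fin k) → lookup Ss s <alex lookup Ts s →
           (∀ j → s Fin.< j → lookup Ss j ≡ lookup Ts j) → σ ◁ τ

module _ {r : ℕ} where

  private
    ∈ₛ? : (S : Subset r) → Decidable (Subset._∈ S)
    ∈ₛ? S x = x Subset.∈? S

  <alex-irrefl : {S T : Subset r} → S ≡ T → ¬ (S <alex T)
  <alex-irrefl {S} refl =
    alex-irrefl {X = Subset._∈ S} {Y = Subset._∈ S} ((λ x → x) , (λ x → x))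

  <alex-trans : Transitive (_<alex_ {r})
  <alex-trans {S} {T} {U} =
    AlexTransitive.alex-trans Fin.<-isStrictTotalOrder
      (List.allFin r) List.∈-allFin (∈ₛ? S) (∈ₛ? T) (∈ₛ? U)

  private
    sorted-unique : ∀ {k ℓ} {Ss : Vec (Subset r) k} {Ts : Vec (Subset r) ℓ} →
                    AllPairs _<alex_ Ss → AllPairs _<alex_ Ts →
                    (Vec._∈ Ss) ≐ (Vec._∈ Ts) → (k , Ss) ≡ (ℓ , Ts)
    sorted-unique [] [] _ = refl
    sorted-unique [] (_ ∷ _) (_ , q) with () ← q (VecAny.here refl)
    sorted-unique (_ ∷ _) [] (p , _) with () ← p (VecAny.here refl)
    sorted-unique {Ss = S ∷ Ss} {T ∷ Ts} (S< ∷ Ss↑) (T< ∷ Ts↑) (p , q)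
      with heads (p (VecAny.here refl)) (q (VecAny.here refl))
      where
      heads : S Vec.∈ (T ∷ Ts) → T Vec.∈ (S ∷ Ss) → S ≡ T
      heads (VecAny.here S≡T) _ = S≡T
      heads (VecAny.there _) (VecAny.here T≡S) = sym T≡S
      heads (VecAny.there S∈) (VecAny.there T∈) = ⊥-elim
        (<alex-irrefl refl (<alex-trans (All.lookup T< S∈) (All.lookup S< T∈)))
    ... | refl with sorted-unique Ss↑ Ts↑
                      ( (λ U∈ → tail (All.lookup S< U∈) (p (VecAny.there U∈)))
                      , (λ U∈ → tail (All.lookup T< U∈) (q (VecAny.there U∈))) )
      where
      tail : ∀ {U n} {Us : Vec (Subset r) n} → S <alex U → U Vec.∈ (S ∷ Us) → U Vec.∈ Us
      tail S<U (VecAny.here refl) = ⊥-elim (<alex-irrefl refl S<U)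
      tail _   (VecAny.there U∈)  = U∈
    ... | refl = refl

  class-resp : {σ τ : Rel (Fin r) 0ℓ} → σ ⇔ τ → ∀ {S} → IsClass σ S → IsClass τ S
  class-resp (to , from) (i , p , q) =
    i , (λ j∈ → let a , b = p j∈ in to a , to b)
      , (λ (a , b) → q (from a , from b))

  enumeration-unique :
    ∀ {σ τ : Rel (Fin r) 0ℓ} {k ℓ} {Ss : Vec (Subset r) k} {Ts : Vec (Subset r) ℓ} →
    σ ⇔ τ → Enumerates σ Ss → Enumerates τ Ts → (k , Ss) ≡ (ℓ , Ts)
  enumeration-unique (σ⇒τ , τ⇒σ) E F =
    sorted-unique E.increasing F.increasing
      ( (λ S∈ → proj₂ F.classes (class-resp (σ⇒τ , τ⇒σ) (proj₁ E.classes S∈)))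
      , (λ S∈ → proj₂ E.classes (class-resp (τ⇒σ , σ⇒τ) (proj₁ F.classes S∈))) )
    where
    module E = Enumerates E
    module F = Enumerates F

  ◁-irrefl : {σ τ : Rel (Fin r) 0ℓ} → σ ⇔ τ → ¬ (σ ◁ τ)
  ◁-irrefl σ⇔τ (fewer E F k<ℓ) with enumeration-unique σ⇔τ E F
  ... | refl = ℕ.<-irrefl refl k<ℓ
  ◁-irrefl σ⇔τ (anti-lexicographic E F s S<T _) with enumeration-unique σ⇔τ E F
  ... | refl = <alex-irrefl refl S<T

  -- Transitivity, allowing the two middle quasiorders to be merely
  -- extensionally equal.
  ◁-trans : {σ τ τ′ υ : Rel (Fin r) 0ℓ} → τ ⇔ τ′ → σ ◁ τ → τ′ ◁ υ → σ ◁ υ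
  ◁-trans eq (fewer D E p) (fewer E′ F q) with enumeration-unique eq E E′
  ... | refl = fewer D F (ℕ.<-trans p q)
  ◁-trans eq (fewer D E p) (anti-lexicographic E′ F _ _ _)
    with enumeration-unique eq E E′
  ... | refl = fewer D F p
  ◁-trans eq (anti-lexicographic D E _ _ _) (fewer E′ F q)
    with enumeration-unique eq E E′
  ... | refl = fewer D F q
  ◁-trans eq (anti-lexicographic D E s p p=) (anti-lexicographic E′ F t q q=)
    with enumeration-unique eq E E′
  ... | refl with Fin.<-cmp s t
  ... | tri< s<t _ _ = anti-lexicographic D F t
    (subst (_<alex _) (sym (p= t s<t)) q)
    (λ j t<j → trans (p= j (Fin.<-trans s<t t<j)) (q= j t<j))
  ... | tri≈ _ refl _ = anti-lexicographic D F s
    (<alex-trans p q) (λ j s<j → trans (p= j s<j) (q= j s<j))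
  ... | tri> _ _ t<s = anti-lexicographic D F s
    (subst (_ <alex_) (q= s t<s) p)
    (λ j s<j → trans (p= j s<j) (q= j (Fin.<-trans t<s s<j)))

  enumerates-resp : {σ τ : Rel (Fin r) 0ℓ} → σ ⇔ τ → ∀ {k} {Ss : Vec (Subset r) k} →
                    Enumerates σ Ss → Enumerates τ Ss
  enumerates-resp (to , from) E = record
    { increasing = increasing
    ; classes    = class-resp (to , from) ∘ proj₁ classes
                 , proj₂ classes ∘ class-resp (from , to)
    }
    where open Enumerates E

  ◁-resp : {σ σ′ τ τ′ : Rel (Fin r) 0ℓ} → σ ⇔ σ′ → τ ⇔ τ′ → σ ◁ τ → σ′ ◁ τ′
  ◁-resp σ τ (fewer E F p) =
    fewer (enumerates-resp σ E) (enumerates-resp τ F) p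
  ◁-resp σ τ (anti-lexicographic E F s p q) =
    anti-lexicographic (enumerates-resp σ E) (enumerates-resp τ F) s p q

tp : {A : Set} (_⊏_ : Rel A 0ℓ) {r : ℕ} → Vec A r → Rel (Fin r) 0ℓ
tp _⊏_ a i j = lookup a i ⊏ lookup a j ⊎ lookup a i ≡ lookup a j

entries : {A : Set} {r : ℕ} → Vec A r → Pred A 0ℓ
entries a x = x Vec.∈ a

Sal : {A : Set} (_⊏_ : Rel A 0ℓ) {r : ℕ} → Rel (Vec A r) 0ℓ
Sal _⊏_ a b =
  tp _⊏_ a ◁ tp _⊏_ b ⊎
  (tp _⊏_ a ⇔ tp _⊏_ b × ¬ (entries a ≐ entries b) ×
   Alex _⊏_ (entries a) (entries b))

sal-isStrictPartialOrder :
  {A : Set} {_⊏_ : Rel A 0ℓ} → IsStrictTotalOrder _≡_ _⊏_ →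
  (elements : List A) → (∀ x → x List.∈ elements) →
  ∀ {r} → IsStrictPartialOrder _≡_ (Sal _⊏_ {r})
sal-isStrictPartialOrder {A} {_⊏_} sto elements complete {r} = record
  { isEquivalence = ≡.isEquivalence
  ; irrefl        = λ where
      refl (inj₁ p)           → ◁-irrefl (id , id) p
      refl (inj₂ (_ , a≢b , _)) → a≢b (id , id)
  ; trans         = sal-trans
  ; <-resp-≈      = (λ { refl p → p }) , (λ { refl p → p })
  }
  where
  open AlexTransitive sto elements complete
  open DecVec (IsStrictTotalOrder._≟_ sto) using (_∈?_)

  entries? : (a : Vec A r) → Decidable (entries a)
  entries? a x = x ∈? a

  sal-trans : Transitive (Sal _⊏_ {r})
  sal-trans (inj₁ p) (inj₁ q) = inj₁ (◁-trans (id , id) p q)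
  sal-trans (inj₁ p) (inj₂ (q , _)) = inj₁ (◁-resp (id , id) q p)
  sal-trans (inj₂ ((p , p′) , _)) (inj₁ q) = inj₁ (◁-resp (p′ , p) (id , id) q)
  sal-trans {a} {b} {c} (inj₂ ((p , p′) , _ , a<b)) (inj₂ ((q , q′) , _ , b<c)) =
    inj₂ ((q ∘ p , p′ ∘ q′) , (λ a≐c → alex-irrefl a≐c a<c) , a<c)
    where
    a<c : Alex _⊏_ (entries a) (entries c)
    a<c = alex-trans (entries? a) (entries? b) (entries? c) a<b b<c

record Language : Set₁ where
  field
    Symbol : Set
    arity  : Symbol → ℕ

-- The linear order is a separate component of a structure, so that its
-- symbol is automatically distinct from those of the language.

record Structure (Θ : Language) : Set₁ where
  open Language Θ
  infix 4 _⊏_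
  field
    Carrier            : Set
    finite             : ∃ λ n → Carrier ↔ Fin n
    _⊏_                : Rel Carrier 0ℓ
    isStrictTotalOrder : IsStrictTotalOrder _≡_ _⊏_
    rel                : (θ : Symbol) → Pred (Vec Carrier (arity θ)) 0ℓ
    reflexive          : ∀ θ a → replicate (arity θ) a ∈ rel θ

  -- rel θ a need not be a proposition, so elements of Tuples θ are compared
  -- through their underlying tuples.
  Tuples : Symbol → Set
  Tuples θ = Σ (Vec Carrier (arity θ)) (rel θ)

  infix 4 _≈ᵗ_ _⊏sal_

  _≈ᵗ_ : ∀ {θ} → Rel (Tuples θ) 0ℓ
  _≈ᵗ_ = _≡_ on proj₁

  _⊏sal_ : ∀ {θ} → Rel (Tuples θ) 0ℓ
  _⊏sal_ = Sal _⊏_ on proj₁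

  elements : List Carrier
  elements = List.map (Inverse.from (proj₂ finite)) (List.allFin _)

  elements-complete : ∀ x → x List.∈ elements
  elements-complete x = subst (List._∈ elements)
    (Inverse.strictlyInverseʳ (proj₂ finite) x)
    (List.∈-map⁺ (Inverse.from (proj₂ finite)) (List.∈-allFin _))

  ⊏-isStrictPartialOrder : IsStrictPartialOrder _≡_ _⊏_
  ⊏-isStrictPartialOrder = IsStrictTotalOrder.isStrictPartialOrder isStrictTotalOrder

  ⊏sal-isStrictPartialOrder : ∀ {θ} → IsStrictPartialOrder (_≈ᵗ_ {θ}) _⊏sal_
  ⊏sal-isStrictPartialOrder = On.isStrictPartialOrder proj₁
    (sal-isStrictPartialOrder isStrictTotalOrder elements elements-complete)

module _ {Θ : Language} where
  open Language Θ

  IsHomomorphism : (𝓐 𝓑 : Structure Θ) →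
                   (Structure.Carrier 𝓐 → Structure.Carrier 𝓑) → Set
  IsHomomorphism 𝓐 𝓑 f = ∀ {θ a} → a ∈ 𝓐.rel θ → map f a ∈ 𝓑.rel θ
    where
    module 𝓐 = Structure 𝓐
    module 𝓑 = Structure 𝓑

  record StrongRigidQuotient (𝓐 𝓑 : Structure Θ) : Set where
    private
      module 𝓐 = Structure 𝓐
      module 𝓑 = Structure 𝓑
    field
      fun             : 𝓐.Carrier → 𝓑.Carrier
      isHomomorphism  : IsHomomorphism 𝓐 𝓑 fun
      rigidSurjection : IsRigidSurjection _≡_ 𝓐._⊏_ _≡_ 𝓑._⊏_ fun

    hat : ∀ θ → 𝓐.Tuples θ → 𝓑.Tuples θ
    hat θ (a , a∈θ) = map fun a , isHomomorphism a∈θ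

    field
      hatRigidSurjection :
        ∀ θ → IsRigidSurjection 𝓐._≈ᵗ_ 𝓐._⊏sal_ 𝓑._≈ᵗ_ 𝓑._⊏sal_ (hat θ)
      strong :
        ∀ {θ x} → x ∈ 𝓐.rel θ →
        ¬ (∀ i j → fun (lookup x i) ≡ fun (lookup x j)) →
        ∀ i j → lookup x i 𝓐.⊏ lookup x j → fun (lookup x i) 𝓑.⊏ fun (lookup x j)

  open StrongRigidQuotient

  identityMap : ∀ {𝓐} → StrongRigidQuotient 𝓐 𝓐
  identityMap {𝓐} = record
    { fun                = id
    ; isHomomorphism     = λ {θ} {a} → subst (𝓐.rel θ) (sym (map-id a))
    ; rigidSurjection    = rigid-identity 𝓐.⊏-isStrictPartialOrder λ _ → refl
    ; hatRigidSurjection = λ θ →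
        rigid-identity (𝓐.⊏sal-isStrictPartialOrder {θ}) λ (a , _) → map-id a
    ; strong             = λ _ _ _ _ → id
    }
    where module 𝓐 = Structure 𝓐

  composeMap : ∀ {𝓐 𝓑 𝓒} → StrongRigidQuotient 𝓑 𝓒 → StrongRigidQuotient 𝓐 𝓑 →
               StrongRigidQuotient 𝓐 𝓒
  composeMap {𝓐} {𝓑} {𝓒} g f = record
    { fun                = fun g ∘ fun f
    ; isHomomorphism     = λ {θ} {a} a∈θ →
        subst (𝓒.rel θ) (sym (map-∘ (fun g) (fun f) a))
              (isHomomorphism g (isHomomorphism f a∈θ))
    ; rigidSurjection    = rigid-compose
        𝓐.⊏-isStrictPartialOrder 𝓑.⊏-isStrictPartialOrder 𝓒.⊏-isStrictPartialOrder
        (cong (fun g)) (λ _ → refl) (rigidSurjection f) (rigidSurjection g)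
    ; hatRigidSurjection = λ θ → rigid-compose
        (𝓐.⊏sal-isStrictPartialOrder {θ}) (𝓑.⊏sal-isStrictPartialOrder {θ})
        (𝓒.⊏sal-isStrictPartialOrder {θ})
        (cong (map (fun g))) (λ (a , _) → map-∘ (fun g) (fun f) a)
        (hatRigidSurjection f θ) (hatRigidSurjection g θ)
    ; strong             = λ {θ} {x} x∈θ nonconstant i j xᵢ⊏xⱼ →
        let eq : ∀ i → lookup (map (fun f) x) i ≡ fun f (lookup x i)
            eq i = lookup-map i (fun f) x

            fxᵢ⊏fxⱼ = strong f x∈θ (λ c → nonconstant λ i j → cong (fun g) (c i j))
                             i j xᵢ⊏xⱼ

            gf = strong g (isHomomorphism f x∈θ)
              (λ c → nonconstant λ i j →
                trans (cong (fun g) (sym (eq i)))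
                      (trans (c i j) (cong (fun g) (eq j))))
              i j (≡.subst₂ 𝓑._⊏_ (sym (eq i)) (sym (eq j)) fxᵢ⊏fxⱼ)
        in ≡.subst₂ (λ u v → fun g u 𝓒.⊏ fun g v) (eq i) (eq j) gf
    }
    where
    module 𝓐 = Structure 𝓐
    module 𝓑 = Structure 𝓑
    module 𝓒 = Structure 𝓒

Rel-srq : Language → Category (lsuc 0ℓ) 0ℓ 0ℓ
Rel-srq Θ = record
  { Obj       = Structure Θ
  ; homSetoid = λ 𝓐 𝓑 → record
      { Carrier       = StrongRigidQuotient 𝓐 𝓑
      ; _≈_           = λ f g → fun f ≗ fun g
      ; isEquivalence = record
          { refl  = λ _ → refl
          ; sym   = λ p x → sym (p x)
          ; trans = λ p q x → trans (p x) (q x)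
          }
      }
  ; identity  = identityMap
  ; _·_       = composeMap
  ; identityˡ = λ _ _ → refl
  ; identityʳ = λ _ _ → refl
  ; assoc     = λ _ _ _ _ → refl
  ; ·-cong    = λ {_} {_} {_} {g} {g′} {f} {f′} p q x →
      trans (cong (fun g) (q x)) (p (fun f′ x))
  }
  where open StrongRigidQuotient

{-# OPTIONS --safe #-}

-- Attach to a structure the chain of its items: first all vertices, then, pattern
-- by pattern, the edges (supports of nonconstant tuples) in anti-lexicographic
-- order.  A strong rigid quotient map either collapses an edge to a vertex or maps
-- it monotonically onto an edge, hence acts on items, and this action is a rigid
-- surjection of chains.  Conversely let 𝓒 consist of n consecutive blocks, each
-- with an edge of every pattern.  A rigid surjection from n onto the items of 𝓧
-- yields a strong rigid quotient map 𝓒 → 𝓧: block j maps onto the item at j, its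
-- edge of the right pattern monotonically, and all its other cells to the least
-- vertex of the item.  This is natural in 𝓧, so the dual Ramsey theorem for finite
-- chains (Graham and Rothschild) transfers to structures.
module Submission where

open import Defs
open import Axiom.ExcludedMiddle using (ExcludedMiddle)
open import Level using (0ℓ)
open import Data.Bool.Base using (Bool; true)
open import Data.Empty using (⊥-elim)
open import Data.Fin.Base as Fin using (Fin; zero; suc; toℕ)
import Data.Fin.Properties as Fin
open import Data.Fin.Subset as Subset using (Subset)
import Data.Fin.Subset.Properties as Subset
open import Data.List.Base as List using (List; []; _∷_; length)
import Data.List.Membership.Propositional as List
import Data.List.Membership.Propositional.Properties as List
import Data.List.Properties as List
open import Data.List.Relation.Unary.All as All using (All; []; _∷_)
import Data.List.Relation.Unary.All.Properties as All
open import Data.List.Relation.Unary.AllPairs using (AllPairs; []; _∷_)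
open import Data.List.Relation.Unary.Any using (here; there)
open import Data.Nat.Base as ℕ using (ℕ; zero; suc; _+_; _^_; _≤_; _<_; z≤n; s≤s; s≤s⁻¹)
open import Data.Nat.ListAction using (sum)
import Data.Nat.Properties as ℕ
open import Data.Product.Base using (Σ; ∃; ∃₂; _×_; _,_; proj₁; proj₂)
open import Data.Product.Function.NonDependent.Propositional using (_×-↔_)
open import Data.Sum.Base as Sum using (_⊎_; inj₁; inj₂)
open import Data.Unit.Base using (⊤; tt)
open import Data.Vec.Base as Vec using (Vec; []; _∷_; lookup; tabulate)
import Data.Vec.Membership.Propositional as Vec
import Data.Vec.Membership.Propositional.Properties as Vec
import Data.Vec.Properties as Vec
import Data.Vec.Relation.Unary.All as VecAll
import Data.Vec.Relation.Unary.All.Properties as VecAll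
open import Data.Vec.Relation.Unary.AllPairs as VecAllPairs using ([]; _∷_)
import Data.Vec.Relation.Unary.Any as VecAny
open import Function.Base using (_∘_; id; flip; case_of_)
open import Function.Bundles using (Func)
open import Function.Properties.Inverse using (↔-refl; ↔-sym; ↔-trans)
open import Relation.Binary.Core using (Rel; _⇔_)
open import Relation.Binary.Definitions using (tri<; tri≈; tri>)
open import Relation.Binary.PropositionalEquality
open import Relation.Binary.Structures using (IsStrictTotalOrder; IsStrictPartialOrder)
open import Relation.Nullary using (¬_; Dec; yes; no; does)
open import Relation.Unary using (Pred; _≐_; Decidable; _∈_)
open import Relation.Unary.Properties using (≐-sym; ≐-trans)

-- A strong map is increasing on every related tuple with nonconstant image, so it preserves the
-- type of such a tuple. Hence all preimages of a nonconstant tuple have its type, and the special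
-- order compares them by their supports alone. Constant tuples have the fewest classes and precede
-- all others. This is why an edge can stand for a tuple and why the patterns may follow each other
-- in any order. Vertices, however, must come first: a collapsed edge drops to a vertex, and every
-- item below that vertex needs a preimage before the edge. Each block carries all patterns because
-- 𝓒 is fixed before it is known which item lands on which block; an edge of the wrong pattern goes
-- to a single vertex, where the strong condition is void. The theorem on chains is proved for words
-- with letters, since a parameter acts as a letter once it has occurred and since Hales-Jewett, the
-- case of no parameters in the coloured words, needs an alphabet. A colouring is made to depend
-- only on the letters before the first parameter, then only on their number, then on nothing.

-- Words with letters and parameters, and their composition

-- Word c n m: words of length n over c letters and m parameters whose first
-- occurrences are in order.  From its first occurrence on, a parameter is a
-- letter, with de Bruijn index zero at that moment.
data Word (c : ℕ) : ℕ → ℕ → Set where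
  []  : Word c 0 0
  old : ∀ {n m} → Fin c → Word c n m → Word c (suc n) m
  new : ∀ {n m} → Word (suc c) n m → Word c (suc n) (suc m)

infixr 5 _▹_
_▹_ : ∀ {A : Set} {c} → A → (Fin c → A) → Fin (suc c) → A
(a ▹ ρ) zero    = a
(a ▹ ρ) (suc x) = ρ x

under : ∀ {c d} → (Fin c → Fin d) → Fin (suc c) → Fin (suc d)
under ρ = zero ▹ suc ∘ ρ

rename : ∀ {c d n m} → (Fin c → Fin d) → Word c n m → Word d n m
rename ρ []        = []
rename ρ (old x w) = old (ρ x) (rename ρ w)
rename ρ (new w)   = new (rename (under ρ) w)

-- The letters of f are substituted for the parameters of v.
comp : ∀ {c d n m l} → Word c n m → (Fin c → Fin d) → Word d m l → Word d n l
comp []        ρ []        = []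
comp (old x v) ρ f         = old (ρ x) (comp v ρ f)
comp (new v)   ρ (old y f) = old y (comp v (y ▹ ρ) f)
comp (new v)   ρ (new f)   = new (comp v (under ρ) f)

infixr 9 _⊙_
_⊙_ : ∀ {c n m l} → Word c n m → Word c m l → Word c n l
v ⊙ f = comp v id f

▹-cong : ∀ {A : Set} {c} {a : A} {ρ σ : Fin c → A} → ρ ≗ σ → a ▹ ρ ≗ a ▹ σ
▹-cong p zero    = refl
▹-cong p (suc x) = p x

▹-η : ∀ {A : Set} {c} {ρ : Fin (suc c) → A} → (ρ zero ▹ ρ ∘ suc) ≗ ρ
▹-η zero    = refl
▹-η (suc x) = refl

∘-▹ : ∀ {A B : Set} {c} (h : A → B) {a : A} {ρ : Fin c → A} →
      h ∘ (a ▹ ρ) ≗ h a ▹ h ∘ ρ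
∘-▹ h zero    = refl
∘-▹ h (suc x) = refl

under-∘ : ∀ {c d e} {σ : Fin d → Fin e} {ρ : Fin c → Fin d} →
         under σ ∘ under ρ ≗ under (σ ∘ ρ)
under-∘ zero    = refl
under-∘ (suc x) = refl

rename-cong : ∀ {c d n m} {ρ σ : Fin c → Fin d} → ρ ≗ σ → (w : Word c n m) →
              rename ρ w ≡ rename σ w
rename-cong p []        = refl
rename-cong p (old x w) = cong₂ old (p x) (rename-cong p w)
rename-cong p (new w)   = cong new (rename-cong (▹-cong (cong suc ∘ p)) w)

rename-id : ∀ {c n m} (w : Word c n m) → rename id w ≡ w
rename-id []        = refl
rename-id (old x w) = cong (old x) (rename-id w)
rename-id (new w)   = cong new (trans (rename-cong ▹-η w) (rename-id w))

rename-∘ : ∀ {c d e n m} {σ : Fin d → Fin e} {ρ : Fin c → Fin d} (w : Word c n m) →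
           rename σ (rename ρ w) ≡ rename (σ ∘ ρ) w
rename-∘ []        = refl
rename-∘ (old x w) = cong (old _) (rename-∘ w)
rename-∘ (new w)   = cong new (trans (rename-∘ w) (rename-cong under-∘ w))

comp-cong : ∀ {c d n m l} {ρ σ : Fin c → Fin d} → ρ ≗ σ →
            (v : Word c n m) (f : Word d m l) → comp v ρ f ≡ comp v σ f
comp-cong p []        []        = refl
comp-cong p (old x v) f         = cong₂ old (p x) (comp-cong p v f)
comp-cong p (new v)   (old y f) = cong (old y) (comp-cong (▹-cong p) v f)
comp-cong p (new v)   (new f)   = cong new (comp-cong (▹-cong (cong suc ∘ p)) v f)

rename-comp : ∀ {c d e n m l} (σ : Fin d → Fin e) {ρ : Fin c → Fin d}
              (v : Word c n m) (f : Word d m l) →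
              rename σ (comp v ρ f) ≡ comp v (σ ∘ ρ) (rename σ f)
rename-comp σ []        []        = refl
rename-comp σ (old x v) f         = cong (old _) (rename-comp σ v f)
rename-comp σ (new v)   (old y f) =
  cong (old _) (trans (rename-comp σ v f) (comp-cong (∘-▹ σ) v _))
rename-comp σ (new v)   (new f)   =
  cong new (trans (rename-comp (under σ) v f) (comp-cong under-∘ v _))

comp-rename : ∀ {c d e n m l} {ρ : Fin c → Fin d} {σ : Fin d → Fin e}
              (v : Word c n m) (f : Word e m l) →
              comp (rename ρ v) σ f ≡ comp v (σ ∘ ρ) f
comp-rename []        []        = refl
comp-rename (old x v) f         = cong (old _) (comp-rename v f)
comp-rename (new v)   (old y f) =
  cong (old y) (trans (comp-rename v f) (comp-cong (λ { zero → refl ; (suc _) → refl }) v f))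
comp-rename (new v)   (new f)   =
  cong new (trans (comp-rename v f) (comp-cong under-∘ v f))

comp-assoc : ∀ {c d e n m l p} {ρ : Fin c → Fin d} {σ : Fin d → Fin e}
             (v : Word c n m) (u : Word d m l) (f : Word e l p) →
             comp (comp v ρ u) σ f ≡ comp v (σ ∘ ρ) (comp u σ f)
comp-assoc []        []        []        = refl
comp-assoc (old x v) u         f         = cong (old _) (comp-assoc v u f)
comp-assoc {σ = σ} (new v) (old y u) f   =
  cong (old _) (trans (comp-assoc v u f) (comp-cong (∘-▹ σ) v _))
comp-assoc (new v)   (new u)   (old z f) =
  cong (old z) (trans (comp-assoc v u f) (comp-cong (λ { zero → refl ; (suc _) → refl }) v _))
comp-assoc (new v)   (new u)   (new f)   =
  cong new (trans (comp-assoc v u f) (comp-cong under-∘ v _))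

identity : ∀ {c} m → Word c m m
identity zero    = []
identity (suc m) = new (identity m)

-- Colourings as single colours

encode : ∀ {c k} → (Fin c → Fin k) → Fin (k ^ c)
encode = Fin.funToFin

encode-injective : ∀ {c k} (f g : Fin c → Fin k) → encode f ≡ encode g → f ≗ g
encode-injective f g e x = begin
  f x                                ≡⟨ Fin.finToFun-funToFin f x ⟨
  Fin.finToFun (encode f) x          ≡⟨ cong (λ h → Fin.finToFun h x) e ⟩
  Fin.finToFun (encode g) x          ≡⟨ Fin.finToFun-funToFin g x ⟩
  g x                                ∎
  where open ≡-Reasoning

-- The number `k ^ (c ^ n)`, written as an iterated power to match `encodeWords`, which codes a
-- colouring by its restrictions to the words with a given first letter.
colourings : ℕ → ℕ → ℕ → ℕ
colourings c zero    k = k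
colourings c (suc n) k = colourings c n k ^ c

encodeWords : ∀ {c} n {k} → (Word c n 0 → Fin k) → Fin (colourings c n k)
encodeWords zero    χ = χ []
encodeWords (suc n) χ = encode λ x → encodeWords n (χ ∘ old x)

encodeWords-injective : ∀ {c} n {k} {χ ψ : Word c n 0 → Fin k} →
                        encodeWords n χ ≡ encodeWords n ψ → χ ≗ ψ
encodeWords-injective zero    e []        = e
encodeWords-injective (suc n) e (old x w) =
  encodeWords-injective n (encode-injective _ _ e x) w

-- Hales–Jewett, by Shelah's insensitivity argument

module Insensitivity {t : ℕ} where

  private
    c : ℕ
    c = suc (suc t)

  a b : Fin c
  a = zero
  b = suc zero

  collapse : Fin c → Fin c
  collapse zero    = b
  collapse (suc x) = suc x

  -- a^i x^(j-i) b^(N-j) y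
  staircase : ∀ {c n m} (a x b : Fin c) N → ℕ → ℕ → Word c n m → Word c (N + n) m
  staircase a x b zero    i       j       y = y
  staircase a x b (suc N) zero    zero    y = old b (staircase a x b N 0 0 y)
  staircase a x b (suc N) zero    (suc j) y = old x (staircase a x b N 0 j y)
  staircase a x b (suc N) (suc i) j       y = old a (staircase a x b N i (ℕ.pred j) y)

  -- The staircase with a new parameter for x. That `i < j` makes the parameter occur; after it all
  -- letters are shifted by one.
  block : ∀ {n m} N (i j : ℕ) → i < j → j ≤ N → Word c n m → Word c (N + n) (suc m)
  block (suc N) zero    (suc j) _ _ y = new (staircase (suc a) zero (suc b) N 0 j (rename suc y))
  block (suc N) (suc i) (suc j) p q y = old a (block N i j (s≤s⁻¹ p) (s≤s⁻¹ q) y)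

  comp-staircase : ∀ {d e} {ρ : Fin d → Fin e} {a x b n m l} N i j
                   (v : Word d n m) (h : Word e m l) →
                   comp (staircase a x b N i j v) ρ h ≡
                   staircase (ρ a) (ρ x) (ρ b) N i j (comp v ρ h)
  comp-staircase zero    i       j       v h = refl
  comp-staircase (suc N) zero    zero    v h = cong (old _) (comp-staircase N 0 0 v h)
  comp-staircase (suc N) zero    (suc j) v h = cong (old _) (comp-staircase N 0 j v h)
  comp-staircase (suc N) (suc i) j       v h = cong (old _) (comp-staircase N i _ v h)

  comp-block : ∀ {n m l} N i j (p : i < j) (q : j ≤ N) (v : Word c n m) x (h : Word c m l) →
               block N i j p q v ⊙ old x h ≡ staircase a x b N i j (v ⊙ h)
  comp-block (suc N) zero    (suc j) p q v x h = cong (old x) (trans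
    (comp-staircase N 0 j (rename suc v) h)
    (cong (staircase a x b N 0 j) (comp-rename v h)))
  comp-block (suc N) (suc i) (suc j) p q v x h =
    cong (old a) (comp-block N i j _ _ v x h)

  staircase-a : ∀ {n m} N {i j} → i ≤ j → (y : Word c n m) →
                staircase a a b N i j y ≡ staircase a a b N j j y
  staircase-a zero            _ y = refl
  staircase-a (suc N) {zero}  {zero}  _ y = refl
  staircase-a (suc N) {zero}  {suc j} _ y = cong (old a) (staircase-a N z≤n y)
  staircase-a (suc N) {suc i} {suc j} p y = cong (old a) (staircase-a N (s≤s⁻¹ p) y)

  staircase-b : ∀ {n m} N {i j} → i ≤ j → (y : Word c n m) →
                staircase a b b N i j y ≡ staircase a a b N i i y
  staircase-b zero                    _ y = refl
  staircase-b (suc N) {zero}  {zero}  _ y = cong (old b) (staircase-b N z≤n y)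
  staircase-b (suc N) {zero}  {suc j} _ y = cong (old b) (staircase-b N z≤n y)
  staircase-b (suc N) {suc i} {suc j} p y = cong (old a) (staircase-b N (s≤s⁻¹ p) y)

  -- The tail length `N₂` is fixed first, and `N₁` counts the colourings of tails. Among the
  -- `suc N₁` words a^i b^(N₁-i) two therefore colour all tails alike; they are the values at b and
  -- at a of one block, whose parameter thus does not distinguish a from b. The other parameters
  -- come from the induction hypothesis for the product colouring over all values of the first one,
  -- hence `k ^ c` colours.
  insensitive : ∀ n k → ∃ λ N → (χ : Word c N 0 → Fin k) →
                ∃ λ (v : Word c N n) → ∀ h → χ (v ⊙ h) ≡ χ (v ⊙ rename collapse h)
  insensitive zero    k = 0 , λ χ → [] , λ { [] → refl }
  insensitive (suc n) k with insensitive n (k ^ c)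
  ... | N₂ , ih = N₁ + N₂ , step
    where
    N₁ : ℕ
    N₁ = colourings c N₂ k

    step : (χ : Word c (N₁ + N₂) 0 → Fin k) →
           ∃ λ (v : Word c (N₁ + N₂) (suc n)) → ∀ h → χ (v ⊙ h) ≡ χ (v ⊙ rename collapse h)
    step χ with Fin.pigeonhole (ℕ.n<1+n N₁)
                  (λ i → encodeWords N₂ (χ ∘ staircase a a b N₁ (toℕ i) (toℕ i)))
    ... | i′ , j′ , i<j , same with ih (λ y → encode λ x → χ (staircase a x b N₁ (toℕ i′) (toℕ j′) y))
    ... | v , v-insens = w , w-insens
      where
      i j : ℕ
      i = toℕ i′
      j = toℕ j′

      j≤N₁ : j ≤ N₁
      j≤N₁ = s≤s⁻¹ (Fin.toℕ<n j′)

      w : Word c (N₁ + N₂) (suc n)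
      w = block N₁ i j i<j j≤N₁ v

      x-insens : ∀ x y → χ (staircase a x b N₁ i j y) ≡ χ (staircase a (collapse x) b N₁ i j y)
      x-insens zero y = begin
        χ (staircase a a b N₁ i j y) ≡⟨ cong χ (staircase-a N₁ (ℕ.<⇒≤ i<j) y) ⟩
        χ (staircase a a b N₁ j j y) ≡⟨ encodeWords-injective N₂ same y ⟨
        χ (staircase a a b N₁ i i y) ≡⟨ cong χ (staircase-b N₁ (ℕ.<⇒≤ i<j) y) ⟨
        χ (staircase a b b N₁ i j y) ∎
        where open ≡-Reasoning
      x-insens (suc x) y = refl

      w-insens : ∀ h → χ (w ⊙ h) ≡ χ (w ⊙ rename collapse h)
      w-insens (old x h) = begin
        χ (w ⊙ old x h)
          ≡⟨ cong χ (comp-block N₁ i j _ _ v x h) ⟩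
        χ (staircase a x b N₁ i j (v ⊙ h))
          ≡⟨ encode-injective (λ x → χ (staircase a x b N₁ i j (v ⊙ h)))
                                (λ x → χ (staircase a x b N₁ i j (v ⊙ rename collapse h)))
                                (v-insens h) x ⟩
        χ (staircase a x b N₁ i j (v ⊙ rename collapse h))
          ≡⟨ x-insens x _ ⟩
        χ (staircase a (collapse x) b N₁ i j (v ⊙ rename collapse h))
          ≡⟨ cong χ (comp-block N₁ i j _ _ v (collapse x) _) ⟨
        χ (w ⊙ rename collapse (old x h)) ∎
        where open ≡-Reasoning

GrahamRothschild : ℕ → ℕ → ℕ → ℕ → Set
GrahamRothschild c l m k = ∃ λ n → (χ : Word c n l → Fin k) →
  ∃₂ λ (v : Word c n m) κ → ∀ f → χ (v ⊙ f) ≡ κ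

constant : ∀ m → Word 1 m 0
constant zero    = []
constant (suc m) = old zero (constant m)

constant-unique : ∀ {m} (w : Word 1 m 0) → w ≡ constant m
constant-unique []           = refl
constant-unique (old zero w) = cong (old zero) (constant-unique w)

-- Induction on the alphabet. In a subspace insensitive to `collapse`, a word `h` has the colour of
-- `rename suc (rename q h)`, where `q` merges the first two letters; so words over one letter fewer
-- decide.
halesJewett : ∀ t m k → GrahamRothschild (suc t) 0 m k
halesJewett zero m k = m , λ χ → identity m , χ (identity m ⊙ constant m) , λ f →
  cong (λ w → χ (identity m ⊙ w)) (constant-unique f)
halesJewett (suc t) m k with halesJewett t m k
... | n , ih with Insensitivity.insensitive {t} n k
... | N , insens = N , λ χ →
  let v , v-insens = insens χ
      u , κ , u-mono = ih (λ h → χ (v ⊙ rename suc h))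
  in v ⊙ rename suc u , κ , λ h → begin
      χ ((v ⊙ rename suc u) ⊙ h)
        ≡⟨ cong χ (comp-assoc v (rename suc u) h) ⟩
      χ (v ⊙ rename suc u ⊙ h)
        ≡⟨ v-insens _ ⟩
      χ (v ⊙ rename collapse (rename suc u ⊙ h))
        ≡⟨ cong (λ z → χ (v ⊙ z)) (trans (sym (trans (rename-∘ _) (rename-cong suc-q _)))
                                          (cong (rename suc) (push u h))) ⟩
      χ (v ⊙ rename suc (u ⊙ rename q h))
        ≡⟨ u-mono _ ⟩
      κ ∎
  where
  open ≡-Reasoning
  open Insensitivity {t} using (collapse)

  q : Fin (suc (suc t)) → Fin (suc t)
  q zero    = zero
  q (suc x) = x

  suc-q : suc ∘ q ≗ collapse
  suc-q zero    = refl
  suc-q (suc x) = refl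

  push : (u : Word (suc t) n m) (h : Word (suc (suc t)) m 0) →
         rename q (rename suc u ⊙ h) ≡ u ⊙ rename q h
  push u h = trans (rename-comp q (rename suc u) h) (comp-rename u (rename q h))

-- Graham–Rothschild, by induction on the number of parameters

prefix : ∀ {c n m} → Word c n m → List (Fin c)
prefix []        = []
prefix (old x w) = x ∷ prefix w
prefix (new w)   = []

-- What is known of the prefix of `comp v ρ f` when only the prefix `g` of `f` is given: reading
-- stops at the first parameter of `v` for which `g` has no letter left.
run : ∀ {c d n m} → Word c n m → (Fin c → Fin d) → List (Fin d) → List (Fin d)
run []        ρ g       = []
run (old x v) ρ g       = ρ x ∷ run v ρ g
run (new v)   ρ []      = []
run (new v)   ρ (y ∷ g) = y ∷ run v (y ▹ ρ) g

prefix-rename : ∀ {c d n m} (ρ : Fin c → Fin d) (w : Word c n m) →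
                prefix (rename ρ w) ≡ List.map ρ (prefix w)
prefix-rename ρ []        = refl
prefix-rename ρ (old x w) = cong (ρ x ∷_) (prefix-rename ρ w)
prefix-rename ρ (new w)   = refl

prefix-comp : ∀ {c d n m l} {ρ : Fin c → Fin d} (v : Word c n m) (f : Word d m (suc l)) →
              prefix (comp v ρ f) ≡ run v ρ (prefix f)
prefix-comp (old x v) f         = cong (_ ∷_) (prefix-comp v f)
prefix-comp (new v)   (old y f) = cong (y ∷_) (prefix-comp v f)
prefix-comp (new v)   (new f)   = refl

prefix-length : ∀ {c n l} (f : Word c n (suc l)) → length (prefix f) < n
prefix-length (old x f) = s≤s (prefix-length f)
prefix-length (new f)   = s≤s z≤n

run-cong : ∀ {c d n m} {ρ σ : Fin c → Fin d} → ρ ≗ σ → (v : Word c n m) → ∀ g →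
           run v ρ g ≡ run v σ g
run-cong p []        g       = refl
run-cong p (old x v) g       = cong₂ _∷_ (p x) (run-cong p v g)
run-cong p (new v)   []      = refl
run-cong p (new v)   (y ∷ g) = cong (y ∷_) (run-cong (▹-cong p) v g)

run-comp : ∀ {c d e n m l} {ρ : Fin c → Fin d} {σ : Fin d → Fin e}
           (v : Word c n m) (u : Word d m l) → ∀ g →
           run (comp v ρ u) σ g ≡ run v (σ ∘ ρ) (run u σ g)
run-comp []        []        g       = refl
run-comp (old x v) u         g       = cong (_ ∷_) (run-comp v u g)
run-comp {σ = σ} (new v) (old y u) g =
  cong (_ ∷_) (trans (run-comp v u g) (run-cong (∘-▹ σ) v _))
run-comp (new v)   (new u)   []      = refl
run-comp (new v)   (new u)   (z ∷ g) =
  cong (z ∷_) (trans (run-comp v u g) (run-cong (λ { zero → refl ; (suc _) → refl }) v _))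

run-length-< : ∀ {c d n m} (v : Word c n m) {ρ : Fin c → Fin d} g →
               length g < m → length (run v ρ g) < n
run-length-< (old x v) g       p = s≤s (run-length-< v g p)
run-length-< (new v)   []      p = s≤s z≤n
run-length-< (new v)   (y ∷ g) p = s≤s (run-length-< v g (s≤s⁻¹ p))

run-length : ∀ {c d n m} (v : Word c n m) {ρ : Fin c → Fin d} g →
             length g ≡ m → length (run v ρ g) ≡ n
run-length []        g       p = refl
run-length (old x v) g       p = cong suc (run-length v g p)
run-length (new v)   (y ∷ g) p = cong suc (run-length v g (ℕ.suc-injective p))

-- On a list that exactly exhausts the parameters of `v`, `run` reads all of `v` and stops at the
-- appended parameter; such lists are full words, within reach of Hales-Jewett.
append-new : ∀ {c n m} → Word c n m → Word c (suc n) (suc m)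
append-new []        = new []
append-new (old x v) = old x (append-new v)
append-new (new v)   = new (append-new v)

run-append-new : ∀ {c d n m} (v : Word c n m) {ρ : Fin c → Fin d} g → length g ≤ m →
                 run (append-new v) ρ g ≡ run v ρ g
run-append-new []        []      p = refl
run-append-new (old x v) g       p = cong (_ ∷_) (run-append-new v g p)
run-append-new (new v)   []      p = refl
run-append-new (new v)   (y ∷ g) p = cong (y ∷_) (run-append-new v g (s≤s⁻¹ p))

fromList : ∀ {c} (g : List (Fin c)) → Word c (length g) 0
fromList []      = []
fromList (x ∷ g) = old x (fromList g)

toList : ∀ {c n} → Word c n 0 → List (Fin c)
toList []        = []
toList (old x w) = x ∷ toList w

toList-comp : ∀ {c d n m} (v : Word c n m) {ρ : Fin c → Fin d} g (p : length g ≡ m) →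
              toList (comp v ρ (subst (λ m → Word d m 0) p (fromList g))) ≡ run v ρ g
toList-comp []        []      refl = refl
toList-comp (old x v) g       refl = cong (_ ∷_) (toList-comp v g refl)
toList-comp (new v)   (y ∷ g) refl = cong (y ∷_) (toList-comp v g refl)

-- The last parameter is placed first: Hales–Jewett makes the lists that reach it
-- monochromatic, and the shorter lists are treated inside that subspace.
length-only : ∀ t m k → Fin k → ∃ λ n → (χ : List (Fin (suc t)) → Fin k) →
              ∃₂ λ (u : Word (suc t) n m) (γ : ℕ → Fin k) →
              ∀ g → length g < m → χ (run u id g) ≡ γ (length g)
length-only t zero    k d = 0 , λ χ → [] , (λ _ → d) , λ g ()
length-only t (suc m) k d with length-only t m k d
... | M , ih with halesJewett t M k
... | P , hj = suc P , λ χ →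
  let w , κ , w-mono = hj (χ ∘ toList)
      u , γ , u-good = ih (χ ∘ run w id)
      γ′ = λ i → choose (i ℕ.≟ m) κ (γ i)
  in append-new (w ⊙ u) , γ′ , λ g g<sm → begin
    χ (run (append-new (w ⊙ u)) id g)
      ≡⟨ cong χ (run-append-new (w ⊙ u) g (s≤s⁻¹ g<sm)) ⟩
    χ (run (w ⊙ u) id g)
      ≡⟨ cong χ (run-comp w u g) ⟩
    χ (run w id (run u id g))
      ≡⟨ value χ w κ w-mono u γ u-good g (s≤s⁻¹ g<sm) ⟩
    γ′ (length g) ∎
  where
  open ≡-Reasoning

  choose : ∀ {P A : Set} → Dec P → A → A → A
  choose (yes _) x y = x
  choose (no _)  x y = y

  value : (χ : List (Fin (suc t)) → Fin k) (w : Word (suc t) P M) (κ : Fin k) →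
          (∀ f → χ (toList (w ⊙ f)) ≡ κ) →
          (u : Word (suc t) M m) (γ : ℕ → Fin k) →
          (∀ g → length g < m → χ (run w id (run u id g)) ≡ γ (length g)) →
          ∀ g → length g ≤ m →
          χ (run w id (run u id g)) ≡ choose (length g ℕ.≟ m) κ (γ (length g))
  value χ w κ w-mono u γ u-good g g≤m with length g ℕ.≟ m
  ... | yes g≡m = trans (cong χ (sym (toList-comp w (run u id g) (run-length u g g≡m))))
                        (w-mono _)
  ... | no g≢m = u-good g (ℕ.≤∧≢⇒< g≤m g≢m)

total : ∀ {k} → (Fin k → ℕ) → ℕ
total {zero}  t = 0
total {suc k} t = t zero + total (t ∘ suc)

total-const : ∀ k m → total {k} (λ _ → m) ≡ k ℕ.* m
total-const zero    m = refl
total-const (suc k) m = cong (m +_) (total-const k m)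

decrease : ∀ {k} → Fin k → (Fin k → ℕ) → Fin k → ℕ
decrease zero    t zero    = ℕ.pred (t zero)
decrease zero    t (suc j) = t (suc j)
decrease (suc i) t zero    = t zero
decrease (suc i) t (suc j) = decrease i (t ∘ suc) j

total-decrease : ∀ {k} (i : Fin k) (t : Fin k → ℕ) {p} → t i ≡ suc p →
                 total t ≡ suc (total (decrease i t))
total-decrease zero    t e rewrite e = refl
total-decrease (suc i) t e =
  trans (cong (t zero +_) (total-decrease i (t ∘ suc) e)) (ℕ.+-suc (t zero) _)

decrease-same : ∀ {k} (i : Fin k) (t : Fin k → ℕ) → decrease i t i ≡ ℕ.pred (t i)
decrease-same zero    t = refl
decrease-same (suc i) t = decrease-same i (t ∘ suc)

decrease-other : ∀ {k} (i j : Fin k) (t : Fin k → ℕ) → i ≢ j → decrease i t j ≡ t j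
decrease-other zero    zero    t i≢j = ⊥-elim (i≢j refl)
decrease-other zero    (suc j) t i≢j = refl
decrease-other (suc i) zero    t i≢j = refl
decrease-other (suc i) (suc j) t i≢j = decrease-other i j (t ∘ suc) (i≢j ∘ cong suc)

-- For `g` shorter than `m`, `run` stops at the first occurrence of a parameter, and its length is
-- that position. So parameters first occur only at positions of colour `κ`.
Good : ∀ {c n m k} → (ℕ → Fin k) → Fin k → Word c n m → Set
Good {c} {n} {m} γ κ s = ∀ {d} {ρ : Fin c → Fin d} g → length g < m → γ (length (run s ρ g)) ≡ κ

olds : ∀ {c} n → Word (suc c) n 0
olds zero    = []
olds (suc n) = old zero (olds n)

-- `t i` is the number of positions of colour `i` still wanted; each position lowers the target of
-- its colour. The recursion ends when a colour of target zero comes up, or at the end of the word,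
-- where `total t ≤ n` leaves only zero targets. On the way back, positions of the winning colour
-- receive a parameter and the others the letter zero.
pigeonhole-word : ∀ {k} n (t : Fin (suc k) → ℕ) → total t ≤ n → (γ : ℕ → Fin (suc k)) →
                  ∃ λ κ → ∀ c m → m ≡ t κ → ∃ λ (s : Word (suc c) n m) → Good γ κ s
pigeonhole-word zero t p γ = zero , λ where
  c zero    e → [] , λ g ()
  c (suc m) e → ⊥-elim (ℕ.1+n≰n (ℕ.≤-trans (s≤s z≤n) (ℕ.≤-trans (ℕ.≤-reflexive e) (ℕ.m+n≤o⇒m≤o _ p))))
pigeonhole-word (suc n) t p γ with t (γ 0) in e
... | zero = γ 0 , λ where
  c zero    _  → olds (suc n) , λ g ()
  c (suc m) e′ → ⊥-elim (ℕ.1+n≢0 (trans e′ e))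
... | suc q with pigeonhole-word n (decrease (γ 0) t)
                   (s≤s⁻¹ (subst (_≤ suc n) (total-decrease (γ 0) t e) p)) (γ ∘ suc)
... | κ , ih with γ 0 Fin.≟ κ
... | no γ₀≢κ = κ , λ c m e′ →
  let s , s-good = ih c m (trans e′ (sym (decrease-other (γ 0) κ t γ₀≢κ)))
  in old zero s , λ g g<m → s-good g g<m
... | yes refl = γ 0 , λ where
  c zero    e′ → ⊥-elim (ℕ.0≢1+n (trans e′ e))
  c (suc m) e′ →
    let s , s-good = ih (suc c) m (trans (cong ℕ.pred e′) (sym (decrease-same (γ 0) t)))
    in new s , λ where
      []      _   → refl
      (y ∷ g) g<m → s-good g (s≤s⁻¹ g<m)

monochromatic-positions : ∀ k c m → ∃ λ n → (γ : ℕ → Fin k) → Fin k →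
                          ∃₂ λ κ (s : Word (suc c) n m) → Good γ κ s
monochromatic-positions zero    c m = 0 , λ γ ()
monochromatic-positions (suc k) c m = suc k ℕ.* m , λ γ _ →
  let κ , good = pigeonhole-word (suc k ℕ.* m) (λ _ → m)
                   (ℕ.≤-reflexive (total-const (suc k) m)) γ
  in κ , good c m refl

-- A word over suc c letters codes one word over c letters for each value x of its
-- fresh letter; the colours of all of them are handled at once.
module PrefixOnly (l : ℕ)
  (gr : ∀ t m k → Fin k → GrahamRothschild (suc t) l m k) where

  -- Induction on `m`, by the first symbol of `f`. If it is a parameter, the prefix is empty, `l`
  -- parameters are left with one more letter, and `gr` makes the colour constant. If it is a letter
  -- `x`, the induction hypothesis applies to the rest, with `x` substituted for the fresh letter.
  prefix-only : ∀ m c k → Fin k → ∃ λ n → (χ : Word c n (suc l) → Fin k) →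
                ∃₂ λ (v : Word c n m) (ψ : List (Fin c) → Fin k) →
                ∀ f → χ (v ⊙ f) ≡ ψ (prefix f)
  prefix-only zero    c k d = 0 , λ χ → [] , (λ _ → d) , λ ()
  prefix-only (suc m) c k d with prefix-only m (suc c) (k ^ c) (encode {c} λ _ → d)
  ... | n₁ , ih with gr c n₁ k d
  ... | n₂ , gr′ = suc n₂ , step
    where
    open ≡-Reasoning

    step : (χ : Word c (suc n₂) (suc l) → Fin k) →
           ∃₂ λ (v : Word c (suc n₂) (suc m)) (ψ : List (Fin c) → Fin k) →
           ∀ f → χ (v ⊙ f) ≡ ψ (prefix f)
    step χ with gr′ (χ ∘ new)
    ... | v , κ , v-mono with ih (λ u → encode λ x → χ (old x (rename (x ▹ id) (v ⊙ u))))
    ... | u , ψ , u-good = new (v ⊙ u) , ψ′ , good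
      where
      ψ′ : List (Fin c) → Fin k
      ψ′ []      = κ
      -- The rest of `f` avoids the fresh letter, so its prefix is shifted past it.
      ψ′ (x ∷ g) = Fin.finToFun (ψ (List.map suc g)) x

      good : ∀ f → χ (new (v ⊙ u) ⊙ f) ≡ ψ′ (prefix f)
      good (new f) = begin
        χ (new (comp (v ⊙ u) (under id) f)) ≡⟨ cong (χ ∘ new) (comp-cong ▹-η (v ⊙ u) f) ⟩
        χ (new ((v ⊙ u) ⊙ f))              ≡⟨ cong (χ ∘ new) (comp-assoc v u f) ⟩
        χ (new (v ⊙ u ⊙ f))                ≡⟨ v-mono (u ⊙ f) ⟩
        κ                                  ∎
      good (old x f) = begin
        χ (old x (comp (v ⊙ u) (x ▹ id) f))
          ≡⟨ cong (χ ∘ old x) unrename ⟨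
        χ (old x (rename (x ▹ id) (v ⊙ u ⊙ rename suc f)))
          ≡⟨ Fin.finToFun-funToFin (λ x → χ (old x (rename (x ▹ id) (v ⊙ u ⊙ rename suc f)))) x ⟨
        Fin.finToFun (encode λ x → χ (old x (rename (x ▹ id) (v ⊙ u ⊙ rename suc f)))) x
          ≡⟨ cong (λ a → Fin.finToFun a x) (u-good (rename suc f)) ⟩
        Fin.finToFun (ψ (prefix (rename suc f))) x
          ≡⟨ cong (λ g → Fin.finToFun (ψ g) x) (prefix-rename suc f) ⟩
        ψ′ (prefix (old x f)) ∎
        where
        unrename : rename (x ▹ id) (v ⊙ u ⊙ rename suc f) ≡ comp (v ⊙ u) (x ▹ id) f
        unrename = begin
          rename (x ▹ id) (v ⊙ u ⊙ rename suc f)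
            ≡⟨ cong (rename (x ▹ id)) (comp-assoc v u (rename suc f)) ⟨
          rename (x ▹ id) ((v ⊙ u) ⊙ rename suc f)
            ≡⟨ rename-comp (x ▹ id) (v ⊙ u) (rename suc f) ⟩
          comp (v ⊙ u) (x ▹ id) (rename (x ▹ id) (rename suc f))
            ≡⟨ cong (comp (v ⊙ u) (x ▹ id)) (trans (rename-∘ f) (rename-id f)) ⟩
          comp (v ⊙ u) (x ▹ id) f ∎

-- The lengths are chosen in the reverse of the order in which the words are found: `v` depends on
-- `χ`, then `u` on `ψ`, then `s` on `γ`. The induction hypothesis for `l` enters through
-- `PrefixOnly`.
grahamRothschild : ∀ l t m k → Fin k → GrahamRothschild (suc t) l m k
grahamRothschild zero    t m k d = halesJewett t m k
grahamRothschild (suc l) t m k d with monochromatic-positions k t m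
... | n₃ , positions with length-only t n₃ k d
... | n₂ , lengths with PrefixOnly.prefix-only l (grahamRothschild l) n₂ (suc t) k d
... | n₁ , prefixes = n₁ , λ χ →
  let v , ψ , v-good = prefixes χ
      u , γ , u-good = lengths ψ
      κ , s , s-good = positions γ d
  in v ⊙ u ⊙ s , κ , λ f → begin
    χ ((v ⊙ u ⊙ s) ⊙ f)
      ≡⟨ cong χ (trans (comp-assoc v (u ⊙ s) f) (cong (v ⊙_) (comp-assoc u s f))) ⟩
    χ (v ⊙ u ⊙ s ⊙ f)
      ≡⟨ v-good _ ⟩
    ψ (prefix (u ⊙ s ⊙ f))
      ≡⟨ cong ψ (trans (prefix-comp u (s ⊙ f)) (cong (run u id) (prefix-comp s f))) ⟩
    ψ (run u id (run s id (prefix f)))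
      ≡⟨ u-good _ (run-length-< s (prefix f) (prefix-length f)) ⟩
    γ (length (run s id (prefix f)))
      ≡⟨ s-good (prefix f) (prefix-length f) ⟩
    κ ∎
  where open ≡-Reasoning

-- Every word without letters starts with a parameter, which then serves as the
-- letter that grahamRothschild needs.
dualRamsey-words : ∀ l m k → Fin k → ∃ λ n → (χ : Word 0 n (suc l) → Fin k) →
                   ∃₂ λ (w : Word 0 n (suc m)) κ → ∀ f → χ (w ⊙ f) ≡ κ
dualRamsey-words l m k d with grahamRothschild l 0 m k d
... | n , gr = suc n , λ χ →
  let w , κ , w-mono = gr (χ ∘ new)
  in new w , κ , λ where
    (new f) → trans (cong (χ ∘ new) (comp-cong ▹-η w f)) (w-mono f)

-- Words without letters are rigid surjections

eval : ∀ {c n m} {A : Set} → Word c n m → (Fin c → A) → (Fin m → A) → Fin n → A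
eval (old x w) ρ ν zero    = ρ x
eval (old x w) ρ ν (suc i) = eval w ρ ν i
eval (new w)   ρ ν zero    = ν zero
eval (new w)   ρ ν (suc i) = eval w (ν zero ▹ ρ) (ν ∘ suc) i

eval-cong : ∀ {c n m} {A : Set} {ρ ρ′ : Fin c → A} {ν ν′ : Fin m → A} (w : Word c n m) →
            ρ ≗ ρ′ → ν ≗ ν′ → eval w ρ ν ≗ eval w ρ′ ν′
eval-cong (old x w) p q zero    = p x
eval-cong (old x w) p q (suc i) = eval-cong w p q i
eval-cong (new w)   p q zero    = q zero
eval-cong (new w)   p q (suc i) =
  eval-cong w (λ { zero → q zero ; (suc x) → p x }) (q ∘ suc) i

eval-natural : ∀ {c n m} {A B : Set} (h : A → B) {ρ : Fin c → A} {ν : Fin m → A}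
               (w : Word c n m) → eval w (h ∘ ρ) (h ∘ ν) ≗ h ∘ eval w ρ ν
eval-natural h (old x w) zero    = refl
eval-natural h (old x w) (suc i) = eval-natural h w i
eval-natural h (new w)   zero    = refl
eval-natural h (new w)   (suc i) =
  trans (eval-cong w (sym ∘ ∘-▹ h) (λ _ → refl) i) (eval-natural h w i)

eval-comp : ∀ {c d n m l} {A : Set} {ρ : Fin c → Fin d} {σ : Fin d → A} {ν : Fin l → A}
            (v : Word c n m) (f : Word d m l) →
            eval (comp v ρ f) σ ν ≗ eval v (σ ∘ ρ) (eval f σ ν)
eval-comp (old x v) f         zero    = refl
eval-comp (old x v) f         (suc i) = eval-comp v f i
eval-comp (new v)   (old y f) zero    = refl
eval-comp {σ = σ} (new v) (old y f) (suc i) =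
  trans (eval-comp v f i) (eval-cong v (∘-▹ σ) (λ _ → refl) i)
eval-comp (new v)   (new f)   zero    = refl
eval-comp (new v)   (new f)   (suc i) =
  trans (eval-comp v f i) (eval-cong v (λ { zero → refl ; (suc _) → refl }) (λ _ → refl) i)

first : ∀ {c n m} → Word c n m → Fin m → Fin n
first (old x w) j       = suc (first w j)
first (new w)   zero    = zero
first (new w)   (suc j) = suc (first w j)

eval-first : ∀ {c n m} {A : Set} {ρ : Fin c → A} {ν : Fin m → A} (w : Word c n m) →
             eval w ρ ν ∘ first w ≗ ν
eval-first (old x w) j       = eval-first w j
eval-first (new w)   zero    = refl
eval-first (new w)   (suc j) = eval-first w j

first-mono : ∀ {c n m} (w : Word c n m) {i j} → i Fin.< j → first w i Fin.< first w j
first-mono (old x w)                 p = s≤s (first-mono w p)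
first-mono (new w)   {zero}  {suc j} p = s≤s z≤n
first-mono (new w)   {suc i} {suc j} p = s≤s (first-mono w (s≤s⁻¹ p))

-- A value may stem from an outer letter, because under `new` that letter can be a parameter whose
-- first occurrence lies further left.
first-least : ∀ {c n m} {A : Set} {ρ : Fin c → A} {ν : Fin m → A} (w : Word c n m) i →
              (∃ λ x → eval w ρ ν i ≡ ρ x) ⊎
              (∃ λ j → eval w ρ ν i ≡ ν j × first w j Fin.≤ i)
first-least (old x w) zero    = inj₁ (x , refl)
first-least (old x w) (suc i) with first-least w i
... | inj₁ p           = inj₁ p
... | inj₂ (j , p , q) = inj₂ (j , p , s≤s q)
first-least (new w) zero    = inj₂ (zero , refl , z≤n)
first-least (new w) (suc i) with first-least w i
... | inj₁ (zero , p)  = inj₂ (zero , p , z≤n)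
... | inj₁ (suc x , p) = inj₁ (x , p)
... | inj₂ (j , p , q) = inj₂ (suc j , p , s≤s q)

record Rigid {n m} (φ : Fin n → Fin m) : Set where
  field
    min      : Fin m → Fin n
    φ-min    : ∀ j → φ (min j) ≡ j
    min-mono : ∀ {i j} → i Fin.< j → min i Fin.< min j
    min-≤    : ∀ i → min (φ i) Fin.≤ i

⟦_⟧ : ∀ {n m} → Word 0 n m → Fin n → Fin m
⟦ w ⟧ = eval w (λ ()) id

⟦⟧-rigid : ∀ {n m} (w : Word 0 n m) → Rigid ⟦ w ⟧
⟦⟧-rigid w = record
  { min      = first w
  ; φ-min    = eval-first w
  ; min-mono = first-mono w
  ; min-≤    = least
  }
  where
  least : ∀ i → first w (⟦ w ⟧ i) Fin.≤ i
  least i with first-least {ρ = λ ()} {ν = id} w i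
  ... | inj₂ (j , p , q) = subst (λ j → first w j Fin.≤ i) (sym p) q

⟦⟧-⊙ : ∀ {n m l} (w : Word 0 n m) (f : Word 0 m l) → ⟦ w ⊙ f ⟧ ≗ ⟦ f ⟧ ∘ ⟦ w ⟧
⟦⟧-⊙ w f i = begin
  eval (w ⊙ f) (λ ()) id i             ≡⟨ eval-comp w f i ⟩
  eval w (λ ()) ⟦ f ⟧ i                ≡⟨ eval-cong w (λ ()) (λ _ → refl) i ⟩
  eval w (⟦ f ⟧ ∘ λ ()) (⟦ f ⟧ ∘ id) i ≡⟨ eval-natural ⟦ f ⟧ w i ⟩
  ⟦ f ⟧ (⟦ w ⟧ i)                      ∎
  where open ≡-Reasoning

module _ where
  private
    shift : ∀ {c m} → Fin c ⊎ Fin (suc m) → Fin (suc c) ⊎ Fin m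
    shift (inj₁ x)       = inj₁ (suc x)
    shift (inj₂ zero)    = inj₁ zero
    shift (inj₂ (suc j)) = inj₂ j

    unshift : ∀ {c m} → Fin (suc c) ⊎ Fin m → Fin c ⊎ Fin (suc m)
    unshift (inj₁ zero)    = inj₂ zero
    unshift (inj₁ (suc x)) = inj₁ x
    unshift (inj₂ j)       = inj₂ (suc j)

    unshift-shift : ∀ {c m} (y : Fin c ⊎ Fin (suc m)) → unshift (shift y) ≡ y
    unshift-shift (inj₁ x)       = refl
    unshift-shift (inj₂ zero)    = refl
    unshift-shift (inj₂ (suc j)) = refl

    shift⁻¹ : ∀ {c m} {y : Fin c ⊎ Fin (suc m)} {j} → shift y ≡ inj₂ j → y ≡ inj₂ (suc j)
    shift⁻¹ {y = y} e = trans (sym (unshift-shift y)) (cong unshift e)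

  -- Stated with letters because the parameter met at the first position becomes a letter for the
  -- rest. The order hypothesis forces the first parameter met to be `zero`: nothing can occur
  -- before position `zero`.
  toWord : ∀ {n m c} (φ : Fin n → Fin c ⊎ Fin m) → (∀ j → ∃ λ i → φ i ≡ inj₂ j) →
           (∀ i j j′ → φ i ≡ inj₂ j → j′ Fin.< j → ∃ λ i′ → i′ Fin.< i × φ i′ ≡ inj₂ j′) →
           ∃ λ (w : Word c n m) → eval w inj₁ inj₂ ≗ φ
  toWord {zero} {zero}  φ onto order = [] , λ ()
  toWord {zero} {suc m} φ onto order with () ← proj₁ (onto zero)
  toWord {suc n} {m} φ onto order with φ zero in e
  ... | inj₁ x = let w , w≗ = toWord (φ ∘ suc) onto′ order′
                 in old x w , λ { zero → sym e ; (suc i) → w≗ i }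
    where
    inj₁≢inj₂ : ∀ {j} → φ zero ≢ inj₂ j
    inj₁≢inj₂ p with () ← trans (sym e) p
    onto′ : ∀ j → ∃ λ i → φ (suc i) ≡ inj₂ j
    onto′ j with onto j
    ... | zero  , p = ⊥-elim (inj₁≢inj₂ p)
    ... | suc i , p = i , p
    order′ : ∀ i j j′ → φ (suc i) ≡ inj₂ j → j′ Fin.< j →
             ∃ λ i′ → i′ Fin.< i × φ (suc i′) ≡ inj₂ j′
    order′ i j j′ p q with order (suc i) j j′ p q
    ... | zero   , _ , r = ⊥-elim (inj₁≢inj₂ r)
    ... | suc i′ , s , r = i′ , s≤s⁻¹ s , r
  toWord {suc n} {suc m} φ onto order | inj₂ (suc j) with order zero (suc j) zero e (s≤s z≤n)
  ... | _ , () , _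
  toWord {suc n} {suc m} {c} φ onto order | inj₂ zero =
    let w , w≗ = toWord (shift ∘ φ ∘ suc) onto′ order′
    in new w , λ where
      zero    → sym e
      (suc i) → begin
        eval w (inj₂ zero ▹ inj₁) (inj₂ ∘ suc) i
          ≡⟨ eval-cong w (λ { zero → refl ; (suc _) → refl }) (λ _ → refl) i ⟩
        eval w (unshift ∘ inj₁) (unshift ∘ inj₂) i
          ≡⟨ eval-natural unshift w i ⟩
        unshift (eval w inj₁ inj₂ i)
          ≡⟨ cong unshift (w≗ i) ⟩
        unshift (shift (φ (suc i)))
          ≡⟨ unshift-shift _ ⟩
        φ (suc i) ∎
    where
    open ≡-Reasoning
    zero≢suc : ∀ {j} → φ zero ≢ inj₂ (suc j)
    zero≢suc p with () ← trans (sym e) p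
    onto′ : ∀ j → ∃ λ i → shift (φ (suc i)) ≡ inj₂ j
    onto′ j with onto (suc j)
    ... | zero  , p = ⊥-elim (zero≢suc p)
    ... | suc i , p = i , cong shift p
    order′ : ∀ i j j′ → shift (φ (suc i)) ≡ inj₂ j → j′ Fin.< j →
             ∃ λ i′ → i′ Fin.< i × shift (φ (suc i′)) ≡ inj₂ j′
    order′ i j j′ p q with order (suc i) (suc j) (suc j′) (shift⁻¹ p) (s≤s q)
    ... | zero   , _ , r = ⊥-elim (zero≢suc r)
    ... | suc i′ , s , r = i′ , s≤s⁻¹ s , cong shift r

-- Rigidity of a map between finite chains without naming the minima: whatever lies below `φ i` has
-- occurred before `i`.
record Onto-in-order {n m} (φ : Fin n → Fin m) : Set where
  field
    onto     : ∀ j → ∃ λ i → φ i ≡ j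
    in-order : ∀ i j → j Fin.< φ i → ∃ λ i′ → i′ Fin.< i × φ i′ ≡ j

word-of : ∀ {n m} {φ : Fin n → Fin m} → Onto-in-order φ → ∃ λ w → ⟦ w ⟧ ≗ φ
word-of {m = m} {φ} φ-ok =
  let w , w≗ = toWord {c = 0} (inj₂ ∘ φ) (λ j → let i , p = onto j in i , cong inj₂ p) order
  in w , λ i → begin
    eval w (λ ()) id i                       ≡⟨ eval-cong w (λ ()) (λ _ → refl) i ⟩
    eval w (strip ∘ inj₁) (strip ∘ inj₂) i   ≡⟨ eval-natural strip w i ⟩
    strip (eval w inj₁ inj₂ i)               ≡⟨ cong strip (w≗ i) ⟩
    φ i                                      ∎
  where
  open ≡-Reasoning
  open Onto-in-order φ-ok
  strip : Fin 0 ⊎ Fin m → Fin m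
  strip (inj₂ j) = j
  order : ∀ i j j′ → inj₂ (φ i) ≡ inj₂ j → j′ Fin.< j →
          ∃ λ i′ → i′ Fin.< i × inj₂ {A = Fin 0} (φ i′) ≡ inj₂ j′
  order i j j′ refl q = let i′ , p , r = in-order i j′ q in i′ , p , cong inj₂ r

rigid-cong : ∀ {n m} {φ ψ : Fin n → Fin m} → φ ≗ ψ → Rigid φ → Rigid ψ
rigid-cong φ≗ψ r = record
  { min      = min
  ; φ-min    = λ j → trans (sym (φ≗ψ (min j))) (φ-min j)
  ; min-mono = min-mono
  ; min-≤    = λ i → subst (λ j → min j Fin.≤ i) (φ≗ψ i) (min-≤ i)
  }
  where open Rigid r

-- A colouring may see the proof of rigidity, since `realise` takes one; hence the congruence
-- hypothesis on `χ`. The elements of `Fin l` and `Fin m` witness that these chains are nonempty.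
dualRamsey-chains : ∀ {l m k} → Fin l → Fin m → Fin k → ∃ λ n →
  (χ : (φ : Fin n → Fin l) → Rigid φ → Fin k) →
  (∀ {φ ψ} (r : Rigid φ) (s : Rigid ψ) → φ ≗ ψ → χ φ r ≡ χ ψ s) →
  ∃₂ λ (w : Fin n → Fin m) (w-rigid : Rigid w) → ∃ λ κ →
  ∀ (f : Fin m → Fin l) → Onto-in-order f → ∃ λ r → χ (f ∘ w) r ≡ κ
dualRamsey-chains {suc l} {suc m} {k} _ _ d with dualRamsey-words l m k d
... | n , ramsey = n , λ χ χ-cong →
  let w , κ , mono = ramsey (λ u → χ ⟦ u ⟧ (⟦⟧-rigid u))
  in ⟦ w ⟧ , ⟦⟧-rigid w , κ , λ f f-ok →
    let u , u≗f = word-of f-ok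
        w⊙u≗    = λ i → trans (⟦⟧-⊙ w u i) (u≗f (⟦ w ⟧ i))
        r       = rigid-cong w⊙u≗ (⟦⟧-rigid (w ⊙ u))
    in r , trans (χ-cong r (⟦⟧-rigid (w ⊙ u)) (sym ∘ w⊙u≗)) (mono u)

-- Finite chains, supports of tuples and the order of subsets

-- Comparability is asked on `P` only, because items are comparable only when valid. Equal elements
-- are merged, so the result is strictly increasing.
module Sorting {X : Set} (P : X → Set) (_≺_ : Rel X 0ℓ)
  (compare : ∀ {x y} → P x → P y → x ≺ y ⊎ x ≡ y ⊎ y ≺ x)
  (≺-trans : ∀ {x y z} → P x → P y → P z → x ≺ y → y ≺ z → x ≺ z) where

  private
    insert : ∀ {x} L → P x → All P L → AllPairs _≺_ L →
             ∃ λ L′ → All P L′ × AllPairs _≺_ L′ ×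
             (∀ {y} → (y List.∈ L′ → y List.∈ (x ∷ L)) × (y List.∈ (x ∷ L) → y List.∈ L′))
    insert {x} [] p [] [] = x ∷ [] , p ∷ [] , [] ∷ [] , id , id
    insert {x} (z ∷ L) p (q ∷ qs) (z≺ ∷ L↑) with compare p q
    ... | inj₁ x≺z = x ∷ z ∷ L , p ∷ q ∷ qs ,
      (x≺z ∷ All.zipWith (λ (z≺y , y∈P) → ≺-trans p q y∈P x≺z z≺y) (z≺ , qs)) ∷ z≺ ∷ L↑ , id , id
    ... | inj₂ (inj₁ refl) = z ∷ L , q ∷ qs , z≺ ∷ L↑ , there ,
      λ { (here refl) → here refl ; (there y∈) → y∈ }
    ... | inj₂ (inj₂ z≺x) with insert L p qs L↑
    ... | L′ , qs′ , L′↑ , members = z ∷ L′ , q ∷ qs′ ,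
      All.tabulate (λ y∈L′ → case proj₁ members y∈L′ of λ where
        (here refl) → z≺x
        (there y∈L) → All.lookup z≺ y∈L) ∷ L′↑ ,
      (λ { (here refl) → there (here refl)
         ; (there y∈)  → case proj₁ members y∈ of λ where
             (here e)   → here e
             (there y∈) → there (there y∈) }) ,
      (λ { (here refl)         → there (proj₂ members (here refl))
         ; (there (here refl)) → here refl
         ; (there (there y∈))  → there (proj₂ members (there y∈)) })

  sort : ∀ L → All P L → ∃ λ L′ → All P L′ × AllPairs _≺_ L′ ×
         (∀ {y} → (y List.∈ L′ → y List.∈ L) × (y List.∈ L → y List.∈ L′))
  sort [] [] = [] , [] , [] , id , id
  sort (x ∷ L) (p ∷ ps) with sort L ps
  ... | L₁ , ps₁ , L₁↑ , same₁ with insert L₁ p ps₁ L₁↑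
  ... | L₂ , ps₂ , L₂↑ , same₂ = L₂ , ps₂ , L₂↑ ,
    (λ y∈ → case proj₁ same₂ y∈ of λ where
      (here e)   → here e
      (there y∈) → there (proj₁ same₁ y∈)) ,
    (λ { (here e)   → proj₂ same₂ (here e)
       ; (there y∈) → proj₂ same₂ (there (proj₂ same₁ y∈)) })

lookup-mono : ∀ {X : Set} {_≺_ : Rel X 0ℓ} {L : List X} → AllPairs _≺_ L →
              ∀ {i j} → i Fin.< j → List.lookup L i ≺ List.lookup L j
lookup-mono (x≺ ∷ L↑) {zero}  {suc j} p = All.lookup x≺ (List.∈-lookup j)
lookup-mono (x≺ ∷ L↑) {suc i} {suc j} p = lookup-mono L↑ (s≤s⁻¹ p)

member-index : ∀ {X : Set} {L : List X} {x} → x List.∈ L → ∃ λ i → List.lookup L i ≡ x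
member-index (here refl) = zero , refl
member-index (there x∈)  = let i , e = member-index x∈ in suc i , e

entry : ∀ {X : Set} {r} {a : Vec X r} {x} → x Vec.∈ a → ∃ λ i → lookup a i ≡ x
entry (VecAny.here refl) = zero , refl
entry (VecAny.there x∈)  = let i , e = entry x∈ in suc i , e

vec-ext : ∀ {X : Set} {r} (x y : Vec X r) → (∀ i → lookup x i ≡ lookup y i) → x ≡ y
vec-ext x y e = trans (sym (Vec.tabulate∘lookup x)) (trans (Vec.tabulate-cong e) (Vec.tabulate∘lookup y))

sublists : {X : Set} → List X → List (List X)
sublists []      = [] ∷ []
sublists (x ∷ L) = sublists L List.++ List.map (x ∷_) (sublists L)

Const : ∀ {X : Set} {r} → Vec X r → Set
Const x = ∀ i j → lookup x i ≡ lookup x j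

-- The given element serves the empty tuple, which determines none.
const-replicate : ∀ {X : Set} {r} (x : Vec X r) → X → Const x → ∃ λ a → x ≡ Vec.replicate r a
const-replicate []      a c = a , refl
const-replicate (b ∷ x) a c = b , cong (b ∷_) (replicated x (λ i → sym (c zero (suc i))))
  where
  replicated : ∀ {r} (x : Vec _ r) → (∀ i → lookup x i ≡ b) → x ≡ Vec.replicate r b
  replicated []      e = refl
  replicated (y ∷ x) e = cong₂ _∷_ (e zero) (replicated x (e ∘ suc))

replicate-const : ∀ {X : Set} {r} {a : X} → Const (Vec.replicate r a)
replicate-const {a = a} i j = trans (Vec.lookup-replicate i a) (sym (Vec.lookup-replicate j a))

map-const : ∀ {X Y : Set} {r} {f : X → Y} (x : Vec X r) →
            (∀ i j → f (lookup x i) ≡ f (lookup x j)) → Const (Vec.map f x)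
map-const {f = f} x c i j = trans (Vec.lookup-map i f x) (trans (c i j) (sym (Vec.lookup-map j f x)))

module _ {X Y : Set} {_⊏_ : Rel X 0ℓ} {_⊏′_ : Rel Y 0ℓ}
  (sto : IsStrictTotalOrder _≡_ _⊏_) (sto′ : IsStrictTotalOrder _≡_ _⊏′_)
  {r : ℕ} (x : Vec X r) (y : Vec Y r) where
  private
    module S = IsStrictTotalOrder sto
    module S′ = IsStrictTotalOrder sto′

  tp-intro : (∀ i j → lookup x i ⊏ lookup x j → lookup y i ⊏′ lookup y j) →
             (∀ i j → lookup x i ≡ lookup x j → lookup y i ≡ lookup y j) →
             tp _⊏_ x ⇔ tp _⊏′_ y
  tp-intro mono cong′ = to , from
    where
    to : ∀ {i j} → tp _⊏_ x i j → tp _⊏′_ y i j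
    to (inj₁ p) = inj₁ (mono _ _ p)
    to (inj₂ p) = inj₂ (cong′ _ _ p)
    from : ∀ {i j} → tp _⊏′_ y i j → tp _⊏_ x i j
    from {i} {j} p with S.compare (lookup x i) (lookup x j)
    ... | tri< q _ _ = inj₁ q
    ... | tri≈ _ q _ = inj₂ q
    ... | tri> _ _ q = case p of λ where
      (inj₁ p) → ⊥-elim (S′.irrefl refl (S′.trans p (mono _ _ q)))
      (inj₂ p) → ⊥-elim (S′.irrefl (sym p) (mono _ _ q))

  tp-⊏ : tp _⊏_ x ⇔ tp _⊏′_ y → ∀ {i j} → lookup x i ⊏ lookup x j → lookup y i ⊏′ lookup y j
  tp-⊏ (to , from) {i} {j} p with to {i} {j} (inj₁ p)
  ... | inj₁ q = q
  ... | inj₂ q with from {j} {i} (inj₂ (sym q))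
  ... | inj₁ p′ = ⊥-elim (S.irrefl refl (S.trans p p′))
  ... | inj₂ p′ = ⊥-elim (S.irrefl (sym p′) p)

  tp-≡ : tp _⊏_ x ⇔ tp _⊏′_ y → ∀ {i j} → lookup x i ≡ lookup x j → lookup y i ≡ lookup y j
  tp-≡ (to , from) {i} {j} p with to {i} {j} (inj₂ p) | to {j} {i} (inj₂ (sym p))
  ... | inj₂ q | _      = q
  ... | inj₁ _ | inj₂ q = sym q
  ... | inj₁ q | inj₁ q′ = ⊥-elim (S′.irrefl refl (S′.trans q q′))

⇔-sym : ∀ {A : Set} {P Q : Rel A 0ℓ} → P ⇔ Q → Q ⇔ P
⇔-sym (p , q) = q , p

⇔-trans : ∀ {A : Set} {P Q R : Rel A 0ℓ} → P ⇔ Q → Q ⇔ R → P ⇔ R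
⇔-trans (p , q) (p′ , q′) = (λ x → p′ (p x)) , (λ x → q (q′ x))

-- Consequences of excluded middle: tables, representatives, comparison of sets and types

module Classical (em : ExcludedMiddle 0ℓ) where

  decide : {A : Set} (P : Pred A 0ℓ) → Decidable P
  decide P x = em

  does-cong : {P Q : Set} → (P → Q) → (Q → P) → does (em {P}) ≡ does (em {Q})
  does-cong {P} {Q} f g with em {P} | em {Q}
  ... | yes p | yes q = refl
  ... | yes p | no ¬q = ⊥-elim (¬q (f p))
  ... | no ¬p | yes q = ⊥-elim (¬p (g q))
  ... | no ¬p | no ¬q = refl

  does-reflects : {P Q : Set} → does (em {P}) ≡ does (em {Q}) → P → Q
  does-reflects {P} {Q} e p with em {P} | em {Q}
  ... | yes _ | yes q = q
  ... | no ¬p | _     = ⊥-elim (¬p p)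

  -- Relations on Fin r form a large type; tables make the types of tuples elements
  -- of a small one, to which excluded middle at level zero applies.
  Table : ℕ → Set
  Table r = Vec (Vec Bool r) r

  table : ∀ {r} → Rel (Fin r) 0ℓ → Table r
  table σ = tabulate λ i → tabulate λ j → does (em {σ i j})

  lookup-table : ∀ {r} (σ : Rel (Fin r) 0ℓ) i j → lookup (lookup (table σ) i) j ≡ does (em {σ i j})
  lookup-table σ i j = trans (cong (flip lookup j) (Vec.lookup∘tabulate _ i)) (Vec.lookup∘tabulate _ j)

  table-cong : ∀ {r} {σ τ : Rel (Fin r) 0ℓ} → σ ⇔ τ → table σ ≡ table τ
  table-cong (to , from) = Vec.tabulate-cong λ i → Vec.tabulate-cong λ j → does-cong to from

  table-reflects : ∀ {r} {σ τ : Rel (Fin r) 0ℓ} → table σ ≡ table τ → σ ⇔ τ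
  table-reflects {σ = σ} {τ} e = (λ {i} {j} → does-reflects (eq i j)) , (λ {i} {j} → does-reflects (sym (eq i j)))
    where
    eq : ∀ i j → does (em {σ i j}) ≡ does (em {τ i j})
    eq i j = trans (sym (lookup-table σ i j))
                   (trans (cong (λ t → lookup (lookup t i) j) e) (lookup-table τ i j))

  -- Finitely many properties cut `P` into finitely many classes, however large `X` is: split by one
  -- property at a time, and let excluded middle pick an element of each nonempty class.
  representatives : {X : Set} (Qs : List (X → Set)) (P : X → Set) →
    ∃ λ (R : List X) → ∀ x → P x →
    ∃ λ y → y List.∈ R × P y × (∀ {Q} → Q List.∈ Qs → (Q x → Q y) × (Q y → Q x))
  representatives {X} [] P with em {Σ X P}
  ... | yes (y , q) = y ∷ [] , λ x p → y , here refl , q , λ ()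
  ... | no none     = [] , λ x p → ⊥-elim (none (x , p))
  representatives (Q ∷ Qs) P
    with representatives Qs (λ x → P x × Q x) | representatives Qs (λ x → P x × ¬ Q x)
  ... | R₁ , rep₁ | R₂ , rep₂ = R₁ List.++ R₂ , rep
    where
    rep : ∀ x → P x → ∃ λ y → y List.∈ (R₁ List.++ R₂) × P y ×
          (∀ {Q′} → Q′ List.∈ (Q ∷ Qs) → (Q′ x → Q′ y) × (Q′ y → Q′ x))
    rep x p with em {Q x}
    ... | yes q = let y , y∈ , (p′ , q′) , same = rep₁ x (p , q) in
      y , List.∈-++⁺ˡ y∈ , p′ , λ { (here refl) → (λ _ → q′) , (λ _ → q) ; (there Q∈) → same Q∈ }
    ... | no ¬q = let y , y∈ , (p′ , ¬q′) , same = rep₂ x (p , ¬q) in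
      y , List.∈-++⁺ʳ R₁ y∈ , p′ , λ where
        (here refl) → (λ q → ⊥-elim (¬q q)) , (λ q → ⊥-elim (¬q′ q))
        (there Q∈)  → same Q∈

  module Chain {X : Set} {_⊏_ : Rel X 0ℓ} (sto : IsStrictTotalOrder _≡_ _⊏_)
    (elements : List X) (complete : ∀ x → x List.∈ elements) where

    open AlexTransitive sto elements complete using (max?; from-witness; alex-trans; ∖?)
    open IsStrictTotalOrder sto using (compare; irrefl) renaming (trans to ⊏-trans)

    Inc : List X → Set
    Inc = AllPairs _⊏_

    inc-unique : ∀ {s t} → Inc s → Inc t → (List._∈ s) ≐ (List._∈ t) → s ≡ t
    inc-unique [] [] e = refl
    inc-unique [] (_ ∷ _) (p , q) with () ← q (here refl)
    inc-unique (_ ∷ _) [] (p , q) with () ← p (here refl)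
    inc-unique {x ∷ s} {y ∷ t} (x⊏ ∷ s↑) (y⊏ ∷ t↑) (p , q) with p (here refl) | q (here refl)
    ... | there x∈t | there y∈s =
      ⊥-elim (irrefl refl (⊏-trans (All.lookup x⊏ y∈s) (All.lookup y⊏ x∈t)))
    ... | there x∈t | here refl = ⊥-elim (irrefl refl (All.lookup y⊏ x∈t))
    ... | here refl | _ = cong (x ∷_) (inc-unique s↑ t↑
      ( (λ z∈ → tail (All.lookup x⊏ z∈) (p (there z∈)))
      , (λ z∈ → tail (All.lookup y⊏ z∈) (q (there z∈))) ))
      where
      tail : ∀ {z L} → x ⊏ z → z List.∈ (x ∷ L) → z List.∈ L
      tail x⊏z (here refl) = ⊥-elim (irrefl refl x⊏z)
      tail x⊏z (there z∈)  = z∈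

    inc-sublist : ∀ {L s} → Inc L → Inc s → (∀ {x} → x List.∈ s → x List.∈ L) → s List.∈ sublists L
    inc-sublist {[]} {[]} L↑ s↑ s⊆L = here refl
    inc-sublist {[]} {x ∷ s} L↑ s↑ s⊆L with () ← s⊆L (here refl)
    inc-sublist {x ∷ L} {[]} (_ ∷ L↑) s↑ s⊆L = List.∈-++⁺ˡ (inc-sublist L↑ [] λ ())
    inc-sublist {x ∷ L} {y ∷ s} (x⊏ ∷ L↑) (y⊏ ∷ s↑) s⊆L with s⊆L (here refl)
    ... | here refl = List.∈-++⁺ʳ (sublists L) (List.∈-map⁺ (x ∷_) (inc-sublist L↑ s↑ λ z∈ →
      case s⊆L (there z∈) of λ where
        (here refl) → ⊥-elim (irrefl refl (All.lookup y⊏ z∈))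
        (there z∈L) → z∈L))
    ... | there y∈L = List.∈-++⁺ˡ (inc-sublist L↑ (y⊏ ∷ s↑) λ where
      (here refl) → y∈L
      (there z∈)  → case s⊆L (there z∈) of λ where
        (here refl) → ⊥-elim (irrefl refl (⊏-trans (All.lookup x⊏ y∈L) (All.lookup y⊏ z∈)))
        (there z∈L) → z∈L)

    -- The largest element of the symmetric difference decides; if there is none, the sets agree.
    alex-compare : (P Q : Pred X 0ℓ) → Alex _⊏_ P Q ⊎ P ≐ Q ⊎ Alex _⊏_ Q P
    alex-compare P Q with max? (decide (λ x → (P x × ¬ Q x) ⊎ (Q x × ¬ P x)))
    ... | inj₁ none = inj₂ (inj₁
      ( (λ {x} p → case em {Q x} of λ where
          (yes q) → q
          (no ¬q) → ⊥-elim (none x (inj₁ (p , ¬q))))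
      , (λ {x} q → case em {P x} of λ where
          (yes p) → p
          (no ¬p) → ⊥-elim (none x (inj₂ (q , ¬p)))) ))
    ... | inj₂ (m , m∈ , m≥) = case m∈ of λ where
        (inj₁ (p , ¬q)) → inj₂ (inj₂ (from-witness (decide Q) (decide P) (m , ¬q , p , λ m⊏x →
          above Q P (λ q ¬p → inj₂ (q , ¬p)) m⊏x , above P Q (λ p ¬q → inj₁ (p , ¬q)) m⊏x)))
        (inj₂ (q , ¬p)) → inj₁ (from-witness (decide P) (decide Q) (m , ¬p , q , λ m⊏x →
          above P Q (λ p ¬q → inj₁ (p , ¬q)) m⊏x , above Q P (λ q ¬p → inj₂ (q , ¬p)) m⊏x))
      where
      above : ∀ (P′ Q′ : Pred X 0ℓ) {x} →
              (P′ x → ¬ Q′ x → (P x × ¬ Q x) ⊎ (Q x × ¬ P x)) →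
              m ⊏ x → P′ x → Q′ x
      above P′ Q′ {x} differ m⊏x p with em {Q′ x}
      ... | yes q = q
      ... | no ¬q with m≥ (differ p ¬q)
      ... | inj₁ x⊏m  = ⊥-elim (irrefl refl (⊏-trans m⊏x x⊏m))
      ... | inj₂ refl = ⊥-elim (irrefl refl m⊏x)

    alex-transitive : {P Q R : Pred X 0ℓ} → Alex _⊏_ P Q → Alex _⊏_ Q R → Alex _⊏_ P R
    alex-transitive {P} {Q} {R} = alex-trans (decide P) (decide Q) (decide R)

    alex-witness : {P Q : Pred X 0ℓ} → ∃ (AlexTransitive.Witness sto elements complete P Q) → Alex _⊏_ P Q
    alex-witness {P} {Q} = from-witness (decide P) (decide Q)

    singleton⁺ : {P Q : Pred X 0ℓ} {x y : X} → (∀ {z} → P z → z ≡ x) → (∀ {z} → Q z → z ≡ y) → Q y →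
                 x ⊏ y → Alex _⊏_ P Q
    singleton⁺ {x = x} {y} p q y∈Q x⊏y = alex-witness (y ,
      (λ y∈P → irrefl (sym (p y∈P)) x⊏y) , y∈Q , λ y⊏z →
        (λ z∈P → ⊥-elim (irrefl refl (⊏-trans x⊏y (subst (y ⊏_) (p z∈P) y⊏z)))) ,
        (λ z∈Q → ⊥-elim (irrefl (sym (q z∈Q)) y⊏z)))

    singleton⁻ : {P Q : Pred X 0ℓ} {x y : X} → (∀ {z} → P z → z ≡ x) → (∀ {z} → Q z → z ≡ y) → P x → Q y →
                 Alex _⊏_ P Q → x ⊏ y
    singleton⁻ {x = x} {y} p q x∈P y∈Q P<Q with compare x y
    ... | tri< x⊏y _ _ = x⊏y
    ... | tri≈ _ refl _ = ⊥-elim (alex-irrefl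
      ((λ z∈P → subst _ (sym (p z∈P)) y∈Q) , (λ z∈Q → subst _ (sym (q z∈Q)) x∈P)) P<Q)
    ... | tri> _ _ y⊏x = ⊥-elim (alex-irrefl (id , id)
      (alex-transitive P<Q (singleton⁺ q p x∈P y⊏x)))

    private
      ⊏-compare : ∀ {x y} → ⊤ → ⊤ → x ⊏ y ⊎ x ≡ y ⊎ y ⊏ x
      ⊏-compare {x} {y} _ _ with compare x y
      ... | tri< p _ _ = inj₁ p
      ... | tri≈ _ p _ = inj₂ (inj₁ p)
      ... | tri> _ _ p = inj₂ (inj₂ p)

      module S = Sorting (λ (_ : X) → ⊤) _⊏_ ⊏-compare (λ _ _ _ → ⊏-trans)

      abstract
        sorted : (L : List X) → ∃ λ L′ → All (λ _ → ⊤) L′ × Inc L′ ×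
                 (∀ {y} → (y List.∈ L′ → y List.∈ L) × (y List.∈ L → y List.∈ L′))
        sorted L = S.sort L (All.tabulate λ _ → tt)

    sortedElements : List X
    sortedElements = proj₁ (sorted elements)

    -- A finite list of all possible supports; it makes the items finite in number, and also the
    -- tests by which patterns are told apart.
    inc-listed : ∀ {s} → Inc s → s List.∈ sublists sortedElements
    inc-listed s↑ = let _ , _ , L↑ , same = sorted elements
                    in inc-sublist L↑ s↑ (λ {x} _ → proj₂ same (complete x))

    support : ∀ {r} → Vec X r → List X
    support x = proj₁ (sorted (Vec.toList x))

    support-inc : ∀ {r} (x : Vec X r) → Inc (support x)
    support-inc x = proj₁ (proj₂ (proj₂ (sorted (Vec.toList x))))

    support-entries : ∀ {r} (x : Vec X r) → entries x ≐ (List._∈ support x)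
    support-entries x = let _ , _ , _ , same = sorted (Vec.toList x) in
      (λ v∈ → proj₂ same (Vec.∈-toList⁺ v∈)) , (λ v∈ → Vec.∈-toList⁻ (proj₁ same v∈))

    -- At the largest entry of x where x and y differ, y could take neither a
    -- smaller nor a larger value.
    tuple-unique : ∀ {r} {x y : Vec X r} → tp _⊏_ x ⇔ tp _⊏_ y → entries x ≐ entries y → x ≡ y
    tuple-unique {x = x} {y} x∼y (x⊆y , y⊆x)
      with max? (decide λ a → ∃ λ i → lookup x i ≡ a × lookup x i ≢ lookup y i)
    ... | inj₁ none = vec-ext x y λ i → case em {lookup x i ≡ lookup y i} of λ where
            (yes e) → e
            (no ne) → ⊥-elim (none (lookup x i) (i , refl , ne))
    ... | inj₂ (_ , (i , refl , xᵢ≢yᵢ) , max) = ⊥-elim (case compare (lookup x i) (lookup y i) of λ where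
            (tri≈ _ e _) → xᵢ≢yᵢ e
            (tri< xᵢ⊏yᵢ _ _) → let j , xⱼ≡yᵢ = entry (y⊆x (Vec.∈-lookup i y))
                                   xⱼ≡yⱼ = agree j (subst (lookup x i ⊏_) (sym xⱼ≡yᵢ) xᵢ⊏yᵢ)
                                   xⱼ≡xᵢ = tp-≡ sto sto y x (⇔-sym x∼y) {j} {i} (trans (sym xⱼ≡yⱼ) xⱼ≡yᵢ)
                               in xᵢ≢yᵢ (trans (sym xⱼ≡xᵢ) xⱼ≡yᵢ)
            (tri> _ _ yᵢ⊏xᵢ) → let j , yⱼ≡xᵢ = entry (x⊆y (Vec.∈-lookup i x))
                                   xᵢ⊏xⱼ = tp-⊏ sto sto y x (⇔-sym x∼y) {i} {j} (subst (lookup y i ⊏_) (sym yⱼ≡xᵢ) yᵢ⊏xᵢ)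
                               in irrefl (trans (sym yⱼ≡xᵢ) (sym (agree j xᵢ⊏xⱼ))) xᵢ⊏xⱼ)
      where
      agree : ∀ j → lookup x i ⊏ lookup x j → lookup x j ≡ lookup y j
      agree j xᵢ⊏xⱼ with em {lookup x j ≡ lookup y j}
      ... | yes e = e
      ... | no ne with max (j , refl , ne)
      ... | inj₁ xⱼ⊏xᵢ = ⊥-elim (irrefl refl (⊏-trans xᵢ⊏xⱼ xⱼ⊏xᵢ))
      ... | inj₂ xᵢ≡xⱼ = ⊥-elim (irrefl xᵢ≡xⱼ xᵢ⊏xⱼ)

  module _ {r : ℕ} where
    private
      open Chain (Fin.<-isStrictTotalOrder {r}) (List.allFin r) List.∈-allFin using (alex-compare)

      class : Rel (Fin r) 0ℓ → Fin r → Subset r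
      class σ i = tabulate λ j → does (em {σ i j × σ j i})

      class⁺ : ∀ σ {i j} → σ i j × σ j i → j Subset.∈ class σ i
      class⁺ σ {i} {j} p = Vec.lookup⇒[]= j _ (trans (Vec.lookup∘tabulate _ j) (holds p))
        where
        holds : ∀ {P : Set} → P → does (em {P}) ≡ true
        holds {P} p with em {P}
        ... | yes _ = refl
        ... | no ¬p = ⊥-elim (¬p p)

      class⁻ : ∀ σ {i j} → j Subset.∈ class σ i → σ i j × σ j i
      class⁻ σ {i} {j} p = valid (trans (sym (Vec.lookup∘tabulate _ j)) (Vec.[]=⇒lookup p))
        where
        valid : ∀ {P : Set} → does (em {P}) ≡ true → P
        valid {P} e with em {P}
        ... | yes p = p

      <alex-compare : ∀ {S T : Subset r} → ⊤ → ⊤ → S <alex T ⊎ S ≡ T ⊎ T <alex S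
      <alex-compare {S} {T} _ _ with alex-compare (Subset._∈ S) (Subset._∈ T)
      ... | inj₁ p              = inj₁ p
      ... | inj₂ (inj₁ (p , q)) = inj₂ (inj₁ (Subset.⊆-antisym p q))
      ... | inj₂ (inj₂ p)       = inj₂ (inj₂ p)

      module S = Sorting (λ (_ : Subset r) → ⊤) _<alex_ <alex-compare (λ _ _ _ → <alex-trans)

      fromList-AllPairs : ∀ {L : List (Subset r)} → AllPairs _<alex_ L →
                          VecAllPairs.AllPairs _<alex_ (Vec.fromList L)
      fromList-AllPairs []        = []
      fromList-AllPairs (p ∷ L↑) = VecAll.fromList⁺ p ∷ fromList-AllPairs L↑

    enumerate : (σ : Rel (Fin r) 0ℓ) → ∃₂ λ k (Ss : Vec (Subset r) k) → Enumerates σ Ss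
    enumerate σ with S.sort (List.map (class σ) (List.allFin r)) (All.tabulate λ _ → tt)
    ... | L , _ , L↑ , same = length L , Vec.fromList L , record
      { increasing = fromList-AllPairs L↑
      ; classes    =
          (λ S∈ → let i , _ , e = List.∈-map⁻ (class σ) (proj₁ same (Vec.∈-fromList⁻ S∈))
                  in i , subst (λ S → (Subset._∈ S) ≐ (λ j → σ i j × σ j i)) (sym e) (class⁻ σ , class⁺ σ))
        , (λ (i , p , q) → Vec.∈-fromList⁺ (proj₂ same (subst (List._∈ _)
             (Subset.⊆-antisym (λ j∈ → q (class⁻ σ j∈)) (λ j∈ → class⁺ σ (p j∈)))
             (List.∈-map⁺ (class σ) (List.∈-allFin i)))))
      }

    -- A full relation has at most one class and `τ` has at least two, those of `i` and `j`. This
    -- puts constant tuples before all others.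
    fewer-classes : {σ τ : Rel (Fin r) 0ℓ} → (∀ i j → σ i j) → (∀ i → τ i i) →
                    ∀ i j → ¬ (τ i j × τ j i) → σ ◁ τ
    fewer-classes {σ} {τ} full τ-refl i j i≢j with enumerate σ | enumerate τ
    ... | k , Ss , E | l , Ts , F = fewer E F
      (ℕ.<-≤-trans (s≤s (one (Enumerates.increasing E) λ S∈ T∈ →
          equal (proj₁ (Enumerates.classes E) S∈) (proj₁ (Enumerates.classes E) T∈)))
        (two (member i) (member j) λ e →
          i≢j (class⁻ τ (subst (j Subset.∈_) (sym e) (class⁺ τ (τ-refl j , τ-refl j))))))
      where
      equal : ∀ {S T} → IsClass σ S → IsClass σ T → S ≡ T
      equal (i , p , q) (j , p′ , q′) = Subset.⊆-antisym
        (λ _ → q′ (full _ _ , full _ _)) (λ _ → q (full _ _ , full _ _))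

      member : ∀ i → class τ i Vec.∈ Ts
      member i = proj₂ (Enumerates.classes F) (i , class⁻ τ , class⁺ τ)

      one : ∀ {k} {Ss : Vec (Subset r) k} → VecAllPairs.AllPairs _<alex_ Ss →
            (∀ {S T} → S Vec.∈ Ss → T Vec.∈ Ss → S ≡ T) → k ≤ 1
      one []                        e = z≤n
      one (_ ∷ [])                  e = s≤s z≤n
      one ((S< VecAll.∷ _) ∷ _ ∷ _) e =
        ⊥-elim (<alex-irrefl (e (VecAny.here refl) (VecAny.there (VecAny.here refl))) S<)

      two : ∀ {k} {Ss : Vec (Subset r) k} {S T} → S Vec.∈ Ss → T Vec.∈ Ss → S ≢ T → 2 ≤ k
      two (VecAny.here refl) (VecAny.here refl) ne = ⊥-elim (ne refl)
      two (VecAny.here _)    (VecAny.there (VecAny.here _))  ne = s≤s (s≤s z≤n)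
      two (VecAny.here _)    (VecAny.there (VecAny.there _)) ne = s≤s (s≤s z≤n)
      two (VecAny.there (VecAny.here _))  _ ne = s≤s (s≤s z≤n)
      two (VecAny.there (VecAny.there _)) _ ne = s≤s (s≤s z≤n)

-- Quotient maps of structures

inc-map : ∀ {X Y : Set} {_⊏_ : Rel X 0ℓ} {_⊏′_ : Rel Y 0ℓ} {f : X → Y} {s} →
          (∀ {x y} → x List.∈ s → y List.∈ s → x ⊏ y → f x ⊏′ f y) →
          AllPairs _⊏_ s → AllPairs _⊏′_ (List.map f s)
inc-map mono []        = []
inc-map mono (x⊏ ∷ s↑) =
  All.map⁺ (All.tabulate λ y∈ → mono (here refl) (there y∈) (All.lookup x⊏ y∈)) ∷
  inc-map (λ x∈ y∈ → mono (there x∈) (there y∈)) s↑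

entries-map : ∀ {X Y : Set} {r} {f : X → Y} {x : Vec X r} {s} → entries x ≐ (List._∈ s) →
              entries (Vec.map f x) ≐ (List._∈ List.map f s)
entries-map {f = f} {x} {s} (to , from) = to′ , from′
  where
  to′ : ∀ {y} → y Vec.∈ Vec.map f x → y List.∈ List.map f s
  to′ y∈ with entry y∈
  ... | i , refl = subst (List._∈ List.map f s) (sym (Vec.lookup-map i f x))
                         (List.∈-map⁺ f (to (Vec.∈-lookup i x)))
  from′ : ∀ {y} → y List.∈ List.map f s → y Vec.∈ Vec.map f x
  from′ y∈ with List.∈-map⁻ f y∈
  ... | v , v∈ , refl = Vec.∈-map⁺ f (from v∈)

tp-map : ∀ {X Y : Set} {_⊏_ : Rel X 0ℓ} {_⊏′_ : Rel Y 0ℓ} {f : X → Y}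
         (sto : IsStrictTotalOrder _≡_ _⊏_) (sto′ : IsStrictTotalOrder _≡_ _⊏′_) {r} (x : Vec X r) →
         (∀ i j → lookup x i ⊏ lookup x j → f (lookup x i) ⊏′ f (lookup x j)) →
         tp _⊏_ x ⇔ tp _⊏′_ (Vec.map f x)
tp-map {_⊏′_ = _⊏′_} {f} sto sto′ x mono = tp-intro sto sto′ x (Vec.map f x)
  (λ i j p → subst₂ _⊏′_ (sym (Vec.lookup-map i f x)) (sym (Vec.lookup-map j f x)) (mono i j p))
  (λ i j p → trans (Vec.lookup-map i f x) (trans (cong f p) (sym (Vec.lookup-map j f x))))

lookup-reflects-≡ : ∀ {X : Set} {_⊏_ : Rel X 0ℓ} → IsStrictTotalOrder _≡_ _⊏_ →
                    ∀ {s} → AllPairs _⊏_ s →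
                    ∀ {i j} → List.lookup s i ≡ List.lookup s j → i ≡ j
lookup-reflects-≡ sto s↑ {i} {j} e with Fin.<-cmp i j
... | tri< i<j _ _ = ⊥-elim (IsStrictTotalOrder.irrefl sto e (lookup-mono s↑ i<j))
... | tri≈ _ i≡j _ = i≡j
... | tri> _ _ j<i = ⊥-elim (IsStrictTotalOrder.irrefl sto (sym e) (lookup-mono s↑ j<i))

lookup-reflects-< : ∀ {X : Set} {_⊏_ : Rel X 0ℓ} → IsStrictTotalOrder _≡_ _⊏_ →
                    ∀ {s} → AllPairs _⊏_ s →
                    ∀ {i j} → List.lookup s i ⊏ List.lookup s j → i Fin.< j
lookup-reflects-< sto {s} s↑ {i} {j} p with Fin.<-cmp i j
... | tri< i<j _ _  = i<j
... | tri≈ _ refl _ = ⊥-elim (IsStrictTotalOrder.irrefl sto refl p)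
... | tri> _ _ j<i  = ⊥-elim (IsStrictTotalOrder.irrefl sto refl
                        (IsStrictTotalOrder.trans sto p (lookup-mono s↑ j<i)))

nth : {X : Set} → X → List X → ℕ → X
nth d []      i       = d
nth d (x ∷ s) zero    = x
nth d (x ∷ s) (suc i) = nth d s i

nth-map : {X Y : Set} (f : X → Y) (d : X) → ∀ s i → f (nth d s i) ≡ nth (f d) (List.map f s) i
nth-map f d []      i       = refl
nth-map f d (x ∷ s) zero    = refl
nth-map f d (x ∷ s) (suc i) = nth-map f d s i

nth-lookup : {X : Set} (d : X) → ∀ s i → nth d s (toℕ i) ≡ List.lookup s i
nth-lookup d (x ∷ s) zero    = refl
nth-lookup d (x ∷ s) (suc i) = nth-lookup d s i

nth-member : {X : Set} (d : X) → ∀ s i → nth d s i ≡ d ⊎ nth d s i List.∈ s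
nth-member d []      i       = inj₁ refl
nth-member d (x ∷ s) zero    = inj₂ (here refl)
nth-member d (x ∷ s) (suc i) with nth-member d s i
... | inj₁ e = inj₁ e
... | inj₂ p = inj₂ (there p)

nth-mono : ∀ {X : Set} {_⊏_ : Rel X 0ℓ} {d s} → AllPairs _⊏_ s → ∀ {i j} → i < j → j < length s →
           nth d s i ⊏ nth d s j
nth-mono {_⊏_ = _⊏_} {d} {s} s↑ {i} {j} i<j j< = subst₂ _⊏_ (at i<) (at j<)
  (lookup-mono s↑ (subst₂ _<_ (sym (Fin.toℕ-fromℕ< i<)) (sym (Fin.toℕ-fromℕ< j<)) i<j))
  where
  i< : i < length s
  i< = ℕ.<-trans i<j j<
  at : ∀ {i} (p : i < length s) → List.lookup s (Fin.fromℕ< p) ≡ nth d s i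
  at p = trans (sym (nth-lookup d s _)) (cong (nth d s) (Fin.toℕ-fromℕ< p))

module Quotients (em : ExcludedMiddle 0ℓ) (Θ : Language) where
  open Classical em
  open Language Θ

  -- The number of distinct entries is recorded beside the table, so that the size of a block edge
  -- can be read off any pattern, realised or not.
  Pattern : Set
  Pattern = Σ Symbol λ θ → Table (arity θ) × ℕ

  module Ordered (𝓧 : Structure Θ) where
    open Structure 𝓧 public
    open Chain isStrictTotalOrder elements elements-complete public
    open IsStrictTotalOrder isStrictTotalOrder public using (compare; irrefl) renaming (trans to ⊏-trans)

    type : ∀ {r} → Vec Carrier r → Table r
    type x = table (tp _⊏_ x)

    -- A tuple of given type is determined by the increasing list s of its entries,
    -- which stands for it.
    Edge : Pattern → List Carrier → Set
    Edge (θ , M , k) s = Inc s × length s ≡ k ×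
      ∃ λ x → x ∈ rel θ × type x ≡ M × entries x ≐ (List._∈ s)

    inc-nonconst : ∀ {x xs r} {a : Vec Carrier r} → Inc (x ∷ xs) → xs ≢ [] →
                   entries a ≐ (List._∈ (x ∷ xs)) → ¬ Const a
    inc-nonconst {xs = []} _ ne _ _ = ne refl
    inc-nonconst {x} {y ∷ _} ((x⊏y ∷ _) ∷ _) _ (_ , from) c
      with entry (from (here refl)) | entry (from (there (here refl)))
    ... | i , refl | j , refl = irrefl (c i j) x⊏y

    nonconst-support : ∀ {r} (a : Vec Carrier r) → ¬ Const a →
                       ∃₂ λ x xs → support a ≡ x ∷ xs × xs ≢ []
    nonconst-support a ¬c with support a | support-entries a
    ... | [] | to , _ = ⊥-elim (¬c λ i j → case to (Vec.∈-lookup i a) of λ ())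
    ... | x ∷ [] | to , _ = ⊥-elim (¬c λ i j → trans (only (to (Vec.∈-lookup i a))) (sym (only (to (Vec.∈-lookup j a)))))
      where
      only : ∀ {y} → y List.∈ (x ∷ []) → y ≡ x
      only (here e) = e
    ... | x ∷ y ∷ xs | _ = x , y ∷ xs , refl , λ ()

    const-before : ∀ {r} (x y : Vec Carrier r) → Const x → ¬ Const y → tp _⊏_ x ◁ tp _⊏_ y
    const-before x y cx ¬cy with em {∃₂ λ i j → lookup y i ≢ lookup y j}
    ... | yes (i , j , ne) = fewer-classes (λ i j → inj₂ (cx i j)) (λ _ → inj₂ refl) i j λ where
      (inj₁ p , inj₁ q) → irrefl refl (⊏-trans p q)
      (inj₂ e , _)      → ne e
      (inj₁ _ , inj₂ e) → ne (sym e)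
    ... | no none = ⊥-elim (¬cy λ i j → case em {lookup y i ≡ lookup y j} of λ where
      (yes e) → e
      (no ne) → ⊥-elim (none (i , j , ne)))

    replicate-entries : ∀ {r} {x y : Carrier} → y Vec.∈ Vec.replicate r x → y ≡ x
    replicate-entries {r} {x} y∈ with entry y∈
    ... | i , refl = Vec.lookup-replicate i x

    replicate-sal : ∀ r {x y} → x ⊏ y → Sal _⊏_ (Vec.replicate (suc r) x) (Vec.replicate (suc r) y)
    replicate-sal r {x} {y} x⊏y =
      inj₂ (((λ {i} {j} _ → inj₂ (replicate-const i j)) , (λ {i} {j} _ → inj₂ (replicate-const i j))) ,
            (λ e → alex-irrefl e x<y) , x<y)
      where
      x<y : Alex _⊏_ (entries (Vec.replicate (suc r) x)) (entries (Vec.replicate (suc r) y))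
      x<y = singleton⁺ (replicate-entries {suc r}) (replicate-entries {suc r}) (VecAny.here refl) x⊏y

    replicate-sal⁻ : ∀ r {x y} → Sal _⊏_ (Vec.replicate (suc r) x) (Vec.replicate (suc r) y) → x ⊏ y
    replicate-sal⁻ r (inj₁ p) = ⊥-elim (◁-irrefl
      ((λ {i} {j} _ → inj₂ (replicate-const i j)) , (λ {i} {j} _ → inj₂ (replicate-const i j))) p)
    replicate-sal⁻ r (inj₂ (_ , _ , p)) =
      singleton⁻ (replicate-entries {suc r}) (replicate-entries {suc r}) (VecAny.here refl) (VecAny.here refl) p

    -- The i-th entry of x is mapped to that of y; this map is increasing.
    same-type-length : ∀ {r} (x y : Vec Carrier r) → tp _⊏_ x ⇔ tp _⊏_ y →
                       length (support x) ≡ length (support y)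
    same-type-length x y x∼y = trans (sym (List.length-map h (support x)))
      (cong length (inc-unique (inc-map mono (support-inc x)) (support-inc y) (to , from)))
      where
      h : Carrier → Carrier
      h v with em {v Vec.∈ x}
      ... | yes v∈ = lookup y (proj₁ (entry v∈))
      ... | no _   = v

      h-lookup : ∀ i → h (lookup x i) ≡ lookup y i
      h-lookup i with em {lookup x i Vec.∈ x}
      ... | yes v∈ = tp-≡ isStrictTotalOrder isStrictTotalOrder x y x∼y (proj₂ (entry v∈))
      ... | no ∉x  = ⊥-elim (∉x (Vec.∈-lookup i x))

      index : ∀ {v} → v List.∈ support x → ∃ λ i → lookup x i ≡ v
      index v∈ = entry (proj₂ (support-entries x) v∈)

      mono : ∀ {u v} → u List.∈ support x → v List.∈ support x → u ⊏ v → h u ⊏ h v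
      mono u∈ v∈ u⊏v with index u∈ | index v∈
      ... | i , refl | j , refl = subst₂ _⊏_ (sym (h-lookup i)) (sym (h-lookup j))
              (tp-⊏ isStrictTotalOrder isStrictTotalOrder x y x∼y u⊏v)

      to : ∀ {v} → v List.∈ List.map h (support x) → v List.∈ support y
      to v∈ with List.∈-map⁻ h v∈
      ... | u , u∈ , refl with index u∈
      ... | i , refl = subst (List._∈ support y) (sym (h-lookup i))
                         (proj₁ (support-entries y) (Vec.∈-lookup i y))

      from : ∀ {v} → v List.∈ support y → v List.∈ List.map h (support x)
      from v∈ with entry (proj₂ (support-entries y) v∈)
      ... | i , refl = subst (List._∈ List.map h (support x)) (h-lookup i)
                         (List.∈-map⁺ h (proj₁ (support-entries x) (Vec.∈-lookup i x)))

  -- The chain of items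

  module _ (R : ℕ) (rep : Fin R → Pattern) where

    -- The sort zero marks the vertices x, given as (zero , x , []); the sort
    -- suc r marks the edges x ∷ xs of pattern rep r.
    Item : Set → Set
    Item X = Fin (suc R) × X × List X

    -- An index past the end yields the default `x` of `nth`, as a foreign sort does; so every value
    -- is a vertex of the item.
    value : {X : Set} → Item X → Fin (suc R) → ℕ → X
    value (r , x , xs) r′ i with r Fin.≟ r′
    ... | yes _ = nth x (x ∷ xs) i
    ... | no _  = x

    value-own : ∀ {X : Set} r (x : X) xs i → value (r , x , xs) r i ≡ nth x (x ∷ xs) i
    value-own r x xs i with r Fin.≟ r
    ... | yes _ = refl
    ... | no ne = ⊥-elim (ne refl)

    value-other : ∀ {X : Set} {r r′} {x : X} {xs} i → r ≢ r′ → value (r , x , xs) r′ i ≡ x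
    value-other {r = r} {r′} i ne with r Fin.≟ r′
    ... | yes e = ⊥-elim (ne e)
    ... | no _  = refl

    value-vertex : ∀ {X : Set} r (x : X) r′ i → value (r , x , []) r′ i ≡ x
    value-vertex r x r′ i with r Fin.≟ r′
    value-vertex r x r′ zero    | yes _ = refl
    value-vertex r x r′ (suc i) | yes _ = refl
    value-vertex r x r′ i       | no _ = refl

    value-member : ∀ {X : Set} r (x : X) xs r′ i → value (r , x , xs) r′ i List.∈ (x ∷ xs)
    value-member r x xs r′ i with r Fin.≟ r′
    ... | no _  = here refl
    ... | yes _ with nth-member x (x ∷ xs) i
    ... | inj₁ e = here e
    ... | inj₂ p = p

    value-map : ∀ {X Y : Set} (f : X → Y) r x xs r′ i →
                f (value (r , x , xs) r′ i) ≡ value (r , f x , List.map f xs) r′ i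
    value-map f r x xs r′ i with r Fin.≟ r′
    ... | yes _ = nth-map f x (x ∷ xs) i
    ... | no _  = refl

    module Items (𝓧 : Structure Θ) where
      open Ordered 𝓧

      Valid : Item Carrier → Set
      Valid (zero  , x , xs) = xs ≡ []
      Valid (suc r , x , xs) = Edge (rep r) (x ∷ xs) × xs ≢ []

      members : Item Carrier → Pred Carrier 0ℓ
      members (_ , x , xs) = List._∈ (x ∷ xs)

      infix 4 _≺_
      _≺_ : Rel (Item Carrier) 0ℓ
      a ≺ b = proj₁ a Fin.< proj₁ b ⊎ (proj₁ a ≡ proj₁ b × Alex _⊏_ (members a) (members b))

      ≺-trans : ∀ {a b c} → a ≺ b → b ≺ c → a ≺ c
      ≺-trans (inj₁ p) (inj₁ q) = inj₁ (Fin.<-trans p q)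
      ≺-trans (inj₁ p) (inj₂ (refl , _)) = inj₁ p
      ≺-trans (inj₂ (refl , _)) (inj₁ q) = inj₁ q
      ≺-trans (inj₂ (refl , p)) (inj₂ (refl , q)) = inj₂ (refl , alex-transitive p q)

      ≺-irrefl : ∀ {a} → ¬ (a ≺ a)
      ≺-irrefl (inj₁ p)       = ℕ.<-irrefl refl p
      ≺-irrefl (inj₂ (_ , p)) = alex-irrefl (id , id) p

      valid-inc : ∀ {a} → Valid a → Inc (proj₁ (proj₂ a) ∷ proj₂ (proj₂ a))
      valid-inc {zero  , _} refl           = [] ∷ []
      valid-inc {suc r , _} ((s↑ , _) , _) = s↑

      -- Validity makes the lists increasing, hence determined by their members; so items of one
      -- sort with equal member sets coincide.
      ≺-compare : ∀ {a b} → Valid a → Valid b → a ≺ b ⊎ a ≡ b ⊎ b ≺ a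
      ≺-compare {a} {b} va vb with Fin.<-cmp (proj₁ a) (proj₁ b)
      ... | tri< p _ _ = inj₁ (inj₁ p)
      ... | tri> _ _ p = inj₂ (inj₂ (inj₁ p))
      ... | tri≈ _ e _ with alex-compare (members a) (members b)
      ... | inj₁ p               = inj₁ (inj₂ (e , p))
      ... | inj₂ (inj₂ p)        = inj₂ (inj₂ (inj₂ (sym e , p)))
      ... | inj₂ (inj₁ p) with e | inc-unique (valid-inc {a} va) (valid-inc {b} vb) p
      ... | refl | refl = inj₂ (inj₁ refl)

      private
        candidates : List (Item Carrier)
        candidates = List.cartesianProduct (List.allFin (suc R))
                       (List.cartesianProduct elements (sublists sortedElements))

        valid-candidate : ∀ {a} → Valid a → a List.∈ candidates
        valid-candidate {r , x , xs} v = List.∈-cartesianProduct⁺ (List.∈-allFin r)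
          (List.∈-cartesianProduct⁺ (elements-complete x)
            (inc-listed (case valid-inc {r , x , xs} v of λ { (_ ∷ xs↑) → xs↑ })))

        module S = Sorting Valid _≺_ ≺-compare (λ _ _ _ → ≺-trans)

        abstract
          sorted : ∃ λ L → All Valid L × AllPairs _≺_ L × (∀ {a} →
                   (a List.∈ L → a List.∈ List.filter (decide Valid) candidates) ×
                   (a List.∈ List.filter (decide Valid) candidates → a List.∈ L))
          sorted = S.sort (List.filter (decide Valid) candidates) (All.all-filter (decide Valid) candidates)

      size : ℕ
      size = length (proj₁ sorted)

      item : Fin size → Item Carrier
      item = List.lookup (proj₁ sorted)

      item-valid : ∀ i → Valid (item i)
      item-valid i = All.lookup (proj₁ (proj₂ sorted)) (List.∈-lookup i)

      item-mono : ∀ {i j} → i Fin.< j → item i ≺ item j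
      item-mono = lookup-mono (proj₁ (proj₂ (proj₂ sorted)))

      abstract
        index : ∀ a → Valid a → ∃ λ i → item i ≡ a
        index a v = member-index (proj₂ (proj₂ (proj₂ (proj₂ sorted)))
                      (List.∈-filter⁺ (decide Valid) (valid-candidate v) v))

      item-reflects : ∀ {i j} → item i ≺ item j → i Fin.< j
      item-reflects {i} {j} p with Fin.<-cmp i j
      ... | tri< i<j _ _  = i<j
      ... | tri≈ _ refl _ = ⊥-elim (≺-irrefl p)
      ... | tri> _ _ j<i  = ⊥-elim (≺-irrefl (≺-trans p (item-mono j<i)))

      item-injective : ∀ {i j} → item i ≡ item j → i ≡ j
      item-injective {i} {j} e with Fin.<-cmp i j
      ... | tri< i<j _ _ = ⊥-elim (≺-irrefl (subst (_≺ item j) e (item-mono i<j)))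
      ... | tri≈ _ i≡j _ = i≡j
      ... | tri> _ _ j<i = ⊥-elim (≺-irrefl (subst (item j ≺_) e (item-mono j<i)))

    -- Action of quotient maps on items

    module Transfer {𝓑 𝓐 : Structure Θ} (F : StrongRigidQuotient 𝓑 𝓐) where
      open StrongRigidQuotient F renaming (fun to f)
      private
        module A  = Ordered 𝓐
        module B  = Ordered 𝓑
        module IA = Items 𝓐
        module IB = Items 𝓑

      Collapsed : B.Carrier → List B.Carrier → Set
      Collapsed x xs = ∀ {y} → y List.∈ (x ∷ xs) → f y ≡ f x

      push : Item B.Carrier → Item A.Carrier
      push (r , x , xs) with em {Collapsed x xs}
      ... | yes _ = zero , f x , []
      ... | no _  = r , f x , List.map f xs

      push-collapsed : ∀ r x xs → Collapsed x xs → push (r , x , xs) ≡ (zero , f x , [])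
      push-collapsed r x xs c with em {Collapsed x xs}
      ... | yes _ = refl
      ... | no ¬c = ⊥-elim (¬c c)

      push-injective : ∀ r x xs → ¬ Collapsed x xs → push (r , x , xs) ≡ (r , f x , List.map f xs)
      push-injective r x xs ¬c with em {Collapsed x xs}
      ... | yes c = ⊥-elim (¬c c)
      ... | no _  = refl

      -- The identity behind naturality. On a collapsed item both sides are `f x`; otherwise `nth`
      -- commutes with mapping.
      push-value : ∀ a r i → f (value a r i) ≡ value (push a) r i
      push-value (s , x , xs) r i with em {Collapsed x xs}
      ... | yes c = trans (c (value-member s x xs r i)) (sym (value-vertex zero (f x) r i))
      ... | no _  = value-map f s x xs r i

      vertex-collapsed : ∀ {x} → Collapsed x []
      vertex-collapsed (here refl) = refl

      spread-out : ∀ {x xs r} {b : Vec B.Carrier r} → entries b ≐ (List._∈ (x ∷ xs)) → ¬ Collapsed x xs →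
                   ¬ (∀ i j → f (lookup b i) ≡ f (lookup b j))
      spread-out (_ , from) ¬c c = ¬c λ y∈ → case entry (from y∈) , entry (from (here refl)) of λ where
        ((i , refl) , (j , refl)) → c i j

      -- If the edge does not collapse, its tuple has a nonconstant image, so `strong` makes `f`
      -- increasing on the entries; order, length and type survive.
      push-edge : ∀ p {x xs} → B.Edge p (x ∷ xs) → ¬ Collapsed x xs →
                  A.Edge p (List.map f (x ∷ xs))
      push-edge (θ , M , k) {x} {xs} (s↑ , len , b , b∈θ , b-type , b-entries) ¬c =
        inc-map mono s↑ , trans (List.length-map f (x ∷ xs)) len ,
        Vec.map f b , isHomomorphism b∈θ ,
        trans (sym (table-cong (tp-map B.isStrictTotalOrder A.isStrictTotalOrder b (strong b∈θ (spread-out b-entries ¬c))))) b-type ,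
        entries-map b-entries
        where
        mono : ∀ {y z} → y List.∈ (x ∷ xs) → z List.∈ (x ∷ xs) → y B.⊏ z → f y A.⊏ f z
        mono y∈ z∈ y⊏z with entry (proj₂ b-entries y∈) | entry (proj₂ b-entries z∈)
        ... | i , refl | j , refl = strong b∈θ (spread-out b-entries ¬c) i j y⊏z

      push-valid : ∀ a → IB.Valid a → IA.Valid (push a)
      push-valid (r , x , xs) v with em {Collapsed x xs}
      ... | yes _ = refl
      push-valid (zero  , x , .[]) refl | no ¬c = ⊥-elim (¬c vertex-collapsed)
      push-valid (suc r , x , xs) (e , ne) | no ¬c = push-edge (rep r) e ¬c , λ e → ne (map-[] e)
        where
        map-[] : ∀ {ys} → List.map f ys ≡ [] → ys ≡ []
        map-[] {[]} _ = refl

      -- The image of `b` is not constant, so `strong` makes `f` increasing on the support of `b`.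
      -- The mapped support is an increasing list with the members of `x ∷ xs`, hence equal to it.
      lift-edge : ∀ {r x xs b} → let θ , M , k = rep r in
                  A.Inc (x ∷ xs) → length (x ∷ xs) ≡ k → xs ≢ [] → b ∈ B.rel θ →
                  A.type (Vec.map f b) ≡ M → entries (Vec.map f b) ≐ (List._∈ (x ∷ xs)) →
                  ∃₂ λ y ys → B.support b ≡ y ∷ ys × IB.Valid (suc r , y , ys) ×
                  push (suc r , y , ys) ≡ (suc r , x , xs) × B.type b ≡ M
      lift-edge {r} {x} {xs} {b} s↑ len ne b∈θ fb-type fb-entries = go (B.nonconst-support b λ c →
          nonconst (λ i j → cong f (c i j)))
        where
        nonconst : ¬ (∀ i j → f (lookup b i) ≡ f (lookup b j))
        nonconst c = A.inc-nonconst {a = Vec.map f b} s↑ ne fb-entries (map-const b c)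

        mono : ∀ {y z} → y List.∈ B.support b → z List.∈ B.support b → y B.⊏ z → f y A.⊏ f z
        mono y∈ z∈ y⊏z with entry (proj₂ (B.support-entries b) y∈) | entry (proj₂ (B.support-entries b) z∈)
        ... | i , refl | j , refl = strong b∈θ nonconst i j y⊏z

        b-type : B.type b ≡ proj₁ (proj₂ (rep r))
        b-type = trans (table-cong (tp-map B.isStrictTotalOrder A.isStrictTotalOrder b (strong b∈θ nonconst))) fb-type

        image : List.map f (B.support b) ≡ x ∷ xs
        image = A.inc-unique (inc-map mono (B.support-inc b)) s↑
          (≐-trans (≐-sym (entries-map {x = b} (B.support-entries b))) fb-entries)

        go : (∃₂ λ y ys → B.support b ≡ y ∷ ys × ys ≢ []) → _
        go (y , ys , e , ne′) = y , ys , e ,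
          ((subst B.Inc e (B.support-inc b) ,
            trans (cong length (sym e)) (trans (sym (List.length-map f (B.support b))) (trans (cong length image) len)) ,
            b , b∈θ , b-type , subst (λ s → entries b ≐ (List._∈ s)) e (B.support-entries b)) , ne′) ,
          pushed , b-type
          where
          image′ : f y ∷ List.map f ys ≡ x ∷ xs
          image′ = trans (cong (List.map f) (sym e)) image
          pushed : push (suc r , y , ys) ≡ (suc r , x , xs)
          pushed = trans (push-injective (suc r) y ys λ c → nonconst λ i j →
              trans (c (in-support i)) (sym (c (in-support j))))
            (case image′ of λ { refl → refl })
            where
            in-support : ∀ i → lookup b i List.∈ (y ∷ ys)
            in-support i = subst (lookup b i List.∈_) e (proj₁ (B.support-entries b) (Vec.∈-lookup i b))

      -- Vertices lift by surjectivity of `f`, edges by that of `hat`. The equality of sorts lets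
      -- `push-in-order` settle items of different sorts.
      push-onto : ∀ a → IA.Valid a → ∃ λ b → IB.Valid b × proj₁ b ≡ proj₁ a × push b ≡ a
      push-onto (zero , x , .[]) refl with IsRigidSurjection.surjective rigidSurjection x
      ... | y , fy≡x = (zero , y , []) , refl , refl ,
        trans (push-collapsed zero y [] vertex-collapsed) (cong (λ x → zero , x , []) (fy≡x refl))
      push-onto (suc r , x , xs) ((s↑ , len , a , a∈θ , a-type , a-entries) , ne)
        with IsRigidSurjection.surjective (hatRigidSurjection (proj₁ (rep r))) (a , a∈θ)
      ... | (b , b∈θ) , fb≡a with fb≡a {b , b∈θ} refl
      ... | refl with lift-edge {r} s↑ len ne b∈θ a-type a-entries
      ... | y , ys , _ , v , pushed , _ = (suc r , y , ys) , v , refl , pushed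

      ⊏-≤ : ∀ {x y z} → x B.⊏ y → y B.⊏ z ⊎ y ≡ z → x B.⊏ z
      ⊏-≤ p (inj₁ q)    = B.⊏-trans p q
      ⊏-≤ p (inj₂ refl) = p

      Preceded : Item A.Carrier → Item B.Carrier → Set
      Preceded a b = ∃ λ b′ → IB.Valid b′ × push b′ ≡ a × b′ IB.≺ b

      -- The least preimage of `x` lies below that of `f y`, hence below `y`. If the item over `y`
      -- is an edge, any vertex precedes it.
      vertex-in-order : ∀ {x r y ys} → IB.Valid (r , y , ys) → x A.⊏ f y → Preceded (zero , x , []) (r , y , ys)
      vertex-in-order {x} {r} {y} {ys} v x⊏fy with IsRigidSurjection.rigid rigidSurjection x⊏fy
      ... | x′ , y′ , (fx′≡x , _) , (_ , y′≤) , x′⊏y′ =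
        (zero , x′ , []) , refl ,
        trans (push-collapsed zero x′ [] vertex-collapsed) (cong (λ x → zero , x , []) fx′≡x) , below r v
        where
        x′⊏y : x′ B.⊏ y
        x′⊏y = ⊏-≤ x′⊏y′ (y′≤ refl)
        below : ∀ r → IB.Valid (r , y , ys) → (zero , x′ , []) IB.≺ (r , y , ys)
        below zero refl = inj₂ (refl , B.singleton⁺ (λ { (here e) → e }) (λ { (here e) → e }) (here refl) x′⊏y)
        below (suc r) _ = inj₁ (s≤s z≤n)

      -- The tuples `a` and `Vec.map f b` have the type recorded in the pattern, so the order of
      -- their supports is their special order. Rigidity of `hat` gives a preimage `b₁` of `a`
      -- before `b`; it has the type of `b`, so its support precedes that of `b`.
      edge-in-order : ∀ {r x xs y ys} → IA.Valid (suc r , x , xs) → IB.Valid (suc r , y , ys) →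
                      ¬ Collapsed y ys → (suc r , x , xs) IA.≺ (suc r , f y , List.map f ys) →
                      Preceded (suc r , x , xs) (suc r , y , ys)
      edge-in-order _ _ _ (inj₁ p) = ⊥-elim (ℕ.<-irrefl refl p)
      edge-in-order {r} {x} {xs} {y} {ys} ((s↑ , len , a , a∈θ , a-type , a-entries) , ne)
        (e@(t↑ , _ , b , b∈θ , b-type , b-entries) , _) ¬c (inj₂ (_ , x<fy))
        with IsRigidSurjection.rigid (hatRigidSurjection (proj₁ (rep r))) {a , a∈θ} {Vec.map f b , isHomomorphism b∈θ}
               (inj₂ (a∼fb , (λ a≐fb → alex-irrefl a≐fb a<fb) , a<fb))
        where
        fb-type : A.type (Vec.map f b) ≡ proj₁ (proj₂ (rep r))
        fb-type = trans (sym (table-cong (tp-map B.isStrictTotalOrder A.isStrictTotalOrder b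
          (strong b∈θ (spread-out b-entries ¬c))))) b-type
        a∼fb : tp A._⊏_ a ⇔ tp A._⊏_ (Vec.map f b)
        a∼fb = table-reflects (trans a-type (sym fb-type))
        a<fb : Alex A._⊏_ (entries a) (entries (Vec.map f b))
        a<fb = alex-resp (≐-sym a-entries) (≐-sym (entries-map b-entries)) x<fy
      ... | (b₁ , b₁∈θ) , (b₂ , b₂∈θ) , (fb₁≡a , _) , (_ , b₂≤) , b₁<b₂ with refl ← fb₁≡a
        with lift-edge {r} s↑ len ne b₁∈θ a-type a-entries
      ... | z , zs , supp , v , pushed , b₁-type = (suc r , z , zs) , v , pushed , inj₂ (refl , z<y b₁<b)
        where
        b₁<b : Sal B._⊏_ b₁ b
        b₁<b = case b₂≤ {b , b∈θ} refl of λ where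
          (inj₁ b₂<b) → IsStrictPartialOrder.trans (B.⊏sal-isStrictPartialOrder {proj₁ (rep r)})
                          {b₁ , b₁∈θ} {b₂ , b₂∈θ} {b , b∈θ} b₁<b₂ b₂<b
          (inj₂ refl) → b₁<b₂
        z<y : Sal B._⊏_ b₁ b → Alex B._⊏_ (List._∈ (z ∷ zs)) (List._∈ (y ∷ ys))
        z<y (inj₁ p) = ⊥-elim (◁-irrefl (table-reflects (trans b₁-type (sym b-type))) p)
        z<y (inj₂ (_ , _ , p)) = alex-resp
          (subst (λ s → entries b₁ ≐ (List._∈ s)) supp (B.support-entries b₁)) b-entries p

      push-in-order : ∀ a b → IA.Valid a → IB.Valid b → a IA.≺ push b → Preceded a b
      push-in-order a (r , y , ys) va vb a≺ with em {Collapsed y ys}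
      -- Only vertices lie below the vertex to which the item collapses.
      push-in-order (zero , x , .[]) (r , y , ys) refl vb (inj₂ (_ , p)) | yes _ =
        vertex-in-order {r = r} vb (A.singleton⁻ (λ { (here e) → e }) (λ { (here e) → e }) (here refl) (here refl) p)
      push-in-order a (zero , y , .[]) va refl a≺ | no ¬c = ⊥-elim (¬c vertex-collapsed)
      push-in-order a (suc r , y , ys) va vb (inj₁ p) | no ¬c with push-onto a va
      ... | b′ , v′ , same , pushed = b′ , v′ , pushed , inj₁ (subst (Fin._< suc r) (sym same) p)
      push-in-order (_ , x , xs) (suc r , y , ys) va vb (inj₂ (refl , p)) | no ¬c =
        edge-in-order va vb ¬c (inj₂ (refl , p))

      pushIndex : Fin IB.size → Fin IA.size
      pushIndex i = proj₁ (IA.index (push (IB.item i)) (push-valid _ (IB.item-valid i)))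

      item-pushIndex : ∀ i → IA.item (pushIndex i) ≡ push (IB.item i)
      item-pushIndex i = proj₂ (IA.index (push (IB.item i)) (push-valid _ (IB.item-valid i)))

      pushIndex-onto : Onto-in-order pushIndex
      pushIndex-onto = record { onto = onto ; in-order = in-order }
        where
        locate : ∀ j b → IB.Valid b → push b ≡ IA.item j → ∃ λ i → IB.item i ≡ b × pushIndex i ≡ j
        locate j b v e = let i , at = IB.index b v in
          i , at , IA.item-injective (trans (item-pushIndex i) (trans (cong push at) e))
        onto : ∀ j → ∃ λ i → pushIndex i ≡ j
        onto j = let b , v , _ , e = push-onto (IA.item j) (IA.item-valid j)
                     i , _ , p = locate j b v e
                 in i , p
        in-order : ∀ i j → j Fin.< pushIndex i → ∃ λ i′ → i′ Fin.< i × pushIndex i′ ≡ j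
        in-order i j j< =
          let b , v , e , b≺ = push-in-order (IA.item j) (IB.item i) (IA.item-valid j) (IB.item-valid i)
                                 (subst (IA.item j IA.≺_) (item-pushIndex i) (IA.item-mono j<))
              i′ , at , p = locate j b v e
          in i′ , IB.item-reflects (subst (IB._≺ IB.item i) (sym at) b≺) , p

    -- The structure of blocks and the maps realised on it

    module Blocks (n N : ℕ) (cls : Pattern → Fin R) where

      size : Fin R → ℕ
      size r = proj₂ (proj₂ (rep r))

      -- The cells (j , suc r , i) with i < size r form an edge of pattern rep r; the
      -- remaining cells, in particular those of sort zero, lie in no edge.
      Cell : Set
      Cell = Fin n × Fin (suc R) × Fin (suc N)

      code : Cell → Fin (n ℕ.* (suc R ℕ.* suc N))
      code (j , r , i) = Fin.combine j (Fin.combine r i)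

      code-injective : ∀ {c d} → code c ≡ code d → c ≡ d
      code-injective {j , r , i} {j′ , r′ , i′} e
        with refl , e′ ← Fin.combine-injective j (Fin.combine r i) j′ (Fin.combine r′ i′) e
        with refl , refl ← Fin.combine-injective r i r′ i′ e′ = refl

      infix 4 _◂_
      _◂_ : Rel Cell 0ℓ
      c ◂ d = code c Fin.< code d

      combine-monoʳ-< : ∀ {m k} (j : Fin m) {x y : Fin k} → x Fin.< y →
                        Fin.combine j x Fin.< Fin.combine j y
      combine-monoʳ-< {k = k} j {x} {y} x<y = subst₂ _<_ (sym (Fin.toℕ-combine j x)) (sym (Fin.toℕ-combine j y))
        (ℕ.+-monoʳ-< (k ℕ.* toℕ j) x<y)

      ◂-earlier : ∀ {j j′ r r′ i i′} → j Fin.< j′ → (j , r , i) ◂ (j′ , r′ , i′)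
      ◂-earlier {r = r} {r′} {i} {i′} p = Fin.combine-monoˡ-< (Fin.combine r i) (Fin.combine r′ i′) p

      ◂-within : ∀ {j r i i′} → i Fin.< i′ → (j , r , i) ◂ (j , r , i′)
      ◂-within {j} {r} p = combine-monoʳ-< j (combine-monoʳ-< r p)

      ◂-sto : IsStrictTotalOrder _≡_ _◂_
      ◂-sto = record
        { isStrictPartialOrder = record
          { isEquivalence = isEquivalence
          ; irrefl        = λ { refl → ℕ.<-irrefl refl }
          ; trans         = Fin.<-trans
          ; <-resp-≈      = (λ { refl p → p }) , (λ { refl p → p })
          }
        ; compare = λ c d → case Fin.<-cmp (code c) (code d) of λ where
            (tri< p q s) → tri< p (λ e → q (cong code e)) s
            (tri≈ p q s) → tri≈ p (code-injective q) s
            (tri> p q s) → tri> p (λ e → q (cong code e)) s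
        }

      ◂-within⁻ : ∀ {j r i i′} → (j , r , i) ◂ (j , r , i′) → i Fin.< i′
      ◂-within⁻ {j} {r} {i} {i′} p with Fin.<-cmp i i′
      ... | tri< q _ _    = q
      ... | tri≈ _ refl _ = ⊥-elim (ℕ.<-irrefl refl p)
      ... | tri> _ _ q    = ⊥-elim (ℕ.<-asym p (◂-within {j} {r} q))

      -- Each block has a least cell outside all edges, available as the least preimage of a vertex.
      corner-least : ∀ {j r i} → (j , zero , zero) ◂ (j , r , i) ⊎ (j , zero , zero) ≡ (j , r , i)
      corner-least {j} {r} {i} with Fin.combine r i in e
      ... | zero  = inj₂ (code-injective {j , zero , zero} {j , r , i} (cong (Fin.combine j) (sym e)))
      ... | suc x = inj₁ (combine-monoʳ-< j {zero} {suc x} (s≤s z≤n))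

      corner-≤ : ∀ {j j′ r i} → j Fin.≤ j′ →
                 (j , zero , zero) ◂ (j′ , r , i) ⊎ (j , zero , zero) ≡ (j′ , r , i)
      corner-≤ {j} {j′} {r} {i} p with Fin.<-cmp j j′
      ... | tri< q _ _    = inj₁ (◂-earlier {r = zero} {r} {zero} {i} q)
      ... | tri≈ _ refl _ = corner-least {j} {r} {i}
      ... | tri> _ _ q    = ⊥-elim (ℕ.<⇒≱ q p)

      Block : Fin n → Fin R → Pred Cell 0ℓ
      Block j r (j′ , r′ , i) = j′ ≡ j × r′ ≡ suc r × toℕ i < size r

      blocks : Structure Θ
      blocks = record
        { Carrier            = Cell
        ; finite             = n ℕ.* (suc R ℕ.* suc N) , ↔-sym (↔-trans Fin.*↔× (↔-refl ×-↔ Fin.*↔×))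
        ; _⊏_                = _◂_
        ; isStrictTotalOrder = ◂-sto
        -- Besides constant tuples: those whose entries fill the edge, in one block, of the sort
        -- representing their own type.
        ; rel                = λ θ x → Const x ⊎
            ∃₂ λ k j → entries x ≐ Block j (cls (θ , table (tp _◂_ x) , k))
        ; reflexive          = λ θ a → inj₁ (replicate-const {a = a})
        }

      private module C = Ordered blocks

      module Realise (𝓧 : Structure Θ) (x₀ : Structure.Carrier 𝓧)
        (size≤N  : ∀ r → size r ≤ N)
        (cls-rep : ∀ p {s} → (Ordered.Edge 𝓧 p s → Ordered.Edge 𝓧 (rep (cls p)) s) ×
                             (Ordered.Edge 𝓧 (rep (cls p)) s → Ordered.Edge 𝓧 p s))
        (φ : Fin n → Fin (Items.size 𝓧)) (φ-rigid : Rigid φ) where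

        private module X = Ordered 𝓧
        open Items 𝓧 hiding (size)
        open Rigid φ-rigid

        fun : Cell → X.Carrier
        fun (j , r , i) = value (item (φ j)) r (toℕ i)

        record OnEdge {θ} (x : Vec Cell (arity θ)) : Set where
          field
            {place} : Fin n
            {k}     : ℕ
            {y}     : X.Carrier
            {ys}    : List X.Carrier
            block   : entries x ≐ Block place (cls (θ , C.type x , k))
            here-is : item (φ place) ≡ (suc (cls (θ , C.type x , k)) , y , ys)
            edge    : X.Edge (θ , C.type x , k) (y ∷ ys)
            mono    : ∀ i j → lookup x i ◂ lookup x j → fun (lookup x i) X.⊏ fun (lookup x j)
            image   : entries (Vec.map fun x) ≐ (List._∈ (y ∷ ys))

        -- An item of another sort would send the whole block edge to its first vertex. So the item
        -- at this block has the sort of the edge, `cls-rep` takes it from the representative back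
        -- to the pattern of `x`, and the block edge is read along it in increasing order.
        on-edge : ∀ {θ} {x : Vec Cell (arity θ)} → x ∈ C.rel θ →
                  ¬ (∀ i j → fun (lookup x i) ≡ fun (lookup x j)) → OnEdge {θ} x
        on-edge (inj₁ c) ¬c = ⊥-elim (¬c λ i j → cong fun (c i j))
        on-edge {θ} {x} (inj₂ (k , j , block)) ¬c = go (item (φ j)) refl
          where
          r : Fin R
          r = cls (θ , C.type x , k)

          cell : ∀ i → ∃ λ m → lookup x i ≡ (j , suc r , m) × toℕ m < size r
          cell i with lookup x i | proj₁ block (Vec.∈-lookup i x)
          ... | _ , _ , m | refl , refl , m< = m , refl , m<

          go : ∀ a → item (φ j) ≡ a → OnEdge {θ} x
          go (s , y , ys) e with s Fin.≟ suc r
          ... | no s≢ = ⊥-elim (¬c λ i i′ → trans (first-vertex i) (sym (first-vertex i′)))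
            where
            first-vertex : ∀ i → fun (lookup x i) ≡ y
            first-vertex i with cell i
            ... | m , at , _ = trans (cong fun at)
              (trans (cong (λ a → value a (suc r) (toℕ m)) e) (value-other (toℕ m) s≢))
          ... | yes refl = record
            { block = block ; here-is = e ; edge = edge ; mono = mono ; image = to , from }
            where
            edge′ : X.Edge (rep r) (y ∷ ys)
            edge′ = proj₁ (subst Valid e (item-valid (φ j)))

            edge : X.Edge (θ , C.type x , k) (y ∷ ys)
            edge = proj₂ (cls-rep (θ , C.type x , k)) edge′

            len : length (y ∷ ys) ≡ size r
            len = proj₁ (proj₂ edge′)

            at-cell : ∀ m → fun (j , suc r , m) ≡ nth y (y ∷ ys) (toℕ m)
            at-cell m = trans (cong (λ a → value a (suc r) (toℕ m)) e) (value-own (suc r) y ys (toℕ m))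

            mono : ∀ i i′ → lookup x i ◂ lookup x i′ → fun (lookup x i) X.⊏ fun (lookup x i′)
            mono i i′ p with lookup x i | lookup x i′ | cell i | cell i′
            ... | _ | _ | m , refl , _ | m′ , refl , m′< =
              subst₂ X._⊏_ (sym (at-cell m)) (sym (at-cell m′))
                (nth-mono (proj₁ edge′) (◂-within⁻ {j} {suc r} {m} {m′} p) (subst (toℕ m′ <_) (sym len) m′<))

            to : ∀ {v} → v Vec.∈ Vec.map fun x → v List.∈ (y ∷ ys)
            to v∈ with entry v∈
            ... | i , refl with cell i
            ... | m , at , _ = subst (List._∈ (y ∷ ys))
              (sym (trans (Vec.lookup-map i fun x) (trans (cong fun at) (at-cell m))))
              (case nth-member y (y ∷ ys) (toℕ m) of λ where
                (inj₁ e)  → here e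
                (inj₂ v∈) → v∈)

            from : ∀ {v} → v List.∈ (y ∷ ys) → v Vec.∈ Vec.map fun x
            from v∈ with member-index v∈
            ... | i , refl = subst (Vec._∈ Vec.map fun x)
                (trans (at-cell m) (trans (cong (nth y (y ∷ ys)) (Fin.toℕ-inject≤ i i≤)) (nth-lookup y (y ∷ ys) i)))
                (Vec.∈-map⁺ fun (proj₂ block (refl , refl ,
                  subst₂ _<_ (sym (Fin.toℕ-inject≤ i i≤)) len (Fin.toℕ<n i))))
              where
              i≤ : length (y ∷ ys) ≤ suc N
              i≤ = ℕ.≤-trans (ℕ.≤-reflexive len) (ℕ.m≤n⇒m≤1+n (size≤N r))
              m : Fin (suc N)
              m = Fin.inject≤ i i≤

        on-edge-type : ∀ {θ} {x : Vec Cell (arity θ)} → OnEdge {θ} x →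
                       tp _◂_ x ⇔ tp X._⊏_ (Vec.map fun x)
        on-edge-type {x = x} E = tp-map ◂-sto X.isStrictTotalOrder x (OnEdge.mono E)

        const∈rel : ∀ {θ} (x : Vec X.Carrier (arity θ)) → Const x → x ∈ X.rel θ
        const∈rel {θ} x c with const-replicate x x₀ c
        ... | a , refl = X.reflexive θ a

        -- If the image is constant, reflexivity applies. Otherwise the item supplies a related
        -- tuple with the type and the entries of the image, and these two determine a tuple.
        isHomomorphism : IsHomomorphism blocks 𝓧 fun
        isHomomorphism {θ} {x} x∈θ with em {∀ i j → fun (lookup x i) ≡ fun (lookup x j)}
        ... | yes c = const∈rel (Vec.map fun x) (map-const x c)
        ... | no ¬c with on-edge {θ} x∈θ ¬c
        ... | E with OnEdge.edge E
        ... | _ , _ , z , z∈θ , z-type , z-entries = subst (_∈ X.rel θ)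
          (X.tuple-unique (⇔-trans (table-reflects z-type) (on-edge-type E))
                          (≐-trans z-entries (≐-sym (OnEdge.image E))))
          z∈θ

        hat : ∀ θ → C.Tuples θ → X.Tuples θ
        hat θ (x , x∈θ) = Vec.map fun x , isHomomorphism {θ} x∈θ

        vertexIndex : ∀ x → ∃ λ i → item i ≡ (zero , x , [])
        vertexIndex x = index (zero , x , []) refl

        vertex : X.Carrier → Cell
        vertex x = min (proj₁ (vertexIndex x)) , zero , zero

        fun-vertex : ∀ x → fun (vertex x) ≡ x
        fun-vertex x = cong (λ a → value a zero 0)
          (trans (cong item (φ-min (proj₁ (vertexIndex x)))) (proj₂ (vertexIndex x)))

        min-mono-≤ : ∀ {i j} → i Fin.≤ j → min i Fin.≤ min j
        min-mono-≤ {i} {j} p with Fin.<-cmp i j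
        ... | tri< q _ _    = ℕ.<⇒≤ (min-mono q)
        ... | tri≈ _ refl _ = ℕ.≤-refl
        ... | tri> _ _ q    = ⊥-elim (ℕ.<⇒≱ q p)

        -- If `c` in block `j` has value `x`, then `item (φ j)` is the vertex `x` or an edge, and
        -- all vertices precede edges. So the index of `x` is at most `φ j`, and its first block is
        -- at most `j`.
        vertex-least : ∀ {x c} → fun c ≡ x → vertex x ◂ c ⊎ vertex x ≡ c
        vertex-least {x} {j , r , i} e = corner-≤ {r = r} {i} (ℕ.≤-trans (min-mono-≤ before) (min-≤ j))
          where
          v : Fin (Items.size 𝓧)
          v = proj₁ (vertexIndex x)

          before : v Fin.≤ φ j
          before = from-item (item (φ j)) refl (item-valid (φ j))
            where
            from-item : ∀ a → item (φ j) ≡ a → Valid a → v Fin.≤ φ j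
            from-item (zero , y , .[]) at refl = ℕ.≤-reflexive (cong toℕ (item-injective
              (trans (proj₂ (vertexIndex x)) (trans (cong (λ x → zero , x , [])
                (trans (sym e) (trans (cong (λ a → value a r (toℕ i)) at) (value-vertex zero y r (toℕ i))))) (sym at)))))
            from-item (suc s , y , ys) at _ = ℕ.<⇒≤ (item-reflects
              (subst₂ _≺_ (sym (proj₂ (vertexIndex x))) (sym at) (inj₁ (s≤s z≤n))))

        vertex-mono : ∀ {x y} → x X.⊏ y → vertex x ◂ vertex y
        vertex-mono {x} {y} p = ◂-earlier {r = zero} {zero} {zero} {zero} (min-mono (item-reflects
          (subst₂ _≺_ (sym (proj₂ (vertexIndex x))) (sym (proj₂ (vertexIndex y)))
            (inj₂ (refl , X.singleton⁺ (λ { (here e) → e }) (λ { (here e) → e }) (here refl) p)))))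

        rigidSurjection : IsRigidSurjection _≡_ _◂_ _≡_ X._⊏_ fun
        rigidSurjection = record
          { surjective = λ x → vertex x , λ { refl → fun-vertex x }
          ; rigid      = λ {x} {y} p → vertex x , vertex y ,
              (fun-vertex x , vertex-least) , (fun-vertex y , vertex-least) , vertex-mono p
          }

        strong : ∀ {θ x} → x ∈ C.rel θ → ¬ (∀ i j → fun (lookup x i) ≡ fun (lookup x j)) →
                 ∀ i j → lookup x i ◂ lookup x j → fun (lookup x i) X.⊏ fun (lookup x j)
        strong {θ} x∈θ ¬c = OnEdge.mono (on-edge {θ} x∈θ ¬c)

        record Lift {θ} (y : Vec X.Carrier (arity θ)) : Set where
          field
            x     : Vec Cell (arity θ)
            x∈θ   : x ∈ C.rel θ
            fun-x : Vec.map fun x ≡ y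
            least : ∀ {z} → z ∈ C.rel θ → Vec.map fun z ≡ y → Sal _◂_ x z ⊎ x ≡ z

        -- Nonconstant preimages come later by their type, constant ones by `vertex-least`.
        vertex-lift : ∀ {θ} a → Lift {θ} (Vec.replicate (arity θ) a)
        vertex-lift {θ} a = record
          { x     = Vec.replicate (arity θ) (vertex a)
          ; x∈θ   = inj₁ (replicate-const {a = vertex a})
          ; fun-x = trans (Vec.map-replicate fun (vertex a) (arity θ))
                          (cong (Vec.replicate (arity θ)) (fun-vertex a))
          ; least = λ {z} _ fz≡ → least z fz≡
          }
          where
          least-const : ∀ {r} (z : Vec Cell r) → Const z → Vec.map fun z ≡ Vec.replicate r a →
                        Sal _◂_ (Vec.replicate r (vertex a)) z ⊎ Vec.replicate r (vertex a) ≡ z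
          least-const [] _ _ = inj₂ refl
          least-const {suc r} z cz fz≡ = at (const-replicate z (vertex x₀) cz) fz≡
            where
            at : ∀ {z} → (∃ λ c → z ≡ Vec.replicate (suc r) c) → Vec.map fun z ≡ Vec.replicate (suc r) a →
                 Sal _◂_ (Vec.replicate (suc r) (vertex a)) z ⊎ Vec.replicate (suc r) (vertex a) ≡ z
            at (c , refl) fz≡ = Sum.map (C.replicate-sal r) (cong (Vec.replicate (suc r)))
                                  (vertex-least (cong Vec.head fz≡))

          least : ∀ z → Vec.map fun z ≡ Vec.replicate (arity θ) a →
                  Sal _◂_ (Vec.replicate (arity θ) (vertex a)) z ⊎ Vec.replicate (arity θ) (vertex a) ≡ z
          least z fz≡ = case em {Const z} of λ where
            (yes cz) → least-const z cz fz≡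
            (no ¬cz) → inj₁ (inj₁ (C.const-before (Vec.replicate (arity θ) (vertex a)) z (replicate-const {a = vertex a}) ¬cz))

        vertex-lift-mono : ∀ {r a b} → Sal X._⊏_ (Vec.replicate r a) (Vec.replicate r b) →
                           Sal _◂_ (Vec.replicate r (vertex a)) (Vec.replicate r (vertex b))
        vertex-lift-mono {zero}  p = ⊥-elim (IsStrictPartialOrder.irrefl
          (sal-isStrictPartialOrder X.isStrictTotalOrder X.elements X.elements-complete) refl p)
        vertex-lift-mono {suc r} p = C.replicate-sal r (vertex-mono (X.replicate-sal⁻ r p))

        -- The last cell of the later edge is the witness: no cell of either edge lies above it.
        blocks-alex : ∀ {j j′ r} → j Fin.< j′ → 0 < size r → Alex _◂_ (Block j r) (Block j′ r)
        blocks-alex {j} {j′} {r} j<j′ 0<size = C.alex-witness ((j′ , suc r , last) ,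
          (λ { (refl , _) → ℕ.<-irrefl refl j<j′ }) , (refl , refl , ℕ.≤-reflexive toℕ-last) , above)
          where
          last< : ℕ.pred (size r) < suc N
          last< = s≤s (ℕ.≤-trans ℕ.pred[n]≤n (size≤N r))
          last : Fin (suc N)
          last = Fin.fromℕ< last<
          toℕ-last : suc (toℕ last) ≡ size r
          toℕ-last = trans (cong suc (Fin.toℕ-fromℕ< last<)) (ℕ.suc-pred (size r) {{ℕ.>-nonZero 0<size}})
          above : ∀ {c} → (j′ , suc r , last) ◂ c → (Block j r c → Block j′ r c) × (Block j′ r c → Block j r c)
          above {_ , _ , i} p =
            (λ { (refl , refl , _) → ⊥-elim (ℕ.<-asym p (◂-earlier {r = suc r} {suc r} {i} {last} j<j′)) }) ,
            (λ { (refl , refl , i<) → ⊥-elim (ℕ.<-irrefl refl (ℕ.<-≤-trans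
                 (ℕ.≤-<-trans (ℕ.≤-reflexive (sym toℕ-last)) (s≤s (◂-within⁻ {j′} {suc r} {last} {i} p))) i<)) })

        -- The least preimage of a nonconstant tuple lies on the first block whose item is the
        -- support of `y` in the sort of its pattern; each entry is replaced by the cell of its
        -- rank.
        module EdgeLift {θ} {y : Vec X.Carrier (arity θ)} (y∈θ : y ∈ X.rel θ) (¬c : ¬ Const y) where

          pattern-of : Pattern
          pattern-of = θ , X.type y , length (X.support y)

          r : Fin R
          r = cls pattern-of

          edge : X.Edge (rep r) (X.support y)
          edge = proj₁ (cls-rep pattern-of) (X.support-inc y , refl , y , y∈θ , refl , X.support-entries y)

          support-cons : ∃₂ λ v vs → X.support y ≡ v ∷ vs × vs ≢ []
          support-cons = X.nonconst-support y ¬c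

          v : X.Carrier
          v = proj₁ support-cons

          vs : List X.Carrier
          vs = proj₁ (proj₂ support-cons)

          support≡ : X.support y ≡ v ∷ vs
          support≡ = proj₁ (proj₂ (proj₂ support-cons))

          located : ∃ λ i → item i ≡ (suc r , v , vs)
          located = index (suc r , v , vs) (subst (X.Edge (rep r)) support≡ edge , proj₂ (proj₂ (proj₂ support-cons)))

          j : Fin n
          j = min (proj₁ located)

          len : length (X.support y) ≡ size r
          len = proj₁ (proj₂ edge)

          0<size : 0 < size r
          0<size = subst (0 <_) (trans (cong length (sym support≡)) len) (s≤s z≤n)

          len≤ : length (X.support y) ≤ suc N
          len≤ = ℕ.≤-trans (ℕ.≤-reflexive len) (ℕ.m≤n⇒m≤1+n (size≤N r))

          cell : Fin (length (X.support y)) → Cell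
          cell m = j , suc r , Fin.inject≤ m len≤

          position : ∀ i → ∃ λ m → List.lookup (X.support y) m ≡ lookup y i
          position i = member-index (proj₁ (X.support-entries y) (Vec.∈-lookup i y))

          x : Vec Cell (arity θ)
          x = tabulate λ i → cell (proj₁ (position i))

          lookup-x : ∀ i → lookup x i ≡ cell (proj₁ (position i))
          lookup-x = Vec.lookup∘tabulate _

          fun-cell : ∀ m → fun (cell m) ≡ List.lookup (X.support y) m
          fun-cell m = begin
            value (item (φ j)) (suc r) (toℕ (Fin.inject≤ m len≤))
              ≡⟨ cong (λ a → value a (suc r) (toℕ (Fin.inject≤ m len≤)))
                      (trans (cong item (φ-min (proj₁ located))) (proj₂ located)) ⟩
            value (suc r , v , vs) (suc r) (toℕ (Fin.inject≤ m len≤))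
              ≡⟨ value-own (suc r) v vs _ ⟩
            nth v (v ∷ vs) (toℕ (Fin.inject≤ m len≤))
              ≡⟨ cong₂ (nth v) (sym support≡) (Fin.toℕ-inject≤ m len≤) ⟩
            nth v (X.support y) (toℕ m)
              ≡⟨ nth-lookup v (X.support y) m ⟩
            List.lookup (X.support y) m ∎
            where open ≡-Reasoning

          fun-x : Vec.map fun x ≡ y
          fun-x = vec-ext (Vec.map fun x) y λ i → trans (Vec.lookup-map i fun x)
            (trans (cong fun (lookup-x i)) (trans (fun-cell _) (proj₂ (position i))))

          type-x : tp X._⊏_ y ⇔ tp _◂_ x
          type-x = tp-intro X.isStrictTotalOrder ◂-sto y x
            (λ i i′ p → subst₂ _◂_ (sym (lookup-x i)) (sym (lookup-x i′))
              (◂-within {j} {suc r} (subst₂ _<_ (sym (Fin.toℕ-inject≤ _ len≤)) (sym (Fin.toℕ-inject≤ _ len≤))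
                (lookup-reflects-< X.isStrictTotalOrder (X.support-inc y)
                  (subst₂ X._⊏_ (sym (proj₂ (position i))) (sym (proj₂ (position i′))) p)))))
            (λ i i′ e → trans (lookup-x i) (trans (cong cell
              (lookup-reflects-≡ X.isStrictTotalOrder (X.support-inc y)
                (trans (proj₂ (position i)) (trans e (sym (proj₂ (position i′)))))))
              (sym (lookup-x i′))))

          block : entries x ≐ Block j r
          block = to , from
            where
            to : ∀ {c} → c Vec.∈ x → Block j r c
            to c∈ = let i , at = entry c∈ in subst (Block j r) (trans (sym (lookup-x i)) at)
              (refl , refl , subst₂ _<_ (sym (Fin.toℕ-inject≤ _ len≤)) len (Fin.toℕ<n _))
            from : ∀ {c} → Block j r c → c Vec.∈ x
            from {_ , _ , i} (refl , refl , i<) = go (entry (proj₂ (X.support-entries y) (List.∈-lookup m)))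
              where
              i<′ : toℕ i < length (X.support y)
              i<′ = subst (toℕ i <_) (sym len) i<
              m : Fin (length (X.support y))
              m = Fin.fromℕ< i<′
              at : cell m ≡ (j , suc r , i)
              at = cong (λ i → j , suc r , i) (Fin.toℕ-injective (trans (Fin.toℕ-inject≤ m len≤) (Fin.toℕ-fromℕ< i<′)))
              go : (∃ λ k → lookup y k ≡ List.lookup (X.support y) m) → (j , suc r , i) Vec.∈ x
              go (k , e) = subst (Vec._∈ x)
                (trans (lookup-x k) (trans (cong cell (lookup-reflects-≡ X.isStrictTotalOrder (X.support-inc y)
                  (trans (proj₂ (position k)) e))) at))
                (Vec.∈-lookup k x)

          x∈θ : x ∈ C.rel θ
          x∈θ = inj₂ (length (X.support y) , j ,
            subst (λ M → entries x ≐ Block j (cls (θ , M , length (X.support y)))) (table-cong type-x) block)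

          -- A preimage `z` has the type and support of `y`, hence the same pattern and the same
          -- item, so its block is not before `j`. In a later block its support is larger; in block
          -- `j` type and entries force `z` to be `x`.
          least : ∀ {z} → z ∈ C.rel θ → Vec.map fun z ≡ y → Sal _◂_ x z ⊎ x ≡ z
          least {z} z∈θ fz≡y = go (on-edge {θ} z∈θ λ c → ¬c (subst Const fz≡y (map-const z c)))
            where
            go : OnEdge {θ} z → Sal _◂_ x z ⊎ x ≡ z
            go E = compare-places (Fin.<-cmp j place)
              where
              open OnEdge E using (place; k; ys; here-is) renaming (y to u; block to z-block; edge to z-edge; image to z-image)

              support-z : u ∷ ys ≡ X.support y
              support-z = X.inc-unique (proj₁ z-edge) (X.support-inc y)
                (≐-trans (≐-sym z-image) (subst (λ w → entries w ≐ (List._∈ X.support y)) (sym fz≡y) (X.support-entries y)))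

              same-pattern : (θ , C.type z , k) ≡ pattern-of
              same-pattern = cong₂ (λ M k → θ , M , k)
                (trans (table-cong (on-edge-type E)) (cong X.type fz≡y))
                (trans (sym (proj₁ (proj₂ z-edge))) (cong length support-z))

              here-is′ : item (φ place) ≡ (suc r , v , vs)
              here-is′ = trans here-is (cong₂ (λ p s → suc (cls p) , s) same-pattern (cons-injective (trans support-z support≡)))
                where
                cons-injective : ∀ {X : Set} {a b : X} {as bs : List X} → a ∷ as ≡ b ∷ bs → (a , as) ≡ (b , bs)
                cons-injective refl = refl

              j≤place : j Fin.≤ place
              j≤place = subst (λ i → min i Fin.≤ place)
                (item-injective (trans here-is′ (sym (proj₂ located)))) (min-≤ place)

              z-block′ : entries z ≐ Block place r
              z-block′ = subst (λ p → entries z ≐ Block place (cls p)) same-pattern z-block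

              x∼z : tp _◂_ x ⇔ tp _◂_ z
              x∼z = ⇔-trans (⇔-sym type-x)
                (⇔-sym (subst (λ w → tp _◂_ z ⇔ tp X._⊏_ w) fz≡y (on-edge-type E)))

              compare-places : _ → Sal _◂_ x z ⊎ x ≡ z
              compare-places (tri< p _ _) = inj₁ (inj₂ (x∼z , (λ e → alex-irrefl e x<z) , x<z))
                where
                x<z : Alex _◂_ (entries x) (entries z)
                x<z = alex-resp (≐-sym block) (≐-sym z-block′) (blocks-alex p 0<size)
              compare-places (tri≈ _ e _) = inj₂ (C.tuple-unique x∼z
                (≐-trans block (≐-sym (subst (λ j → entries z ≐ Block j r) (sym e) z-block′))))
              compare-places (tri> _ _ p) = ⊥-elim (ℕ.<⇒≱ p j≤place)

          lift : Lift {θ} y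
          lift = record { x = x ; x∈θ = x∈θ ; fun-x = fun-x ; least = λ {z} → least {z} }

        -- Lifting keeps types, which settles different types. For equal types the supports are
        -- items of one sort in the same order, and `min` carries this order to the blocks.
        edge-lift-mono : ∀ {θ} {y y′ : Vec X.Carrier (arity θ)}
          (y∈θ : y ∈ X.rel θ) (¬c : ¬ Const y) (y′∈θ : y′ ∈ X.rel θ) (¬c′ : ¬ Const y′) →
          Sal X._⊏_ y y′ → Sal _◂_ (EdgeLift.x {θ} y∈θ ¬c) (EdgeLift.x {θ} y′∈θ ¬c′)
        edge-lift-mono {θ} {y} {y′} y∈θ ¬c y′∈θ ¬c′ = go
          where
          module L  = EdgeLift {θ} y∈θ ¬c
          module L′ = EdgeLift {θ} y′∈θ ¬c′
          go : Sal X._⊏_ y y′ → Sal _◂_ L.x L′.x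
          go (inj₁ p) = inj₁ (◁-resp L.type-x L′.type-x p)
          go (inj₂ (y∼y′ , _ , y<y′)) = inj₂
            (⇔-trans (⇔-sym L.type-x) (⇔-trans y∼y′ L′.type-x) , (λ e → alex-irrefl e x<x′) , x<x′)
            where
            same : L.r ≡ L′.r
            same = cong₂ (λ M k → cls (θ , M , k)) (table-cong y∼y′) (X.same-type-length y y′ y∼y′)
            before : (suc L.r , L.v , L.vs) ≺ (suc L′.r , L′.v , L′.vs)
            before = inj₂ (cong suc same , alex-resp
              (subst (λ s → entries y ≐ (List._∈ s)) L.support≡ (X.support-entries y))
              (subst (λ s → entries y′ ≐ (List._∈ s)) L′.support≡ (X.support-entries y′)) y<y′)
            j<j′ : L.j Fin.< L′.j
            j<j′ = min-mono (item-reflects (subst₂ _≺_ (sym (proj₂ L.located)) (sym (proj₂ L′.located)) before))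
            x<x′ : Alex _◂_ (entries L.x) (entries L′.x)
            x<x′ = alex-resp (≐-sym L.block)
              (≐-sym (subst (λ r → entries L′.x ≐ Block L′.j r) (sym same) L′.block)) (blocks-alex j<j′ L.0<size)

        data Kind {θ} : Vec X.Carrier (arity θ) → Set where
          const : ∀ a → Kind (Vec.replicate (arity θ) a)
          edge     : ∀ {y} → y ∈ X.rel θ → ¬ Const y → Kind y

        kind : ∀ {θ} {y : Vec X.Carrier (arity θ)} → y ∈ X.rel θ → Kind {θ} y
        kind {θ} {y} y∈θ with em {Const y}
        ... | no ¬c = edge y∈θ ¬c
        ... | yes c with const-replicate y x₀ c
        ... | a , refl = const a

        lift : ∀ {θ} {y : Vec X.Carrier (arity θ)} → Kind {θ} y → Lift {θ} y
        lift {θ} (const a)  = vertex-lift {θ} a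
        lift {θ} (edge y∈θ ¬c) = EdgeLift.lift {θ} y∈θ ¬c

        lift-mono : ∀ {θ} {y y′ : Vec X.Carrier (arity θ)} (κ : Kind {θ} y) (κ′ : Kind {θ} y′) →
                    Sal X._⊏_ y y′ → Sal _◂_ (Lift.x (lift κ)) (Lift.x (lift κ′))
        lift-mono {θ} (edge y∈θ ¬c) (edge y′∈θ ¬c′) y<y′ = edge-lift-mono {θ} y∈θ ¬c y′∈θ ¬c′ y<y′
        -- Impossible, since constant tuples precede nonconstant ones.
        lift-mono {θ} {y} {y′} (edge y∈θ ¬c) (const a) y<y′ =
          ⊥-elim (IsStrictPartialOrder.irrefl salX refl (IsStrictPartialOrder.trans salX y<y′
            (inj₁ (X.const-before y′ y (replicate-const {a = a}) ¬c))))
          where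
          salX : IsStrictPartialOrder _≡_ (Sal X._⊏_ {arity θ})
          salX = sal-isStrictPartialOrder X.isStrictTotalOrder X.elements X.elements-complete
        lift-mono {θ} (const a) (edge y′∈θ ¬c′) y<y′ =
          inj₁ (C.const-before (Vec.replicate (arity θ) (vertex a)) (EdgeLift.x {θ} y′∈θ ¬c′) (replicate-const {a = vertex a}) λ c → ¬c′
            (subst Const (EdgeLift.fun-x {θ} y′∈θ ¬c′)
              (map-const (EdgeLift.x {θ} y′∈θ ¬c′) λ i j → cong fun (c i j))))
        lift-mono {θ} (const a) (const b) y<y′ = vertex-lift-mono y<y′

        hatRigidSurjection : ∀ θ → IsRigidSurjection C._≈ᵗ_ C._⊏sal_ X._≈ᵗ_ X._⊏sal_ (hat θ)
        hatRigidSurjection θ = record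
          { surjective = λ (y , y∈θ) → tuple y∈θ , λ z≈ → trans (cong (Vec.map fun) z≈) (Lift.fun-x (lift (kind {θ} y∈θ)))
          ; rigid      = λ {(y , y∈θ)} {(y′ , y′∈θ)} y<y′ → tuple y∈θ , tuple y′∈θ ,
              (Lift.fun-x (lift (kind {θ} y∈θ)) , λ {(z , z∈θ)} → Lift.least (lift (kind {θ} y∈θ)) {z} z∈θ) ,
              (Lift.fun-x (lift (kind {θ} y′∈θ)) , λ {(z , z∈θ)} → Lift.least (lift (kind {θ} y′∈θ)) {z} z∈θ) ,
              lift-mono (kind {θ} y∈θ) (kind {θ} y′∈θ) y<y′
          }
          where
          tuple : ∀ {y} → y ∈ X.rel θ → C.Tuples θ
          tuple y∈θ = Lift.x (lift (kind {θ} y∈θ)) , Lift.x∈θ (lift (kind {θ} y∈θ))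

        realise : StrongRigidQuotient blocks 𝓧
        realise = record
          { fun                = fun
          ; isHomomorphism     = λ {θ} → isHomomorphism {θ}
          ; rigidSurjection    = rigidSurjection
          ; hatRigidSurjection = hatRigidSurjection
          ; strong             = λ {θ} → strong {θ}
          }

-- Finitely many patterns, and the transfer of the Ramsey property

≤-sum : {A : Set} (f : A → ℕ) → ∀ L i → f (List.lookup L i) ≤ sum (List.map f L)
≤-sum f (x ∷ L) zero    = ℕ.m≤m+n (f x) _
≤-sum f (x ∷ L) (suc i) = ℕ.≤-trans (≤-sum f L i) (ℕ.m≤n+m _ (f x))

-- Patterns realised by the same lists in 𝓐 and in 𝓑 share a representative, so
-- that finitely many patterns suffice even for an infinite language.
module Colouring (em : ExcludedMiddle 0ℓ) (Θ : Language) (𝓐 𝓑 : Structure Θ) where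
  open Classical em
  open Quotients em Θ

  private
    module A = Ordered 𝓐
    module B = Ordered 𝓑

    tests : (𝓧 : Structure Θ) → List (Pattern → Set)
    tests 𝓧 = List.map (λ s p → Ordered.Edge 𝓧 p s) (sublists (Ordered.sortedElements 𝓧))

    abstract
      classified : ∃ λ (L : List Pattern) → ∀ p → ⊤ → ∃ λ q → q List.∈ L × ⊤ ×
                   (∀ {Q} → Q List.∈ (tests 𝓐 List.++ tests 𝓑) → (Q p → Q q) × (Q q → Q p))
      classified = representatives (tests 𝓐 List.++ tests 𝓑) (λ _ → ⊤)

    patterns : List Pattern
    patterns = proj₁ classified

    R : ℕ
    R = length patterns

    rep : Fin R → Pattern
    rep = List.lookup patterns

    cls : Pattern → Fin R
    cls p = proj₁ (member-index (proj₁ (proj₂ (proj₂ classified p tt))))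

    length-of : Pattern → ℕ
    length-of (_ , _ , k) = k

    N : ℕ
    N = sum (List.map length-of patterns)

    cls-rep : ∀ 𝓧 → (∀ {Q} → Q List.∈ tests 𝓧 → Q List.∈ (tests 𝓐 List.++ tests 𝓑)) → ∀ p {s} →
              (Ordered.Edge 𝓧 p s → Ordered.Edge 𝓧 (rep (cls p)) s) ×
              (Ordered.Edge 𝓧 (rep (cls p)) s → Ordered.Edge 𝓧 p s)
    cls-rep 𝓧 included p {s} =
      (λ e → subst (λ q → X.Edge q s) (sym rep≡) (proj₁ (agree (proj₁ e)) e)) ,
      (λ e → proj₂ (agree (proj₁ e)) (subst (λ q → X.Edge q s) rep≡ e))
      where
      module X = Ordered 𝓧
      q : Pattern
      q = proj₁ (proj₂ classified p tt)
      rep≡ : rep (cls p) ≡ q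
      rep≡ = proj₂ (member-index (proj₁ (proj₂ (proj₂ classified p tt))))
      agree : X.Inc s → (X.Edge p s → X.Edge q s) × (X.Edge q s → X.Edge p s)
      agree s↑ = proj₂ (proj₂ (proj₂ (proj₂ classified p tt)))
        (included (List.∈-map⁺ (λ s p → X.Edge p s) (X.inc-listed s↑)))

    module T  = Transfer R rep {𝓑} {𝓐}
    module IA = Items R rep 𝓐
    module IB = Items R rep 𝓑

  -- A chain map is coloured by the colour of the quotient map it realises. Both realisations use
  -- the same `rep` and `cls`, so their source is one structure, with a block for each point of the
  -- Ramsey chain; `a₀` and `b₀` make the chains of items nonempty.
  ramsey : ∀ {k} → Fin k → A.Carrier → B.Carrier → ∃ λ (𝓒 : Structure Θ) →
           (χ : Func (Category.homSetoid (Rel-srq Θ) 𝓒 𝓐) (setoid (Fin k))) →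
           ∃ λ (w : StrongRigidQuotient 𝓒 𝓑) → ∀ (F G : StrongRigidQuotient 𝓑 𝓐) →
           Func.to χ (composeMap F w) ≡ Func.to χ (composeMap G w)
  ramsey {k} d a₀ b₀
    with dualRamsey-chains (proj₁ (IA.index (zero , a₀ , []) refl)) (proj₁ (IB.index (zero , b₀ , []) refl)) d
  ... | n , chains = C.blocks , λ χ →
    let w , w-rigid , κ , mono = chains (λ φ r → Func.to χ (RA.realise φ r))
                                        (λ {φ} {ψ} r s φ≗ψ → Func.cong χ (realise-cong r s φ≗ψ))
        constant-colour = λ F →
          let r , coloured = mono (T.pushIndex F) (T.pushIndex-onto F)
          in trans (Func.cong χ (natural F w w-rigid r)) coloured
    in RB.realise w w-rigid , λ F G → trans (constant-colour F) (sym (constant-colour G))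
    where
    module C  = Blocks R rep n N cls
    module RA = C.Realise 𝓐 a₀ (≤-sum length-of patterns) (cls-rep 𝓐 List.∈-++⁺ˡ)
    module RB = C.Realise 𝓑 b₀ (≤-sum length-of patterns) (cls-rep 𝓑 (List.∈-++⁺ʳ (tests 𝓐)))

    realise-cong : ∀ {φ ψ} (r : Rigid φ) (s : Rigid ψ) → φ ≗ ψ → RA.fun φ r ≗ RA.fun ψ s
    realise-cong r s φ≗ψ (j , c , i) = cong (λ m → value R rep (IA.item m) c (toℕ i)) (φ≗ψ j)

    natural : ∀ F w w-rigid r → StrongRigidQuotient.fun F ∘ RB.fun w w-rigid ≗ RA.fun (T.pushIndex F ∘ w) r
    natural F w w-rigid r (j , c , i) = trans (T.push-value F (IB.item (w j)) c (toℕ i))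
      (cong (λ a → value R rep a c (toℕ i)) (sym (T.item-pushIndex F (w j))))

theorem6p6 : ExcludedMiddle 0ℓ → (Θ : Language) → DualRamsey (Rel-srq Θ)
theorem6p6 em Θ k 2≤k 𝓐 𝓑 F with em {Structure.Carrier 𝓑}
-- The bound on `k` supplies a default colour.
... | yes b₀ = Colouring.ramsey em Θ 𝓐 𝓑 (Fin.fromℕ< 2≤k) (StrongRigidQuotient.fun F b₀) b₀
-- Any two maps out of an empty structure agree, so 𝓑 itself serves.
... | no empty = 𝓑 , λ χ → identityMap , λ F G → Func.cong χ λ b → ⊥-elim (empty b)
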